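{- Let $G=(V,E)$ be a graph with a multiset $R$ of vertices and let $\mathcal{M}$ be a matroid on $R$ of rank $k$ with rank function $r_{\mathcal{M}}$. Then one can check whether $(G,R)$ satisfies all of the following three conditions in $O(k^4|V|^2+k^2|V||R|^2Q)$ time, where $Q$ is the time of the independence oracle of $\mathcal{M}$: (C1) $R_v$ is independent in $\mathcal{M}$ for each $v\in V$; (C2) $|F|+|R_F|\le k|V(F)|-k+r_{\mathcal{M}}(R_F)$ for every non-empty $F\subseteq E$; (C3) $|E|+|R|=k|V|$.
   Context: Graphs are finite and undirected. For $F\subseteq E$, $V(F)$ is the set of vertices incident to edges of $F$. The multiset $R=\{r_1,\dots,r_t\}$ of vertices of $V$ is regarded as an indexed family (different indices are different elements of $R$); a matroid on $R$ has these $t$ elements as ground set. For $v\in V$, $R_v=\{r_i\in R\mid r_i=v\}$, and for $F\subseteq E$, $R_F=\{r_i\in R\mid r_i\in V(F)\}$, as multi-subsets of $R$. The matroid is given by an independence oracle, which decides whether a given subset of $R$ is independent in $\mathcal{M}$ in time $Q$. -}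

module Defs where

open import Level using (0ℓ)
open import Data.Bool using (if_then_else_)
open import Data.Nat using (ℕ; zero; suc; _+_; _*_; _∸_; _^_; _≤_; _<_; _<ᵇ_; _≡ᵇ_)
open import Data.Nat.Properties using (_<?_)
open import Data.Fin using (Fin; toℕ; fromℕ<)
import Data.Fin as Fin
open import Data.Fin.Properties using (any?)
open import Data.Fin.Subset using (Subset; inside; outside; _∈_; _∉_; _⊆_; _∪_; ⁅_⁆; ⊥; ∣_∣; Nonempty)
open import Data.Fin.Subset.Properties using (_∈?_; _⊆?_)
open import Data.List using (List; []; _∷_; map; _++_; filter)
open import Data.List.Extrema.Nat using (max)
open import Data.Product using (∃-syntax; _×_; _,_; proj₁; proj₂)
open import Data.Sum using (_⊎_)
open import Data.Vec using ([]; _∷_; tabulate; lookup)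
open import Relation.Binary.PropositionalEquality using (_≡_; _≢_)
open import Relation.Nullary using (Dec; ¬_; does; yes; no)
open import Relation.Nullary.Decidable using (_×-dec_; _⊎-dec_)
open import Relation.Unary using (Pred; Decidable)

------------------------------------------------------------------------
-- Graphs, with edges as an indexed family: parallel edges and loops are
-- allowed.  The order of the two ends of an edge carries no meaning.

record Graph : Set where
  field
    |V| |E| : ℕ
    ends    : Fin |E| → Fin |V| × Fin |V|

  Incident : Fin |V| → Fin |E| → Set
  Incident v e = v ≡ proj₁ (ends e) ⊎ v ≡ proj₂ (ends e)

  incident? : ∀ v e → Dec (Incident v e)
  incident? v e = (v Fin.≟ proj₁ (ends e)) ⊎-dec (v Fin.≟ proj₂ (ends e))

  V⟨_⟩ : Subset |E| → Subset |V|
  V⟨ F ⟩ = tabulate λ v → does (any? λ e → (e ∈? F) ×-dec incident? v e)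

------------------------------------------------------------------------
-- Matroids on Fin t.  Independence is decidable, as it is given by an oracle.

record Matroid (t : ℕ) : Set₁ where
  field
    Indep      : Pred (Subset t) 0ℓ
    indep?     : Decidable Indep
    ⊥-indep    : Indep ⊥
    hereditary : ∀ {I J} → I ⊆ J → Indep J → Indep I
    augment    : ∀ {I J} → Indep I → Indep J → ∣ I ∣ < ∣ J ∣ →
                 ∃[ x ] x ∈ J × x ∉ I × Indep (I ∪ ⁅ x ⁆)

subsets : ∀ n → List (Subset n)
subsets zero    = [] ∷ []
subsets (suc n) = map (outside ∷_) (subsets n) ++ map (inside ∷_) (subsets n)

rank : ∀ {t} → Matroid t → Subset t → ℕ
rank {t} M X = max 0 (map ∣_∣ (filter (λ I → (I ⊆? X) ×-dec indep? I) (subsets t)))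
  where open Matroid M

------------------------------------------------------------------------
-- The multiset R is the family root : Fin t → V, its elements being the
-- indices.

module Conditions (G : Graph) {t : ℕ} (root : Fin t → Fin (Graph.|V| G))
                  (M : Matroid t) (k : ℕ) where
  open Graph G
  open Matroid M

  R[_] : Fin |V| → Subset t
  R[ v ] = tabulate λ i → does (root i Fin.≟ v)

  R⟨_⟩ : Subset |E| → Subset t
  R⟨ F ⟩ = tabulate λ i → does (root i ∈? V⟨ F ⟩)

  C1 : Set
  C1 = ∀ v → Indep R[ v ]

  -- V⟨ F ⟩ is non-empty when F is, so the subtraction is never truncated.
  C2 : Set
  C2 = ∀ F → Nonempty F →
       ∣ F ∣ + ∣ R⟨ F ⟩ ∣ ≤ (k * ∣ V⟨ F ⟩ ∣ ∸ k) + rank M R⟨ F ⟩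

  C3 : Set
  C3 = |E| + t ≡ k * |V|

------------------------------------------------------------------------
-- The machine model: a structured unit-cost RAM with finitely many
-- registers and arrays (a program mentions only finitely many names), whose
-- only arithmetic is addition and truncated subtraction.  Every node of an
-- expression and every command costs one step, except that an oracle call
-- costs Q.

infixl 6 _⊕_ _⊖_
infix  4 _≔_ _[_]≔_
infixr 3 _；_

data Expr : Set where
  lit     : ℕ → Expr
  reg     : ℕ → Expr
  arr     : ℕ → Expr → Expr
  _⊕_ _⊖_ : Expr → Expr → Expr

data Program : Set where
  skip             : Program
  _≔_              : ℕ → Expr → Program
  _[_]≔_           : ℕ → Expr → Expr → Program
  _；_              : Program → Program → Program
  if_then_else_end : Expr → Program → Program → Program
  while_loop_end   : Expr → Program → Program
  -- query x a: set register x to 1 if the set whose indicator vector is held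
  -- in array a (non-zero meaning membership) is independent, and to 0 if not.
  query            : ℕ → ℕ → Program

record State : Set where
  constructor state
  field
    regs   : ℕ → ℕ
    arrays : ℕ → ℕ → ℕ
open State public

_[_↦_] : {A : Set} → (ℕ → A) → ℕ → A → ℕ → A
(f [ x ↦ a ]) y = if x ≡ᵇ y then a else f y

setReg : State → ℕ → ℕ → State
setReg (state r m) x n = state (r [ x ↦ n ]) m

setArray : State → ℕ → ℕ → ℕ → State
setArray (state r m) a i n = state r (m [ a ↦ (m a) [ i ↦ n ] ])

eval : State → Expr → ℕ
eval s (lit n)  = n
eval s (reg x)  = regs s x
eval s (arr a e) = arrays s a (eval s e)
eval s (d ⊕ e)  = eval s d + eval s e
eval s (d ⊖ e)  = eval s d ∸ eval s e

size : Expr → ℕ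
size (lit n)  = 1
size (reg x)  = 1
size (arr a e) = suc (size e)
size (d ⊕ e)  = suc (size d + size e)
size (d ⊖ e)  = suc (size d + size e)

module Semantics {t : ℕ} (M : Matroid t) (Q : ℕ) where

  oracle : (ℕ → ℕ) → ℕ
  oracle f = if does (Matroid.indep? M (tabulate λ i → 0 <ᵇ f (toℕ i))) then 1 else 0

  -- p ∶ s ⇓ s′ # T : started in s, p halts in s′ after time T.
  infix 2 _∶_⇓_#_

  data _∶_⇓_#_ : Program → State → State → ℕ → Set where
    ⇓skip   : ∀ {s} → skip ∶ s ⇓ s # 1
    ⇓reg    : ∀ {s x e} → (x ≔ e) ∶ s ⇓ setReg s x (eval s e) # suc (size e)
    ⇓array  : ∀ {s a d e} →
              (a [ d ]≔ e) ∶ s ⇓ setArray s a (eval s d) (eval s e) # suc (size d + size e)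
    ⇓seq    : ∀ {s s′ s″ p q T U} →
              p ∶ s ⇓ s′ # T → q ∶ s′ ⇓ s″ # U → (p ； q) ∶ s ⇓ s″ # T + U
    ⇓then   : ∀ {s s′ e p q T} → eval s e ≢ 0 →
              p ∶ s ⇓ s′ # T → if e then p else q end ∶ s ⇓ s′ # suc (size e) + T
    ⇓else   : ∀ {s s′ e p q T} → eval s e ≡ 0 →
              q ∶ s ⇓ s′ # T → if e then p else q end ∶ s ⇓ s′ # suc (size e) + T
    ⇓stop   : ∀ {s e p} → eval s e ≡ 0 → while e loop p end ∶ s ⇓ s # suc (size e)
    ⇓loop   : ∀ {s s′ s″ e p T U} → eval s e ≢ 0 →
              p ∶ s ⇓ s′ # T → while e loop p end ∶ s′ ⇓ s″ # U →
              while e loop p end ∶ s ⇓ s″ # suc (size e) + (T + U)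
    ⇓query  : ∀ {s x a} → query x a ∶ s ⇓ setReg s x (oracle (arrays s a)) # Q

------------------------------------------------------------------------
-- Input and output conventions.

fromFin : ∀ {n} → (Fin n → ℕ) → ℕ → ℕ
fromFin {n} f i with i <? n
... | yes i<n = f (fromℕ< i<n)
... | no  _   = 0

-- Registers 0–3 hold |V|, |E|, |R|, k; arrays 0 and 1 hold the two ends of
-- each edge and array 2 the vertex of each element of R.  The matroid is
-- accessible through the oracle only.
input : (G : Graph) {t : ℕ} → (Fin t → Fin (Graph.|V| G)) → ℕ → State
input G {t} root k = state registers memory
  where
  open Graph G

  registers : ℕ → ℕ
  registers 0 = |V|
  registers 1 = |E|
  registers 2 = t
  registers 3 = k
  registers _ = 0

  memory : ℕ → ℕ → ℕ
  memory 0 = fromFin λ e → toℕ (proj₁ (ends e))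
  memory 1 = fromFin λ e → toℕ (proj₂ (ends e))
  memory 2 = fromFin λ i → toℕ (root i)
  memory _ = λ _ → 0

-- The answer is left in register 0.
Answers : State → Set → Set
Answers s P = (regs s 0 ≡ 1 × P) ⊎ (regs s 0 ≡ 0 × ¬ P)

-- The suc makes c * suc (bound) an O(bound) that stays meaningful in the
-- degenerate cases where k or |V| is 0 and the bound itself vanishes.
bound : (k |V| |R| Q : ℕ) → ℕ
bound k |V| |R| Q = k ^ 4 * |V| ^ 2 + k ^ 2 * |V| * |R| ^ 2 * Q

-- Give every vertex k slots.  A root outside an independent set I occupies a slot
-- of its vertex, and an edge occupies a slot of one of its ends.  Under (C1), the
-- inequality (C2) holds for all F with last edge m if and only if k + 1 copies
-- of m can be placed in addition to the edges before m.  If they can, count the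
-- items that are placed at V(F).  If not, let X be the set of the vertices that the
-- search for a free slot reaches from the ends of m: their slots are all occupied, by
-- roots in R_X ∖ I, by edges inside X and by at most k copies of m, and I ∩ R_X spans
-- R_X, so m and the edges inside X violate (C2).
--
-- The search moves an edge to its other end, or a root x into I against some y ∈ I
-- that leaves I for a slot of its own vertex.  A vertex is labelled when it is
-- first reached, so the fundamental circuit of an earlier x on the path found
-- avoids every later y, and the moves can be made one by one from the far end.
-- There are O(k² |V|) searches.  Each takes O(k |V| + |R|² Q) time, because
-- a root is tested against the elements of I only once.

module Submission where

open import Data.Bool using (Bool; true; false; not; _∧_; _∨_; if_then_else_)
open import Data.Empty using (⊥-elim) renaming (⊥ to Empty)
import Data.Fin as Fin
open import Data.Fin using (Fin; toℕ; fromℕ<)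
open import Data.Fin.Properties using (toℕ<n; toℕ-fromℕ<; toℕ-injective; fromℕ<-toℕ; any?)
open import Data.Fin.Subset using (Subset; _∈_; _⊆_; _∪_; ⁅_⁆; ⊤; ∣_∣; Nonempty)
open import Data.Fin.Subset.Properties using (_∈?_; _⊆?_; ∈⊤; ∣p∣≤n; x∈p∪q⁺; x∈⁅x⁆)
open import Data.List using (map; filter)
open import Data.List.Extrema.Nat using (max≤v⁺; v≤max⁺)
open import Data.List.Membership.Propositional using () renaming (_∈_ to _∈ˡ_)
open import Data.List.Membership.Propositional.Properties
  using (∈-map⁺; ∈-map⁻; ∈-++⁺ˡ; ∈-++⁺ʳ; ∈-filter⁺; ∈-filter⁻)
open import Data.List.Relation.Unary.All using (tabulate)
open import Data.List.Relation.Unary.Any using (here) renaming (map to Any-map)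
open import Data.Nat hiding (_%_; _/_)
open import Data.Nat.DivMod
  using (_%_; _/_; m≡m%n+[m/n]*n; m<n⇒m%n≡m; [m+n]%n≡m%n; [m+kn]%n≡m%n; m<n*o⇒m/o<n)
open import Data.Nat.Properties
open import Data.Nat.Tactic.RingSolver using (solve-∀)
open import Data.Product using (∃-syntax; _×_; _,_; _,′_; proj₁; proj₂)
open import Data.Sum using (_⊎_; inj₁; inj₂; [_,_]′)
open import Data.Vec using ([]; _∷_; lookup) renaming (tabulate to tabulateᵛ)
open import Data.Vec.Properties using (tabulate-cong; lookup∘tabulate; lookup⇒[]=; []=⇒lookup)
open import Function using (_∘_; id; case_of_)
open import Relation.Binary.Definitions using (tri<; tri≈; tri>)
open import Relation.Binary.PropositionalEquality
open import Relation.Nullary using (Dec; yes; no; ¬_; does)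
open import Relation.Nullary.Decidable using (_×-dec_; dec-true; dec-false)
open import Defs

-- (C2) reads |F| + k + |R_F| ≤ k|V(F)| + r(R_F). The roots of R_F in `I` number at most r(R_F), and
-- what remains, (|F| - 1) + (k + 1) + |R_F - I|, counts items that need slots at V(F); hence the k
-- + 1 copies. For the converse, `X` may exceed V(F), since exchanges can reach vertices that lie on
-- no edge inside `X`. By (C1) each R_v is independent, so |R_v| ≤ k and R_X - R_F has at most k|X -
-- V(F)| elements. The same bound yields the initial placement, with `I` empty. The delicate point
-- is to exchange several roots along one path, since exchanges that are possible one at a time need
-- not be possible together. Each root on the path therefore carries a witness `A` inside the
-- independent set, which the moves before its turn leave intact. (C3) is tested first, because it
-- gives |E| ≤ k|V| and so limits the number of searches. Within a search the root tests are paid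
-- for by a potential; charging k of them to every vertex would be too coarse. The case k = 0 is
-- separate, as the time must then be constant.

holds : ∀ {P : Set} (d : Dec P) → does d ≡ true → P
holds (yes p) _ = p

fails : ∀ {P : Set} (d : Dec P) → does d ≡ false → ¬ P
fails (no ¬p) _ = ¬p

≢true⇒≡false : ∀ {b} → b ≢ true → b ≡ false
≢true⇒≡false {false} _ = refl
≢true⇒≡false {true}  p = ⊥-elim (p refl)

true≢false : ∀ {b} → b ≡ true → b ≡ false → ∀ {A : Set} → A
true≢false refl ()

≡ᵇ-refl : ∀ x → (x ≡ᵇ x) ≡ true
≡ᵇ-refl zero    = refl
≡ᵇ-refl (suc x) = ≡ᵇ-refl x

≢⇒≡ᵇ : ∀ {x y} → x ≢ y → (x ≡ᵇ y) ≡ false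
≢⇒≡ᵇ {x} {y} x≢y = dec-false (x ≟ y) x≢y

module _ {A : Set} (f : ℕ → A) (x : ℕ) (a : A) where

  update-same : (f [ x ↦ a ]) x ≡ a
  update-same rewrite ≡ᵇ-refl x = refl

  update-other : ∀ {y} → y ≢ x → (f [ x ↦ a ]) y ≡ f y
  update-other y≢x rewrite ≢⇒≡ᵇ (y≢x ∘ sym) = refl

  -- An eliminator for updated maps. Its motive ranges over the index and the value, so later proofs
  -- split on y ≡ x without meeting `≡ᵇ`.
  update-cases : (P : ℕ → A → Set) → ∀ y → (y ≡ x → P y a) → (y ≢ x → P y (f y)) →
                 P y ((f [ x ↦ a ]) y)
  update-cases P y same other with y ≟ x
  ... | yes refl rewrite ≡ᵇ-refl y = same refl
  ... | no y≢x rewrite ≢⇒≡ᵇ (y≢x ∘ sym) = other y≢x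

-- Counting the indices below a bound that satisfy a predicate.

infix 4 _⊆[_]_

_⊆[_]_ : (ℕ → Bool) → ℕ → (ℕ → Bool) → Set
f ⊆[ n ] g = ∀ i → i < n → f i ≡ true → g i ≡ true

bit : Bool → ℕ
bit b = if b then 1 else 0

# : ℕ → (ℕ → Bool) → ℕ
# zero    f = 0
# (suc n) f = bit (f 0) + # n (f ∘ suc)

#-cong : ∀ n {f g} → (∀ i → i < n → f i ≡ g i) → # n f ≡ # n g
#-cong zero    eq = refl
#-cong (suc n) eq = cong₂ _+_ (cong bit (eq 0 z<s)) (#-cong n (λ i i<n → eq (suc i) (s<s i<n)))

#-+ : ∀ m n f → # (m + n) f ≡ # m f + # n (f ∘ (m +_))
#-+ zero    n f = refl
#-+ (suc m) n f rewrite #-+ m n (f ∘ suc) = sym (+-assoc (bit (f 0)) _ _)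

#-suc : ∀ n f → # (suc n) f ≡ # n f + bit (f n)
#-suc n f = begin
  # (suc n) f                        ≡⟨ cong (λ m → # m f) (+-comm 1 n) ⟩
  # (n + 1) f                        ≡⟨ #-+ n 1 f ⟩
  # n f + (bit (f (n + 0)) + 0)      ≡⟨ cong (# n f +_) (+-identityʳ _) ⟩
  # n f + bit (f (n + 0))            ≡⟨ cong (λ m → # n f + bit (f m)) (+-identityʳ n) ⟩
  # n f + bit (f n)                  ∎
  where open ≡-Reasoning

#-true : ∀ n → # n (λ _ → true) ≡ n
#-true zero    = refl
#-true (suc n) = cong suc (#-true n)

bit-mono : ∀ {b c} → (b ≡ true → c ≡ true) → bit b ≤ bit c
bit-mono {false} _ = z≤n
bit-mono {true}  p rewrite p refl = ≤-refl

#-mono : ∀ n {f g} → f ⊆[ n ] g → # n f ≤ # n g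
#-mono zero    sub = z≤n
#-mono (suc n) sub = +-mono-≤ (bit-mono (sub 0 z<s)) (#-mono n (λ i i<n → sub (suc i) (s<s i<n)))

#-monoˡ : ∀ {m n} f → m ≤ n → # m f ≤ # n f
#-monoˡ f z≤n       = z≤n
#-monoˡ f (s≤s m≤n) = +-monoʳ-≤ (bit (f 0)) (#-monoˡ (f ∘ suc) m≤n)

#-≤ : ∀ n f → # n f ≤ n
#-≤ n f = subst (# n f ≤_) (#-true n) (#-mono n (λ _ _ _ → refl))

#-split : ∀ n (f g : ℕ → Bool) → # n f ≡ # n (λ i → f i ∧ g i) + # n (λ i → f i ∧ not (g i))
#-split zero    f g = refl
#-split (suc n) f g rewrite #-split n (f ∘ suc) (g ∘ suc) with f 0 | g 0
... | false | _     = refl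
... | true  | true  = refl
... | true  | false = sym (+-suc _ _)

#-insert : ∀ n (f : ℕ → Bool) x → x < n → f x ≡ false → # n (f [ x ↦ true ]) ≡ suc (# n f)
#-insert (suc n) f zero    x<n fx rewrite fx = refl
#-insert (suc n) f (suc x) x<n fx =
  trans (cong (bit (f 0) +_) (#-insert n (f ∘ suc) x (s<s⁻¹ x<n) fx)) (+-suc _ _)

#-delete : ∀ n (f : ℕ → Bool) x → x < n → f x ≡ true → # n f ≡ suc (# n (f [ x ↦ false ]))
#-delete (suc n) f zero    x<n fx rewrite fx = refl
#-delete (suc n) f (suc x) x<n fx =
  trans (cong (bit (f 0) +_) (#-delete n (f ∘ suc) x (s<s⁻¹ x<n) fx)) (+-suc _ _)

#-⊇ : ∀ n f g → f ⊆[ n ] g → # n g ≤ # n f → g ⊆[ n ] f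
#-⊇ n f g sub le i i<n gi with f i in fi
... | true  = refl
... | false = ⊥-elim (<-irrefl refl (begin-strict
    # n f              <⟨ n<1+n _ ⟩
    suc (# n f)        ≡⟨ #-insert n f i i<n fi ⟨
    # n (f [ i ↦ true ]) ≤⟨ #-mono n sub′ ⟩
    # n g              ≤⟨ le ⟩
    # n f              ∎))
  where
  open ≤-Reasoning
  sub′ : (f [ i ↦ true ]) ⊆[ n ] g
  sub′ j j<n = update-cases f i true (λ j b → b ≡ true → g j ≡ true) j
                 (λ { refl _ → gi }) (λ _ → sub j j<n)

#-inject : ∀ {n m f g} (L : ℕ → ℕ → Set) →
           (∀ i → i < n → f i ≡ true → ∃[ p ] p < m × g p ≡ true × L i p) →
           (∀ {i j p} → L i p → L j p → i ≡ j) →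
           # n f ≤ # m g
#-inject {zero}  L φ inj = z≤n
#-inject {suc n} {m} {f} {g} L φ inj with f 0 in f0
... | false = #-inject (L ∘ suc) (λ i i<n → φ (suc i) (s<s i<n)) (λ l l′ → suc-injective (inj l l′))
... | true with φ 0 z<s f0
-- The partner `q` of the index 0 is withdrawn from `g`, and injectivity of `L` keeps it from being
-- needed again. As `L` is a relation, existence statements such as `complete` serve as the matching
-- without a choice function.
...   | q , q<m , gq , Lq = begin
  suc (# n (f ∘ suc))       ≤⟨ s≤s (#-inject (L ∘ suc) φ′ (λ l l′ → suc-injective (inj l l′))) ⟩
  suc (# m (g [ q ↦ false ])) ≡⟨ #-delete m g q q<m gq ⟨
  # m g                     ∎
  where
  open ≤-Reasoning
  φ′ : ∀ i → i < n → f (suc i) ≡ true → ∃[ p ] p < m × (g [ q ↦ false ]) p ≡ true × L (suc i) p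
  φ′ i i<n fi with φ (suc i) (s<s i<n) fi
  ... | p , p<m , gp , Lp = p , p<m ,
    trans (update-other g q false (λ { refl → case inj Lp Lq of λ () })) gp , Lp

#-mod : ∀ k v (X : ℕ → Bool) → # (k * suc v) (λ p → X (p % suc v)) ≡ k * # (suc v) X
#-mod zero    v X = refl
#-mod (suc k) v X = trans (#-+ (suc v) (k * suc v) (λ p → X (p % suc v))) (cong₂ _+_
  (#-cong (suc v) (λ i i<n → cong X (m<n⇒m%n≡m i<n)))
  (trans (#-cong (k * suc v) (λ i _ → cong X (trans (cong (_% suc v) (+-comm (suc v) i)) ([m+n]%n≡m%n i
      (suc v)))))
         (#-mod k v X)))

⊆-or-counterexample : ∀ n (f g : ℕ → Bool) → f ⊆[ n ] g ⊎ (∃[ i ] i < n × f i ≡ true × g i ≡ false)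
⊆-or-counterexample zero    f g = inj₁ λ _ ()
⊆-or-counterexample (suc n) f g with ⊆-or-counterexample n (f ∘ suc) (g ∘ suc) | f 0 in f0 | g 0 in g0
... | inj₂ (i , i<n , fi , gi) | _ | _ = inj₂ (suc i , s<s i<n , fi , gi)
... | inj₁ sub | true  | false = inj₂ (0 , z<s , f0 , g0)
... | inj₁ sub | false | _     = inj₁ λ { zero _ f0′ → true≢false f0′ f0 ; (suc i) i<n → sub i
    (s<s⁻¹ i<n) }
... | inj₁ sub | true  | true  = inj₁ λ { zero _ _ → g0 ; (suc i) i<n → sub i (s<s⁻¹ i<n) }

-- Subsets of `Fin n` as Boolean predicates on the natural numbers.

restrict : ∀ {n} → (Fin n → Bool) → ℕ → Bool
restrict {zero}  f i       = false
restrict {suc n} f zero    = f Fin.zero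
restrict {suc n} f (suc i) = restrict (f ∘ Fin.suc) i

restrict-toℕ : ∀ {n} (f : Fin n → Bool) i → restrict f (toℕ i) ≡ f i
restrict-toℕ f Fin.zero    = refl
restrict-toℕ f (Fin.suc i) = restrict-toℕ (f ∘ Fin.suc) i

∣tabulate∣ : ∀ {n} (f : Fin n → Bool) → ∣ tabulateᵛ f ∣ ≡ # n (restrict f)
∣tabulate∣ {zero}  f = refl
∣tabulate∣ {suc n} f with f Fin.zero
... | true  = cong suc (∣tabulate∣ (f ∘ Fin.suc))
... | false = ∣tabulate∣ (f ∘ Fin.suc)

∣lookup∣ : ∀ {n} (S : Subset n) → ∣ S ∣ ≡ # n (restrict (lookup S))
∣lookup∣ []          = refl
∣lookup∣ (true ∷ S)  = cong suc (∣lookup∣ S)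
∣lookup∣ (false ∷ S) = ∣lookup∣ S

sub : ∀ {n} → (ℕ → Bool) → Subset n
sub f = tabulateᵛ (f ∘ toℕ)

∈-tabulate⁺ : ∀ {n} (f : Fin n → Bool) {i} → f i ≡ true → i ∈ tabulateᵛ f
∈-tabulate⁺ f {i} fi = lookup⇒[]= i _ (trans (lookup∘tabulate f i) fi)

∈-tabulate⁻ : ∀ {n} (f : Fin n → Bool) {i} → i ∈ tabulateᵛ f → f i ≡ true
∈-tabulate⁻ f {i} i∈ = trans (sym (lookup∘tabulate f i)) ([]=⇒lookup i∈)

∣sub∣ : ∀ n (f : ℕ → Bool) → ∣ sub {n} f ∣ ≡ # n f
∣sub∣ n f = trans (∣tabulate∣ {n} (f ∘ toℕ)) (#-cong n λ i i<n →
  trans (cong (restrict {n} (f ∘ toℕ)) (sym (toℕ-fromℕ< i<n)))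
  (trans (restrict-toℕ {n} (f ∘ toℕ) (fromℕ< i<n)) (cong f (toℕ-fromℕ< i<n))))

∈-subsets : ∀ {n} (S : Subset n) → S ∈ˡ subsets n
∈-subsets []          = here refl
∈-subsets (false ∷ S) = ∈-++⁺ˡ (∈-map⁺ (false ∷_) (∈-subsets S))
∈-subsets {suc n} (true ∷ S) = ∈-++⁺ʳ (map (false ∷_) (subsets n)) (∈-map⁺ (true ∷_) (∈-subsets S))

-- Independence, rank and fundamental circuits.

module MatroidProperties {t : ℕ} (M : Matroid t) where
  open Matroid M

  Ind : (ℕ → Bool) → Set
  Ind f = Indep (sub f)

  ind? : ∀ f → Dec (Ind f)
  ind? f = indep? (sub f)

  Ind-⊆ : ∀ {f g} → f ⊆[ t ] g → Ind g → Ind f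
  Ind-⊆ {f} {g} f⊆g = hereditary λ i∈ →
    ∈-tabulate⁺ (g ∘ toℕ) (f⊆g _ (toℕ<n _) (∈-tabulate⁻ (f ∘ toℕ) i∈))

  Ind-∅ : Ind (λ _ → false)
  Ind-∅ = hereditary (λ i∈ → case ∈-tabulate⁻ (λ _ → false) i∈ of λ ()) ⊥-indep

  Ind-augment-subset : ∀ {f} {J : Subset t} → Ind f → Indep J → # t f < ∣ J ∣ →
                       ∃[ x ] x ∈ J × f (toℕ x) ≡ false × Ind (f [ toℕ x ↦ true ])
  Ind-augment-subset {f} {J} If IJ lt with augment {sub f} {J} If IJ (subst (_< ∣ J ∣)
      (sym (∣sub∣ t f)) lt)
  ... | x , x∈J , x∉f , I = x , x∈J , fx , hereditary to I
    where
    fx = ≢true⇒≡false (x∉f ∘ ∈-tabulate⁺ (f ∘ toℕ))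
    to : sub (f [ toℕ x ↦ true ]) ⊆ sub f ∪ ⁅ x ⁆
    to {i} i∈ = x∈p∪q⁺ (update-cases f (toℕ x) true
      (λ j b → j ≡ toℕ i → b ≡ true → i ∈ sub f ⊎ i ∈ ⁅ x ⁆) (toℕ i)
      (λ eq _ _ → inj₂ (subst (_∈ ⁅ x ⁆) (sym (toℕ-injective eq)) (x∈⁅x⁆ x)))
      (λ _ _ fi → inj₁ (∈-tabulate⁺ (f ∘ toℕ) fi)) refl (∈-tabulate⁻ ((f [ toℕ x ↦ true ]) ∘ toℕ) i∈))

  Ind-augment : ∀ {f g} → Ind f → Ind g → # t f < # t g →
                ∃[ x ] x < t × g x ≡ true × f x ≡ false × Ind (f [ x ↦ true ])
  Ind-augment {f} {g} If Ig lt with Ind-augment-subset {f} {sub g} If Ig (subst (# t f <_)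
      (sym (∣sub∣ t g)) lt)
  ... | x , x∈ , fx , I = toℕ x , toℕ<n x , ∈-tabulate⁻ (g ∘ toℕ) x∈ , fx , I

  rank-≥ : ∀ {f} {X : Subset t} → Ind f → (∀ i → f (toℕ i) ≡ true → i ∈ X) → # t f ≤ rank M X
  rank-≥ {f} {X} If f⊆X = v≤max⁺ 0 _ (inj₂ (Any-map (λ eq → ≤-reflexive (trans (sym (∣sub∣ t f)) eq))
    (∈-map⁺ ∣_∣ (∈-filter⁺ (λ I → (I ⊆? X) ×-dec indep? I) (∈-subsets (sub f))
        ((λ {i} i∈ → f⊆X i (∈-tabulate⁻ (f ∘ toℕ) i∈)) , If)))))

  -- An independent subset of `X` with more elements than `f` would, by augmentation, supply an
  -- element of `X` that can be added to `f`.
  rank-≤ : ∀ {f} {X : Subset t} → Ind f →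
           (∀ x → x ∈ X → f (toℕ x) ≡ false → ¬ Ind (f [ toℕ x ↦ true ])) → rank M X ≤ # t f
  rank-≤ {f} {X} If maximal = max≤v⁺ z≤n (tabulate bounded)
    where
    bounded : ∀ {n} → n ∈ˡ map ∣_∣ (filter (λ I → (I ⊆? X) ×-dec indep? I) (subsets t)) → n ≤ # t f
    bounded n∈ with ∈-map⁻ ∣_∣ n∈
    ... | J , J∈ , refl with ∈-filter⁻ (λ I → (I ⊆? X) ×-dec indep? I) {xs = subsets t} J∈
    ...   | _ , J⊆X , IJ with ∣ J ∣ ≤? # t f
    ...     | yes le = le
    ...     | no ¬le with Ind-augment-subset {f} {J} If IJ (≰⇒> ¬le)
    ...       | x , x∈J , fx , I = ⊥-elim (maximal x (J⊆X x∈J) fx I)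

  rank-mono : ∀ {X Y : Subset t} → X ⊆ Y → rank M X ≤ rank M Y
  rank-mono {X} {Y} X⊆Y = max≤v⁺ z≤n (tabulate bounded)
    where
    bounded : ∀ {n} → n ∈ˡ map ∣_∣ (filter (λ I → (I ⊆? X) ×-dec indep? I) (subsets t)) → n ≤ rank M Y
    bounded n∈ with ∈-map⁻ ∣_∣ n∈
    ... | J , J∈ , refl with ∈-filter⁻ (λ I → (I ⊆? X) ×-dec indep? I) {xs = subsets t} J∈
    ...   | _ , J⊆X , IJ = v≤max⁺ 0 _ (inj₂ (Any-map ≤-reflexive
      (∈-map⁺ ∣_∣ (∈-filter⁺ (λ I → (I ⊆? Y) ×-dec indep? I) (∈-subsets J)
          ((λ {i} i∈ → X⊆Y (J⊆X i∈)) , IJ)))))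

  rank-≤-size : ∀ X → rank M X ≤ t
  rank-≤-size X = max≤v⁺ z≤n (tabulate bounded)
    where
    bounded : ∀ {n} → n ∈ˡ map ∣_∣ (filter (λ I → (I ⊆? X) ×-dec indep? I) (subsets t)) → n ≤ t
    bounded n∈ with ∈-map⁻ ∣_∣ n∈
    ... | J , _ , refl = ∣p∣≤n J

  #-≤-rank : ∀ {f} → Ind f → # t f ≤ rank M ⊤
  #-≤-rank If = rank-≥ If (λ _ _ → ∈⊤)

  -- Augmentation from `J` is repeated until the sizes agree. The containment in A ∪ J is kept
  -- because it is what identifies the resulting set in the exchange arguments.
  extend : ∀ {A J} → Ind A → Ind J → # t A ≤ # t J →
           ∃[ K ] Ind K × A ⊆[ t ] K × (∀ i → i < t → K i ≡ true → A i ≡ true ⊎ J i ≡ true) ×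
               # t K ≡ # t J
  extend {A} {J} IA IJ le = go (# t J ∸ # t A) A IA (m+[n∸m]≡n le)
    where
    go : ∀ d A → Ind A → # t A + d ≡ # t J →
         ∃[ K ] Ind K × A ⊆[ t ] K × (∀ i → i < t → K i ≡ true → A i ≡ true ⊎ J i ≡ true) × # t K ≡ # t J
    go zero    A IA eq = A , IA , (λ _ _ a → a) , (λ _ _ a → inj₁ a) , trans (sym (+-identityʳ _)) eq
    go (suc d) A IA eq with Ind-augment {A} {J} IA IJ (subst (# t A <_) eq (m<m+n (# t A) z<s))
    ... | x , x<t , Jx , Ax , I with go d (A [ x ↦ true ]) I
                                     (trans (cong (_+ d) (#-insert t A x x<t Ax))
                                         (trans (sym (+-suc (# t A) d)) eq))
    ...   | K , IK , A⊆K , K⊆ , card =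
      K , IK , (λ i i<t Ai → A⊆K i i<t (update-cases A x true (λ _ b → b ≡ true) i (λ _ → refl)
          (λ _ → Ai))) ,
      (λ i i<t Ki → [ (λ Ai → update-cases A x true (λ j b → j ≡ i → b ≡ true →
          A i ≡ true ⊎ J i ≡ true) i
                          (λ { refl _ _ → inj₂ Jx }) (λ _ _ Ai → inj₁ Ai) refl Ai) , inj₂ ]′
                              (K⊆ i i<t Ki)) ,
      card

  exchange-cases : ∀ f y x i {P : Set} → ((f [ y ↦ false ]) [ x ↦ true ]) i ≡ true →
                   (i ≡ x → P) → (i ≢ x → i ≢ y → f i ≡ true → P) → P
  exchange-cases f y x i h onx other with i ≟ x
  ... | yes i≡x = onx i≡x
  ... | no i≢x with i ≟ y
  ...   | yes refl = case trans (sym (trans (update-other (f [ i ↦ false ]) x true i≢x)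
      (update-same f i false))) h of λ ()
  ...   | no i≢y = other i≢x i≢y
    (trans (sym (trans (update-other (f [ y ↦ false ]) x true i≢x) (update-other f y false i≢y))) h)

  exchange-true : ∀ f y x {i} → i ≢ y → f i ≡ true → ((f [ y ↦ false ]) [ x ↦ true ]) i ≡ true
  exchange-true f y x {i} i≢y fi = update-cases (f [ y ↦ false ]) x true (λ _ b → b ≡ true) i
      (λ _ → refl)
    (λ _ → trans (update-other f y false i≢y) fi)

  #-exchange : ∀ f {y x} → y < t → x < t → f y ≡ true → f x ≡ false →
               # t ((f [ y ↦ false ]) [ x ↦ true ]) ≡ # t f
  #-exchange f {y} {x} y<t x<t fy fx = trans
    (#-insert t (f [ y ↦ false ]) x x<t (trans (update-other f y false
        (λ { refl → true≢false fy fx })) fx))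
    (sym (#-delete t f y y<t fy))

  -- `K` lies in I + x and avoids `y`, so it is contained in I - y + x. Both sets have |I| elements
  -- and therefore coincide.
  missing⇒exchange : ∀ {K I x y} → Ind K → x < t → y < t → I y ≡ true → I x ≡ false →
    (∀ i → i < t → K i ≡ true → i ≡ x ⊎ I i ≡ true) → K y ≡ false → # t K ≡ # t I →
    Ind ((I [ y ↦ false ]) [ x ↦ true ])
  missing⇒exchange {K} {I} {x} {y} IK x<t y<t Iy Ix K⊆ Ky card =
    Ind-⊆ (#-⊇ t K I′ K⊆I′ (≤-reflexive (trans (#-exchange I y<t x<t Iy Ix) (sym card)))) IK
    where
    I′ = (I [ y ↦ false ]) [ x ↦ true ]
    K⊆I′ : K ⊆[ t ] I′
    K⊆I′ i i<t Ki = [ (λ { refl → update-same (I [ y ↦ false ]) i true }) ,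
                      (λ Ii → exchange-true I y x (λ { refl → true≢false Ki Ky }) Ii) ]′ (K⊆ i i<t Ki)

  -- Extend A - y + x from `J` to the size of `J`. The result cannot contain `y`, since it would
  -- then contain the dependent set A + x; hence it is J - y + x. So a part `A` of `J` that exhibits
  -- `y` on the circuit of `x` is enough, no matter how the rest of `J` has changed since the
  -- search.
  exchange : ∀ {J A x y} → Ind J → A ⊆[ t ] J → x < t → y < t → A y ≡ true → J x ≡ false →
             ¬ Ind (A [ x ↦ true ]) → Ind ((A [ y ↦ false ]) [ x ↦ true ]) →
             Ind ((J [ y ↦ false ]) [ x ↦ true ])
  exchange {J} {A} {x} {y} IJ A⊆J x<t y<t Ay Jx dep I
    with extend {(A [ y ↦ false ]) [ x ↦ true ]} {J} I IJ
           (subst (_≤ # t J) (sym (#-exchange A y<t x<t Ay Ax)) (#-mono t A⊆J))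
    where
    Ax : A x ≡ false
    Ax = ≢true⇒≡false (λ Ax → true≢false (A⊆J x x<t Ax) Jx)
  ... | K , IK , A′⊆K , K⊆ , card = missing⇒exchange IK x<t y<t (A⊆J y y<t Ay) Jx
    (λ i i<t Ki → [ (λ Ai → exchange-cases A y x i Ai inj₁ (λ _ _ Ai → inj₂ (A⊆J i i<t Ai))) , inj₂ ]′
        (K⊆ i i<t Ki))
    (≢true⇒≡false λ Ky → dep (Ind-⊆ (λ i i<t → update-cases A x true (λ j b → j ≡ i → b ≡ true →
        K i ≡ true) i
       (λ { refl _ _ → A′⊆K i i<t (update-same (A [ y ↦ false ]) i true) })
       (λ i≢x _ Ai → case i ≟ y of λ { (yes refl) → Ky ; (no i≢y) → A′⊆K i i<t
           (exchange-true A y x i≢y Ai) }) refl) IK))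
    card

  exchangeable : (ℕ → Bool) → ℕ → ℕ → Bool
  exchangeable I x y = I y ∧ does (ind? ((I [ y ↦ false ]) [ x ↦ true ]))

  exchangeable-true : ∀ I x y → exchangeable I x y ≡ true → I y ≡ true × Ind
      ((I [ y ↦ false ]) [ x ↦ true ])
  exchangeable-true I x y e with I y
  exchangeable-true I x y e  | true = refl , holds (ind? ((I [ y ↦ false ]) [ x ↦ true ])) e

  exchangeable-intro : ∀ I x y → I y ≡ true → Ind ((I [ y ↦ false ]) [ x ↦ true ]) →
      exchangeable I x y ≡ true
  exchangeable-intro I x y Iy i rewrite Iy = dec-true (ind? ((I [ y ↦ false ]) [ x ↦ true ])) i

  -- Together with x, the elements of I that can be exchanged against x form
  -- the fundamental circuit of x.
  exchangeable-dependent : ∀ {I x} → Ind I → x < t → I x ≡ false → ¬ Ind (I [ x ↦ true ]) →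
                           ¬ Ind (exchangeable I x [ x ↦ true ])
  exchangeable-dependent {I} {x} II x<t Ix dep IA = contra (extend {A [ x ↦ true ]} {I} IA II card)
    where
    A = exchangeable I x
    A⊆I : A ⊆[ t ] I
    A⊆I i _ Ai = proj₁ (exchangeable-true I x i Ai)
    card : # t (A [ x ↦ true ]) ≤ # t I
    card with # t A <? # t I
    ... | yes lt = subst (_≤ # t I) (sym (#-insert t A x x<t (≢true⇒≡false λ Ax → true≢false
        (A⊆I x x<t Ax) Ix))) lt
    ... | no ¬lt = ⊥-elim (dep (Ind-⊆ (λ i i<t → update-cases I x true
                     (λ j b → j ≡ i → b ≡ true → (A [ x ↦ true ]) i ≡ true) i
                     (λ { refl _ _ → update-same A i true })
                     (λ i≢x _ Ii → trans (update-other A x true i≢x) (#-⊇ t A I A⊆I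
                         (≮⇒≥ ¬lt) i i<t Ii)) refl) IA))
    -- `K` would be an independent set of size |I| between A + x and I + x. As I + x is dependent,
    -- `K` misses some `y` of `I` and thus equals I - y + x. Then `y` is exchangeable, so it belongs
    -- to `A` and to `K` after all.
    contra : ¬ (∃[ K ] Ind K × (A [ x ↦ true ]) ⊆[ t ] K ×
                (∀ i → i < t → K i ≡ true → (A [ x ↦ true ]) i ≡ true ⊎ I i ≡ true) × # t K ≡ # t I)
    contra (K , IK , A⊆K , K⊆ , card) with ⊆-or-counterexample t I K
    ... | inj₁ I⊆K = dep (Ind-⊆ (λ i i<t → update-cases I x true (λ j b → j ≡ i → b ≡ true →
        K i ≡ true) i
                       (λ { refl _ _ → A⊆K i i<t (update-same A i true) }) (λ _ _ Ii →
                           I⊆K i i<t Ii) refl) IK)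
    ... | inj₂ (y , y<t , Iy , Ky) = true≢false
      (A⊆K y y<t (trans (update-other A x true (λ { refl → true≢false Iy Ix }))
        (exchangeable-intro I x y Iy (missing⇒exchange IK x<t y<t Iy Ix K⊆I Ky card)))) Ky
      where
      K⊆I : ∀ i → i < t → K i ≡ true → i ≡ x ⊎ I i ≡ true
      K⊆I i i<t Ki = [ (λ Ai → update-cases A x true (λ j b → j ≡ i → b ≡ true → i ≡ x ⊎ I i ≡ true) i
        (λ i≡x _ _ → inj₁ i≡x) (λ _ _ Ai → inj₂ (A⊆I i i<t Ai)) refl Ai) , inj₂ ]′ (K⊆ i i<t Ki)

-- Programs: syntactic frames and a logic with amortised time.

∨-false : ∀ {a b} → a ∨ b ≡ false → a ≡ false × b ≡ false
∨-false {false} eq = refl , eq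

For : ℕ → ℕ → Program → Program
For x n body = x ≔ lit 0 ； while reg n ⊖ reg x loop body ； x ≔ reg x ⊕ lit 1 end

-- The value 0 at loops is never used: they are timed by run-for below.
ops : Program → ℕ
ops skip                    = 1
ops (x ≔ e)                 = suc (size e)
ops (a [ d ]≔ e)            = suc (size d + size e)
ops (p ； q)                = ops p + ops q
ops (if e then p else q end) = suc (size e) + (ops p + ops q)
ops (while e loop p end)    = 0
ops (query x a)             = 0

queries : Program → ℕ
queries (p ； q)                 = queries p + queries q
queries (if e then p else q end) = queries p + queries q
queries (query x a)              = 1
queries _                        = 0

cost : ℕ → Program → ℕ
cost Q p = ops p + queries p * Q

-- A syntactic over-approximation that computes, so that each frame condition on a concrete program
-- is proved by `refl`.
writesReg : Program → ℕ → Bool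
writesReg (x ≔ e)                 y = x ≡ᵇ y
writesReg (p ； q)                y = writesReg p y ∨ writesReg q y
writesReg (if e then p else q end) y = writesReg p y ∨ writesReg q y
writesReg (while e loop p end)    y = writesReg p y
writesReg (query x a)             y = x ≡ᵇ y
writesReg _                       y = false

writesArray : Program → ℕ → Bool
writesArray (a [ d ]≔ e)              b = a ≡ᵇ b
writesArray (p ； q)                  b = writesArray p b ∨ writesArray q b
writesArray (if e then p else q end)  b = writesArray p b ∨ writesArray q b
writesArray (while e loop p end)      b = writesArray p b
writesArray _                         b = false

record Same (p : Program) (s s′ : State) : Set where
  constructor same
  field
    sameReg   : ∀ x → writesReg p x ≡ false → regs s′ x ≡ regs s x
    sameArray : ∀ a → writesArray p a ≡ false → arrays s′ a ≡ arrays s a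
open Same public

same-refl : ∀ {p s} → Same p s s
same-refl = same (λ _ _ → refl) (λ _ _ → refl)

same-trans : ∀ {p s s′ s″} → Same p s s′ → Same p s′ s″ → Same p s s″
same-trans (same r a) (same r′ a′) =
  same (λ x w → trans (r′ x w) (r x w)) (λ x w → trans (a′ x w) (a x w))

same-seqˡ : ∀ {p q s s′} → Same p s s′ → Same (p ； q) s s′
same-seqˡ (same r a) = same (λ x w → r x (proj₁ (∨-false w))) (λ x w → a x (proj₁ (∨-false w)))

same-seqʳ : ∀ {p q s s′} → Same q s s′ → Same (p ； q) s s′
same-seqʳ {p} (same r a) = same (λ x w → r x (proj₂ (∨-false {writesReg p x} w)))
                                (λ x w → a x (proj₂ (∨-false {writesArray p x} w)))

module Logic {t : ℕ} (M : Matroid t) (Q : ℕ) where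
  open Semantics M Q

  ⇓-same : ∀ {p s s′ τ} → p ∶ s ⇓ s′ # τ → Same p s s′
  ⇓-same ⇓skip            = same-refl
  ⇓-same (⇓reg {s} {x} {e}) = same (λ y w → cong (λ b → if b then eval s e else regs s y) w)
      (λ _ _ → refl)
  ⇓-same (⇓array {s} {a} {d} {e}) =
    same (λ _ _ → refl) (λ b w → cong
        (λ c → if c then arrays s a [ eval s d ↦ eval s e ] else arrays s b) w)
  ⇓-same (⇓seq {p = p} {q} d d′) = same-trans (same-seqˡ {p} {q} (⇓-same d)) (same-seqʳ {p} {q}
      (⇓-same d′))
  ⇓-same (⇓then {p = p} {q} _ d) with same r a ← same-seqˡ {p} {q} (⇓-same d) = same r a
  ⇓-same (⇓else {p = p} {q} _ d) with same r a ← same-seqʳ {p} {q} (⇓-same d) = same r a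
  ⇓-same (⇓stop _)        = same-refl
  ⇓-same (⇓loop _ d d′) with ⇓-same d | ⇓-same d′
  ... | same r a | same r′ a′ = same (λ x w → trans (r′ x w) (r x w)) (λ x w → trans (a′ x w) (a x w))
  ⇓-same (⇓query {s} {x} {a}) = same (λ y w → cong (λ b → if b then oracle (arrays s a) else regs s y) w)
      (λ _ _ → refl)

  -- The time is amortised: it is at most B plus the drop of the potential Φ.
  record Run (Φ : State → ℕ) (p : Program) (s : State) (B : ℕ) (R : State → Set) : Set where
    constructor run
    field
      {final}    : State
      {time}     : ℕ
      derivation : p ∶ s ⇓ final # time
      amortised  : time + Φ final ≤ B + Φ s
      result     : R final

  -- The zero potential, under which `Run` is a plain time bound.
  still : State → ℕ
  still _ = 0

  -- Computes on loop-free code, whose verification thereby becomes a statement about explicit final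
  -- states. `Empty` excludes loops, which are left to `run-for`.
  wp : Program → (State → Set) → State → Set
  wp skip                     R s = R s
  wp (x ≔ e)                  R s = R (setReg s x (eval s e))
  wp (a [ d ]≔ e)             R s = R (setArray s a (eval s d) (eval s e))
  wp (p ； q)                 R s = wp p (wp q R) s
  wp (if e then p else q end) R s = (eval s e ≢ 0 → wp p R s) × (eval s e ≡ 0 → wp q R s)
  wp (while e loop p end)     R s = Empty
  wp (query x a)              R s = R (setReg s x (oracle (arrays s a)))

  private
    cost-seq : ∀ a b c d q → (a + b * q) + (c + d * q) ≡ (a + c) + (b + d) * q
    cost-seq = solve-∀

    cost-ifˡ : ∀ e a b c d → suc e + (a + b * Q) ≤ (suc e + (a + c)) + (b + d) * Q
    cost-ifˡ e a b c d = begin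
      suc e + (a + b * Q)               ≡⟨ +-assoc (suc e) a _ ⟨
      suc e + a + b * Q                 ≤⟨ +-mono-≤ (+-monoʳ-≤ (suc e) (m≤m+n a c)) (*-monoˡ-≤ Q
          (m≤m+n b d)) ⟩
      (suc e + (a + c)) + (b + d) * Q   ∎
      where open ≤-Reasoning

    cost-ifʳ : ∀ e a b c d → suc e + (c + d * Q) ≤ (suc e + (a + c)) + (b + d) * Q
    cost-ifʳ e a b c d = subst₂ (λ x y → suc e + (c + d * Q) ≤ (suc e + x) + y * Q) (+-comm c a)
        (+-comm d b)
                           (cost-ifˡ e c d a b)

  -- `cost` charges both branches of a conditional, which makes the bound a function of the program
  -- and `Q` alone.
  wp-sound : ∀ p {R s} → wp p R s → ∃[ s′ ] ∃[ τ ] (p ∶ s ⇓ s′ # τ) × τ ≤ cost Q p × R s′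
  wp-sound skip w = _ , _ , ⇓skip , ≤-refl , w
  wp-sound (x ≔ e) w = _ , _ , ⇓reg , m≤m+n _ _ , w
  wp-sound (a [ d ]≔ e) w = _ , _ , ⇓array , m≤m+n _ _ , w
  wp-sound (p ； q) w with wp-sound p w
  ... | _ , _ , d , le , w′ with wp-sound q w′
  ...   | _ , _ , d′ , le′ , r = _ , _ , ⇓seq d d′ ,
    ≤-trans (+-mono-≤ le le′) (≤-reflexive (cost-seq (ops p) (queries p) (ops q) (queries q) Q)) , r
  wp-sound (if e then p else q end) {s = s} (w , w′) with eval s e ≟ 0
  ... | no e≢0 with wp-sound p (w e≢0)
  ...   | _ , _ , d , le , r = _ , _ , ⇓then e≢0 d ,
    ≤-trans (+-monoʳ-≤ (suc (size e)) le) (cost-ifˡ (size e) (ops p) (queries p) (ops q) (queries q)) , r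
  wp-sound (if e then p else q end) {s = s} (w , w′) | yes e≡0 with wp-sound q (w′ e≡0)
  ...   | _ , _ , d , le , r = _ , _ , ⇓else e≡0 d ,
    ≤-trans (+-monoʳ-≤ (suc (size e)) le) (cost-ifʳ (size e) (ops p) (queries p) (ops q) (queries q)) , r
  wp-sound (query x a) w = _ , _ , ⇓query , m≤m+n _ _ , w

  module _ {Φ : State → ℕ} where

    run-wp : ∀ p R {s} → wp p R s → (∀ {s′} → Same p s s′ → R s′ → Φ s′ ≤ Φ s) → Run Φ p s (cost Q p) R
    run-wp p R w Φ-≤ with wp-sound p {R} w
    ... | _ , _ , d , le , r = run d (+-mono-≤ le (Φ-≤ (⇓-same d) r)) r

    run-≤ : ∀ {p s B B′ R} → B ≤ B′ → Run Φ p s B R → Run Φ p s B′ R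
    run-≤ {s = s} le (run d a r) = run d (≤-trans a (+-monoˡ-≤ (Φ s) le)) r

    run-map : ∀ {p s B R R′} → (∀ {s′} → Same p s s′ → R s′ → R′ s′) → Run Φ p s B R → Run Φ p s B R′
    run-map f (run d a r) = run d a (f (⇓-same d) r)

    run-seq : ∀ {p q s B C R R′} → Run Φ p s B R → (∀ s′ → Same p s s′ → R s′ → Run Φ q s′ C R′) →
              Run Φ (p ； q) s (B + C) R′
    run-seq {s = s} {B} {C} (run {s₁} {τ} d a r) next with next s₁ (⇓-same d) r
    ... | run {s₂} {τ′} d′ a′ r′ = run (⇓seq d d′) (begin
      (τ + τ′) + Φ s₂  ≡⟨ +-assoc τ τ′ _ ⟩
      τ + (τ′ + Φ s₂)  ≤⟨ +-monoʳ-≤ τ a′ ⟩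
      τ + (C + Φ s₁)   ≡⟨ swap-+ τ C (Φ s₁) ⟩
      C + (τ + Φ s₁)   ≤⟨ +-monoʳ-≤ C a ⟩
      C + (B + Φ s)    ≡⟨ swap-+′ C B (Φ s) ⟩
      B + C + Φ s      ∎) r′
      where
      open ≤-Reasoning
      swap-+ : ∀ a b c → a + (b + c) ≡ b + (a + c)
      swap-+ = solve-∀
      swap-+′ : ∀ a b c → a + (b + c) ≡ b + a + c
      swap-+′ = solve-∀

    run-if : ∀ {e p q s B R} → (eval s e ≢ 0 → Run Φ p s B R) → (eval s e ≡ 0 → Run Φ q s B R) →
             Run Φ (if e then p else q end) s (suc (size e) + B) R
    run-if {e} {s = s} {B} then′ else′ with eval s e ≟ 0
    ... | no e≢0 with then′ e≢0
    ...   | run d a r = run (⇓then e≢0 d)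
      (≤-trans (≤-reflexive (+-assoc (suc (size e)) _ _))
        (≤-trans (+-monoʳ-≤ (suc (size e)) a) (≤-reflexive (sym (+-assoc (suc (size e)) B _))))) r
    run-if {e} {s = s} {B} then′ else′ | yes e≡0 with else′ e≡0
    ...   | run d a r = run (⇓else e≡0 d)
      (≤-trans (≤-reflexive (+-assoc (suc (size e)) _ _))
        (≤-trans (+-monoʳ-≤ (suc (size e)) a) (≤-reflexive (sym (+-assoc (suc (size e)) B _))))) r

    -- Each round adds 8 to the body, 4 for the test and 4 for the increment; the 6 are the initial
    -- assignment and the last test. The step must establish the invariant with the counter already
    -- raised. `Same` for the whole loop gives the step access to everything that the loop never
    -- writes.
    run-for : ∀ x n body {s₀ b B} (Inv : ℕ → State → Set) →
              writesReg body x ≡ false → writesReg body n ≡ false → (x ≡ᵇ n) ≡ false →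
              (∀ s v → Φ (setReg s x v) ≡ Φ s) →
              regs s₀ n ≡ b → Inv 0 (setReg s₀ x 0) →
              (∀ i s → i < b → Same (For x n body) s₀ s → regs s x ≡ i → Inv i s →
                Run Φ body s B (λ s′ → Inv (suc i) (setReg s′ x (suc i)))) →
              Run Φ (For x n body) s₀ (b * (B + 8) + 6) (Inv b)
    run-for x n body {s₀} {b} {B} Inv wx wn x≢n Φx n≡b init step =
      run-≤ (≤-reflexive (+-comm 2 _ ∙ +-assoc (b * (B + 8)) 4 2))
        (run-seq {R = λ s′ → s′ ≡ setReg s₀ x 0} (run ⇓reg (≤-reflexive (cong (2 +_)
            (Φx s₀ 0))) refl) λ { s′ sm refl →
          go b 0 s′ refl (same-seqˡ {p = x ≔ lit 0} {q = loopP} sm) (update-same (regs s₀) x 0)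
            (trans (cong (λ c → if c then 0 else regs s₀ n) x≢n) n≡b) init })
      where
      infixr 4 _∙_
      _∙_ : ∀ {a b c : ℕ} → a ≡ b → b ≡ c → a ≡ c
      _∙_ = trans
      loopP = while reg n ⊖ reg x loop body ； x ≔ reg x ⊕ lit 1 end
      rearrange : ∀ B r f → 4 + (B + (4 + (4 + r) + f)) ≡ B + 8 + r + 4 + f
      rearrange = solve-∀
      go : ∀ d i s → i + d ≡ b → Same (For x n body) s₀ s → regs s x ≡ i → regs s n ≡ b → Inv i s →
             Run Φ loopP s (d * (B + 8) + 4) (Inv b)
      go zero i s eq sm xi nb inv = run (⇓stop (trans (cong₂ _∸_ nb (xi ∙ sym (+-identityʳ i) ∙ eq))
          (n∸n≡0 b)))
        ≤-refl (subst (λ j → Inv j s) (sym (+-identityʳ i) ∙ eq) inv)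
      go (suc d) i s eq sm xi nb inv with step i s i<b sm xi inv
        where i<b = subst (i <_) eq (m<m+n i z<s)
      ... | run {s₁} {τ} D a inv₁ with go d (suc i) s₂ (sym (+-suc i d) ∙ eq) sm₂ xi₂ nb₂ inv₂
        where
        s₂ = setReg s₁ x (regs s₁ x + 1)
        xi₁ : regs s₁ x ≡ i
        xi₁ = sameReg (⇓-same D) x wx ∙ xi
        xi₁′ : regs s₁ x + 1 ≡ suc i
        xi₁′ = +-comm _ 1 ∙ cong suc xi₁
        xi₂ : regs s₂ x ≡ suc i
        xi₂ = update-same (regs s₁) x (regs s₁ x + 1) ∙ xi₁′
        nb₂ : regs s₂ n ≡ b
        nb₂ = cong (λ c → if c then regs s₁ x + 1 else regs s₁ n) x≢n ∙ sameReg (⇓-same D) n wn ∙ nb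
        inv₂ : Inv (suc i) s₂
        inv₂ = subst (λ v → Inv (suc i) (setReg s₁ x v)) (sym xi₁′) inv₁
        sm₂ : Same (For x n body) s₀ s₂
        sm₂ = same-trans sm (same-trans
          (same-seqʳ {p = x ≔ lit 0} {q = loopP} (same (λ y w → sameReg (⇓-same D) y (proj₁ (∨-false w)))
                                   (λ c w → sameArray (⇓-same D) c (proj₁ (∨-false w)))))
          (same-seqʳ {p = x ≔ lit 0} {q = loopP}
              (same (λ y w → cong (λ c → if c then regs s₁ x + 1 else regs s₁ y)
                  (proj₂ (∨-false {writesReg body y} w)))
                                   (λ c w → refl))))
      ...   | run {s₃} {τ′} D′ a′ r = run (⇓loop (λ z → <⇒≱ (subst (i <_) eq (m<m+n i z<s))
                                        (m∸n≡0⇒m≤n (sym (cong₂ _∸_ nb xi) ∙ z)))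
                                      (⇓seq D ⇓reg) D′) (begin
        4 + ((τ + 4) + τ′) + Φ s₃          ≡⟨ r₁ τ τ′ (Φ s₃) ⟩
        8 + τ + (τ′ + Φ s₃)                ≤⟨ +-monoʳ-≤ (8 + τ) a′ ⟩
        8 + τ + (d * (B + 8) + 4 + Φ (setReg s₁ x (regs s₁ x + 1))) ≡⟨ cong (λ f → 8 + τ +
            (d * (B + 8) + 4 + f)) (Φx s₁ _) ⟩
        8 + τ + (d * (B + 8) + 4 + Φ s₁)   ≡⟨ r₂ τ (d * (B + 8)) (Φ s₁) ⟩
        (τ + Φ s₁) + (12 + d * (B + 8))    ≤⟨ +-monoˡ-≤ (12 + d * (B + 8)) a ⟩
        (B + Φ s) + (12 + d * (B + 8))     ≡⟨ r₃ B (d * (B + 8)) (Φ s) ⟩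
        B + 8 + d * (B + 8) + 4 + Φ s      ∎) r
        where
        open ≤-Reasoning
        r₁ : ∀ a b c → 4 + ((a + 4) + b) + c ≡ 8 + a + (b + c)
        r₁ = solve-∀
        r₂ : ∀ a b c → 8 + a + (b + 4 + c) ≡ (a + c) + (12 + b)
        r₂ = solve-∀
        r₃ : ∀ a b c → (a + c) + (12 + b) ≡ a + 8 + b + 4 + c
        r₃ = solve-∀

  run-flat : ∀ p R {s} → wp p R s → Run still p s (cost Q p) R
  run-flat p R w = run-wp p R w (λ _ _ → z≤n)

  run-lift : ∀ {Φ p s B R} → Run still p s B (λ s′ → Φ s′ ≤ Φ s × R s′) → Run Φ p s B R
  run-lift (run d a (le , r)) = run d (+-mono-≤ (subst₂ _≤_ (+-identityʳ _) (+-identityʳ _) a) le) r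

-- Placements of roots and edges, the search tree, and augmentation.

-- A structure of k * n slots, the p-th belonging to the vertex p % n.  A slot
-- contains suc i if it holds item i, and 0 if it is empty.
module Slots (n-1 k : ℕ) where

  n N : ℕ
  n = suc n-1
  N = k * n

  record Holds (Item : ℕ → Set) (Fit : ℕ → ℕ → Set) (σ : ℕ → ℕ) : Set where
    constructor holding
    field
      sound    : ∀ {p i} → p < N → σ p ≡ suc i → Item i × Fit i (p % n)
      unique   : ∀ {p q i} → p < N → q < N → σ p ≡ suc i → σ q ≡ suc i → p ≡ q
      complete : ∀ {i} → Item i → ∃[ p ] p < N × σ p ≡ suc i
  open Holds public

  private variable
    Item Item′ : ℕ → Set
    Fit : ℕ → ℕ → Set
    σ : ℕ → ℕ
    p i : ℕ

  holds-map : (∀ {i} → Item i → Item′ i) → (∀ {i} → Item′ i → Item i) →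
              Holds Item Fit σ → Holds Item′ Fit σ
  holds-map to from (holding s u c) =
    holding (λ p<N eq → to (proj₁ (s p<N eq)) , proj₂ (s p<N eq)) u (c ∘ from)

  holds-remove : p < N → σ p ≡ suc i → Holds Item Fit σ → Holds (λ j → Item j × j ≢ i) Fit (σ [ p ↦ 0 ])
  holds-remove {p} {σ} {i} p<N σp (holding s u c) = holding
    (λ {q} {j} q<N eq → let q≢p , σq = old q eq in
       (proj₁ (s q<N σq) , λ { refl → q≢p (u q<N p<N σq σp) }) , proj₂ (s q<N σq))
    (λ {q} {r} q<N r<N eq eq′ → u q<N r<N (proj₂ (old q eq)) (proj₂ (old r eq′)))
    λ { (it , j≢i) → let q , q<N , σq = c it in
        q , q<N , trans (update-other σ p 0 (λ { refl → j≢i (suc-injective (trans (sym σq) σp)) })) σq }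
    where
    old : ∀ q {j} → (σ [ p ↦ 0 ]) q ≡ suc j → q ≢ p × σ q ≡ suc j
    old q {j} = update-cases σ p 0 (λ q b → b ≡ suc j → q ≢ p × σ q ≡ suc j) q (λ _ ()) (λ q≢p eq →
        q≢p , eq)

  holds-insert : p < N → σ p ≡ 0 → ¬ Item i → Fit i (p % n) → Holds Item Fit σ →
                 Holds (λ j → Item j ⊎ j ≡ i) Fit (σ [ p ↦ suc i ])
  holds-insert {p} {σ} {Item} {i} {Fit} p<N σp i∉ fit (holding s u c) = holding
    (λ {q} {j} q<N eq → [ (λ { (refl , refl) → inj₂ refl , fit }) ,
       (λ { (q≢p , σq) → inj₁ (proj₁ (s q<N σq)) , proj₂ (s q<N σq) }) ]′ (cases q eq))
    (λ {q} {r} q<N r<N eq eq′ → case (cases q eq , cases r eq′) of λ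
       { (inj₁ (refl , _) , inj₁ (refl , _)) → refl
       ; (inj₁ (_ , refl) , inj₂ (_ , σr)) → ⊥-elim (i∉ (proj₁ (s r<N σr)))
       ; (inj₂ (_ , σq) , inj₁ (_ , refl)) → ⊥-elim (i∉ (proj₁ (s q<N σq)))
       ; (inj₂ (_ , σq) , inj₂ (_ , σr)) → u q<N r<N σq σr })
    λ { (inj₁ it) → let q , q<N , σq = c it in
          q , q<N , trans (update-other σ p (suc i) (λ { refl → case trans (sym σp) σq of λ () })) σq
      ; (inj₂ refl) → p , p<N , update-same σ p (suc i) }
    where
    cases : ∀ q {j} → (σ [ p ↦ suc i ]) q ≡ suc j → (q ≡ p × j ≡ i) ⊎ (q ≢ p × σ q ≡ suc j)
    cases q {j} = update-cases σ p (suc i) (λ q b → b ≡ suc j → (q ≡ p × j ≡ i) ⊎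
        (q ≢ p × σ q ≡ suc j)) q
      (λ q≡p eq → inj₁ (q≡p , sym (suc-injective eq))) (λ q≢p eq → inj₂ (q≢p , eq))

-- The items are the roots i < t outside the independent set I and, as t + e,
-- the edges e present.  A root must be placed at its vertex, an edge
-- at one of its two ends B₀ e, B₁ e.
module Search {t : ℕ} (M : Matroid t) (n-1 k : ℕ) (ρ B₀ B₁ : ℕ → ℕ) (Present : ℕ → Set) where
  open Slots n-1 k public
  open MatroidProperties M public

  infix 4 _∈ᴵ_

  _∈ᴵ_ : ℕ → (ℕ → Bool) → Set
  i ∈ᴵ I = (i < t × I i ≡ false) ⊎ (∃[ e ] i ≡ t + e × Present e)

  Fits : ℕ → ℕ → Set
  Fits i w = (i < t → ρ i ≡ w) × (∀ e → i ≡ t + e → w ≡ B₀ e ⊎ w ≡ B₁ e)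

  Placement : (ℕ → Bool) → (ℕ → ℕ) → Set
  Placement I = Holds (_∈ᴵ I) Fits

  Joins : ℕ → ℕ → ℕ → Set
  Joins e a b = (B₀ e ≡ a × B₁ e ≡ b) ⊎ (B₀ e ≡ b × B₁ e ≡ a)

  joins-end : ∀ {e a b} → Joins e a b → b ≡ B₀ e ⊎ b ≡ B₁ e
  joins-end (inj₁ (_ , refl)) = inj₂ refl
  joins-end (inj₂ (refl , _)) = inj₁ refl

  -- The vertex w was reached from the slot par w of pv w, whose item can be
  -- moved to w: an edge, or a root x to be exchanged against exch w.
  record Link (σ mark pv par : ℕ → ℕ) (Root : ℕ → ℕ → Set) (w : ℕ) : Set where
    constructor link
    field
      slot<N  : par w < N
      vertex  : pv w ≡ par w % n
      marked  : mark (pv w) ≢ 0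
      earlier : mark (pv w) < mark w
      via     : (∃[ e ] σ (par w) ≡ suc (t + e) × Joins e (pv w) w) ⊎
                (∃[ x ] σ (par w) ≡ suc x × x < t × Root x w)
  open Link public

  -- Every vertex that an exchange of x leads to has been marked at time done x
  -- or earlier.  The bound b serves while the roots y are being tested.
  record Closed (I : ℕ → Bool) (mark done : ℕ → ℕ) (b x : ℕ) : Set where
    constructor mkClosed
    field
      root     : x < t
      outside  : I x ≡ false
      spanned  : ¬ Ind (I [ x ↦ true ])
      exchanged : ∀ y → y < b → I y ≡ true → Ind ((I [ y ↦ false ]) [ x ↦ true ]) →
                  mark (ρ y) ≢ 0 × mark (ρ y) ≤ done x
  open Closed public

  private variable
    mark pv par exch queue done lim lim′ : ℕ → ℕ
    tail : ℕ

  module _ (u v : ℕ) (σ : ℕ → ℕ) (I : ℕ → Bool) where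

    -- The equation of times records that `w` was reached by the scan of `x`. Together with `Closed`
    -- it bounds by `mark w` the marks of all vertices that exchanges of `x` lead to.
    SearchRoot : (mark exch done : ℕ → ℕ) → ℕ → ℕ → Set
    SearchRoot mark exch done x w =
      done x ≡ mark w × exch w < t × ρ (exch w) ≡ w × I (exch w) ≡ true ×
      Ind ((I [ exch w ↦ false ]) [ x ↦ true ])

    -- Mark 1 belongs to the starting vertices, and h + 2 to those first reached while the vertex at
    -- position h of the queue is scanned. The bound in `entry` therefore puts the mark of a parent
    -- below that of its child, and all marks at n or below. `lim x` says how far the exchanges of
    -- `x` have been tested; it is t for every root except the one in progress.
    record Tree (mark pv par exch queue done : ℕ → ℕ) (tail : ℕ) (lim : ℕ → ℕ) : Set where
      constructor tree
      field
        origin   : ∀ w → mark w ≡ 1 → w ≡ u ⊎ w ≡ v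
        links    : ∀ w → 2 ≤ mark w → Link σ mark pv par (SearchRoot mark exch done) w
        closed   : ∀ x → done x ≢ 0 → Closed I mark done (lim x) x
        queued   : ∀ w → mark w ≢ 0 → ∃[ m ] m < tail × queue m ≡ w
        entry    : ∀ m → m < tail → mark (queue m) ≢ 0 × mark (queue m) ≤ suc m × queue m < n
        distinct : ∀ {l m} → l < tail → m < tail → queue l ≡ queue m → l ≡ m
    open Tree public

    tail≤n : Tree mark pv par exch queue done tail lim → tail ≤ n
    tail≤n {queue = queue} {tail = tail} T = subst₂ _≤_ (#-true tail) (#-true n)
      (#-inject (λ m w → m < tail × queue m ≡ w) (λ m m<tail _ → queue m , proj₂
          (proj₂ (entry T m m<tail)) , refl , m<tail , refl)
        (λ { (l< , refl) (m< , eq) → distinct T l< m< (sym eq) }))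

    mark≤n : Tree mark pv par exch queue done tail lim → ∀ w → mark w ≤ n
    mark≤n {mark} T w with mark w ≟ 0
    ... | yes z = subst (_≤ n) (sym z) z≤n
    ... | no z with queued T w z
    ...   | m , m< , refl = ≤-trans (proj₁ (proj₂ (entry T m m<))) (≤-trans m< (tail≤n T))

    marked<n : Tree mark pv par exch queue done tail lim → ∀ w → mark w ≢ 0 → w < n
    marked<n T w z with queued T w z
    ... | m , m< , refl = proj₂ (proj₂ (entry T m m<))

    -- `w` was unmarked, so it occupies no position of the queue, is the parent of no vertex and is
    -- not among the vertices that `Closed` vouches for. Writing at `w` leaves all of these facts as
    -- they were.
    push : ∀ w p cv y st →
           Tree mark pv par exch queue done tail lim →
           w < n → mark w ≡ 0 → 1 ≤ st → st ≤ suc tail → (st ≡ 1 → w ≡ u ⊎ w ≡ v) →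
           (2 ≤ st → p < N × cv ≡ p % n × mark cv ≢ 0 × mark cv < st ×
             ((∃[ e ] σ p ≡ suc (t + e) × Joins e cv w) ⊎
              (∃[ x ] σ p ≡ suc x × x < t × done x ≡ st × y < t × ρ y ≡ w × I y ≡ true ×
                Ind ((I [ y ↦ false ]) [ x ↦ true ])))) →
           Tree (mark [ w ↦ st ]) (pv [ w ↦ cv ]) (par [ w ↦ p ]) (exch [ w ↦ y ])
               (queue [ tail ↦ w ]) done (suc tail) lim
    push {mark = mark} {pv} {par} {exch} {queue} {done} {tail} {lim} w p cv y st T w<n w0 1≤st st≤ org new = record
      { origin = λ z → update-cases mark w st (λ z b → b ≡ 1 → z ≡ u ⊎ z ≡ v) z (λ { refl → org })
          (λ _ → origin T z)
      ; links = links′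
      ; closed = λ x d → let c = closed T x d in mkClosed (root c) (outside c) (spanned c) λ z z<b Iz i →
          let nz , le = exchanged c z z<b Iz i in
          subst (_≢ 0) (sym (old nz)) nz , subst (_≤ done x) (sym (old nz)) le
      ; queued = λ z → update-cases mark w st (λ z b → b ≢ 0 → ∃[ m ] m < suc tail ×
          (queue [ tail ↦ w ]) m ≡ z) z
          (λ { refl _ → tail , ≤-refl , update-same queue tail w })
          (λ _ nz → let m , m< , eq = queued T z nz in
             m , m<n⇒m<1+n m< , trans (update-other queue tail w (<⇒≢ m<)) eq)
      ; entry = λ m m< → update-cases queue tail w (λ m b → m < suc tail → mark′ b ≢ 0 ×
          mark′ b ≤ suc m × b < n) m
          (λ { refl _ → subst (_≢ 0) (sym new-mark) (λ { refl → case 1≤st of λ () }) ,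
                        subst (_≤ suc tail) (sym new-mark) st≤ , w<n })
          (λ m≢ m< → let nz , le , <n = entry T m (≤∧≢⇒< (s≤s⁻¹ m<) m≢) in
             subst (_≢ 0) (sym (old nz)) nz , subst (_≤ suc m) (sym (old nz)) le , <n) m<
      ; distinct = λ {l} {m} l< m< eq → case (l ≟ tail) ,′ (m ≟ tail) of λ
          { (yes refl , yes refl) → refl
          ; (yes refl , no m≢) → ⊥-elim (fresh m (≤∧≢⇒< (s≤s⁻¹ m<) m≢)
              (trans (sym (update-other queue tail w m≢)) (trans (sym eq) (update-same queue tail w))))
          ; (no l≢ , yes refl) → ⊥-elim (fresh l (≤∧≢⇒< (s≤s⁻¹ l<) l≢)
              (trans (sym (update-other queue tail w l≢)) (trans eq (update-same queue tail w))))
          ; (no l≢ , no m≢) → distinct T (≤∧≢⇒< (s≤s⁻¹ l<) l≢) (≤∧≢⇒< (s≤s⁻¹ m<) m≢)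
              (trans (sym (update-other queue tail w l≢)) (trans eq (update-other queue tail w m≢))) }
      }
      where
      mark′ = mark [ w ↦ st ]
      new-mark : mark′ w ≡ st
      new-mark = update-same mark w st
      old : ∀ {z} → mark z ≢ 0 → mark′ z ≡ mark z
      old nz = update-other mark w st (λ { refl → nz w0 })
      fresh : ∀ m → m < tail → queue m ≢ w
      fresh m m< refl = proj₁ (entry T m m<) w0
      links′ : ∀ z → 2 ≤ mark′ z →
               Link σ mark′ (pv [ w ↦ cv ]) (par [ w ↦ p ]) (SearchRoot mark′ (exch [ w ↦ y ]) done) z
      links′ z 2≤ with z ≟ w
      ... | yes refl with new (subst (2 ≤_) new-mark 2≤)
      ...   | p<N , cv≡ , nz , lt , via′ = record
        { slot<N  = subst (_< N) (sym (update-same par z p)) p<N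
        ; vertex  = trans (update-same pv z cv) (trans cv≡ (cong (_% n) (sym (update-same par z p))))
        ; marked  = subst (λ a → mark′ a ≢ 0) (sym (update-same pv z cv)) (subst (_≢ 0)
            (sym (old nz)) nz)
        ; earlier = subst₂ _<_ (trans (sym (old nz)) (cong mark′ (sym (update-same pv z cv))))
            (sym new-mark) lt
        ; via = [ (λ { (e , eq , j) → inj₁ (e , trans (cong σ (update-same par z p)) eq ,
                       subst (λ a → Joins e a z) (sym (update-same pv z cv)) j) })
                , (λ { (x , eq , x<t , dx , y<t , ρy , Iy , i) → inj₂
                    (x , trans (cong σ (update-same par z p)) eq , x<t ,
                       trans dx (sym new-mark) , subst (λ y → y < t × ρ y ≡ z × I y ≡ true × Ind
                           ((I [ y ↦ false ]) [ x ↦ true ]))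
                         (sym (update-same exch z y)) (y<t , ρy , Iy , i)) }) ]′ via′
        }
      links′ z 2≤ | no z≢w = record
        { slot<N  = subst (_< N) (sym par≡) (slot<N L)
        ; vertex  = trans pv≡ (trans (vertex L) (cong (_% n) (sym par≡)))
        ; marked  = subst (_≢ 0) (sym mark-pv) (marked L)
        ; earlier = subst₂ _<_ (sym mark-pv) (sym mark≡) (earlier L)
        ; via = [ (λ { (e , eq , j) → inj₁ (e , trans (cong σ par≡) eq , subst (λ a → Joins e a z)
            (sym pv≡) j) })
                , (λ { (x , eq , x<t , dx , rest) → inj₂ (x , trans (cong σ par≡) eq , x<t , trans dx
                    (sym mark≡) ,
                       subst (λ y → y < t × ρ y ≡ z × I y ≡ true × Ind ((I [ y ↦ false ]) [ x ↦ true ]))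
                         (sym exch≡) rest) }) ]′ (via L)
        }
        where
        mark≡ = update-other mark w st z≢w
        pv≡ = update-other pv w cv z≢w
        par≡ = update-other par w p z≢w
        exch≡ = update-other exch w y z≢w
        L = links T z (subst (2 ≤_) (update-other mark w st z≢w) 2≤)
        mark-pv : mark′ ((pv [ w ↦ cv ]) z) ≡ mark (pv z)
        mark-pv = trans (cong mark′ pv≡) (old (marked L))

    -- A link through a root has its `done` equal to a mark of at least 2, so no link passes through
    -- the unscanned `x`, and its entry can be overwritten. The limit 0 says that none of its
    -- exchanges has been tested.
    start-root : ∀ x st →
                 Tree mark pv par exch queue done tail (λ _ → t) →
                 done x ≡ 0 → x < t → I x ≡ false → ¬ Ind (I [ x ↦ true ]) →
                 Tree mark pv par exch queue (done [ x ↦ st ]) tail ((λ _ → t) [ x ↦ 0 ])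
    start-root {mark} {pv} {par} {exch} {queue} {done} {tail} x st T dx x<t Ix dep = record
      { origin = origin T ; queued = queued T ; entry = entry T ; distinct = distinct T
      ; links = λ w 2≤ → let L = links T w 2≤ in record
          { slot<N = slot<N L ; vertex = vertex L ; marked = marked L ; earlier = earlier L
          ; via = [ inj₁ , (λ { (x′ , eq , x′<t , dx′ , rest) → inj₂ (x′ , eq , x′<t ,
              trans (update-other done x st (λ { refl → <⇒≢ (≤-trans (s≤s z≤n) 2≤)
                  (trans (sym dx) dx′) })) dx′ , rest) }) ]′ (via L) }
      ; closed = λ z d → case z ≟ x of λ
          { (yes refl) → mkClosed x<t Ix dep λ y y<b → case subst (y <_) (update-same
              (λ _ → t) z 0) y<b of λ ()
          ; (no z≢x) → let d≡ = update-other done x st z≢x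
                           c = closed T z (subst (_≢ 0) d≡ d) in
              mkClosed (root c) (outside c) (spanned c) λ y y<b Iy i →
                let nz , le = exchanged c y (subst (y <_) (update-other (λ _ → t) x 0 z≢x) y<b) Iy i in
                nz , subst (mark (ρ y) ≤_) (sym d≡) le }
      }

    tree-closed : (∀ x → done x ≢ 0 → Closed I mark done (lim x) x → Closed I mark done (lim′ x) x) →
      Tree mark pv par exch queue done tail lim → Tree mark pv par exch queue done tail lim′
    tree-closed f T = record { origin = origin T ; links = links T ; closed = λ x d → f x d
        (closed T x d)
                             ; queued = queued T ; entry = entry T ; distinct = distinct T }

    advance : ∀ {x y} →
      Tree mark pv par exch queue done tail ((λ _ → t) [ x ↦ y ]) →
      (I y ≡ true → Ind ((I [ y ↦ false ]) [ x ↦ true ]) → mark (ρ y) ≢ 0 × mark (ρ y) ≤ done x) →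
      Tree mark pv par exch queue done tail ((λ _ → t) [ x ↦ suc y ])
    advance {mark} {done = done} {x = x} {y} T new = tree-closed f T
      where
      f : ∀ z → done z ≢ 0 → Closed I mark done (((λ _ → t) [ x ↦ y ]) z) z → Closed I mark done
          (((λ _ → t) [ x ↦ suc y ]) z) z
      f z _ c with z ≟ x
      ... | yes refl = mkClosed (root c) (outside c) (spanned c) λ y′ y′<b Iy i → case y′ ≟ y of λ
            { (yes refl) → new Iy i
            ; (no y′≢y) → exchanged c y′ (subst (y′ <_) (sym (update-same (λ _ → t) z y))
                (≤∧≢⇒< (s≤s⁻¹ (subst (y′ <_) (update-same (λ _ → t) z (suc y)) y′<b)) y′≢y)) Iy i }
      ... | no z≢x = subst (λ b → Closed I mark done b z)
            (trans (update-other (λ _ → t) x y z≢x) (sym (update-other (λ _ → t) x (suc y) z≢x))) c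

    finish-root : ∀ {x} →
      Tree mark pv par exch queue done tail ((λ _ → t) [ x ↦ t ]) → Tree mark pv par exch queue done tail
          (λ _ → t)
    finish-root {mark} {done = done} {x = x} = tree-closed λ z _ → subst (λ b → Closed I mark done b z)
      (update-cases (λ _ → t) x t (λ _ b → b ≡ t) z (λ _ → refl) (λ _ → refl))

    -- The state of a slot that has not ended the search; in particular it is occupied.
    Scanned : (mark done : ℕ → ℕ) → ℕ → Set
    Scanned mark done p = ∃[ i ] σ p ≡ suc i × (i < t → done i ≢ 0) ×
                          (∀ e → i ≡ t + e → mark (B₀ e) ≢ 0 × mark (B₁ e) ≢ 0)

    -- The end of a successful search: the slot is empty, or becomes so because its root can join
    -- `I`.
    record Terminal (mark : ℕ → ℕ) (p w : ℕ) : Set where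
      constructor terminal
      field
        terminal<N     : p < N
        terminalVertex : p % n ≡ w
        terminalMarked : mark w ≢ 0
        terminalItem   : σ p ≡ 0 ⊎ (∃[ x ] σ p ≡ suc x × x < t × Ind (I [ x ↦ true ]))
    open Terminal public

  -- The fundamental circuit of x survives the exchanges made at vertices of
  -- larger mark: A consists of its elements other than x.
  PathRoot : (mark exch : ℕ → ℕ) → (ℕ → Bool) → ℕ → ℕ → Set
  PathRoot mark exch J x w = exch w < t × ρ (exch w) ≡ w × (∃[ A ]
    A ⊆[ t ] J × A (exch w) ≡ true × ¬ Ind (A [ x ↦ true ]) ×
    Ind ((A [ exch w ↦ false ]) [ x ↦ true ]) × (∀ y → y < t → A y ≡ true → mark (ρ y) ≤ mark w))

  -- An augmentation in progress: the slot p of w is empty, and the path from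
  -- an initial vertex to w is intact.
  record Path (mark pv par exch σ : ℕ → ℕ) (J : ℕ → Bool) (w p : ℕ) : Set where
    constructor path
    field
      placement : Placement J σ
      hole      : σ p ≡ 0
      hole<N    : p < N
      holeAt    : p % n ≡ w
      indep     : Ind J
      reached   : mark w ≢ 0
      pathLinks : ∀ z → 2 ≤ mark z → mark z ≤ mark w → Link σ mark pv par (PathRoot mark exch J) z
  open Path public

  module _ {u v : ℕ} {σ : ℕ → ℕ} {I : ℕ → Bool} {mark pv par exch queue done : ℕ → ℕ} {tail : ℕ}
           (T : Tree u v σ I mark pv par exch queue done tail (λ _ → t)) (P : Placement I σ) (II : Ind I) where

    -- Every x on the path is scanned before the exchanges of later roots are
    -- found, whence the bound on the marks of its circuit.
    tree-links : ∀ z → 2 ≤ mark z → Link σ mark pv par (PathRoot mark exch I) z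
    tree-links z 2≤ with links T z 2≤
    ... | link s<N ver mk early (inj₁ e) = link s<N ver mk early (inj₁ e)
    ... | link s<N ver mk early (inj₂ (x , eq , x<t , dx , y<t , ρy , Iy , i)) =
      link s<N ver mk early (inj₂ (x , eq , x<t , y<t , ρy , exchangeable I x ,
        (λ j _ e → proj₁ (exchangeable-true I x j e)) , exchangeable-intro I x (exch z) Iy i ,
        exchangeable-dependent II x<t (outside c) (spanned c) ,
        Ind-⊆ (λ j j<t e → exchange-cases (exchangeable I x) (exch z) x j e
                 (λ { refl → update-same (I [ exch z ↦ false ]) j true })
                 (λ _ j≢ e′ → exchange-true I (exch z) x j≢ (proj₁ (exchangeable-true I x j e′)))) i ,
        (λ y y<t e → let Iy , i = exchangeable-true I x y e in
           subst (mark (ρ y) ≤_) dx (proj₂ (exchanged c y y<t Iy i)))))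
      where c = closed T x (subst (_≢ 0) (sym dx) (λ z≡ → case subst (2 ≤_) z≡ 2≤ of λ ()))

    path-empty : ∀ {p w} → Terminal u v σ I mark p w → σ p ≡ 0 → Path mark pv par exch σ I w p
    path-empty (terminal p<N at mk _) σp = path P σp p<N at II mk (λ z 2≤ _ → tree-links z 2≤)

    path-free : ∀ {p w x} → Terminal u v σ I mark p w → σ p ≡ suc x → x < t → Ind (I [ x ↦ true ]) →
                Path mark pv par exch (σ [ p ↦ 0 ]) (I [ x ↦ true ]) w p
    path-free {p} {w} {x} (terminal p<N at mk _) σp x<t Ix = path
      (holds-map
        (λ { (inj₁ (i<t , Ii) , i≢x) → inj₁ (i<t , trans (update-other I x true i≢x) Ii)
           ; (inj₂ e , _) → inj₂ e })
        (λ { {i} (inj₁ (i<t , Ii)) → case i ≟ x of λ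
               { (yes refl) → true≢false (update-same I i true) Ii
               ; (no i≢x) → inj₁ (i<t , trans (sym (update-other I x true i≢x)) Ii) , i≢x }
           ; (inj₂ (e , refl , pr)) → inj₂ (e , refl , pr) , λ { refl → <⇒≱ x<t (m≤m+n t e) } })
        (holds-remove p<N σp P))
      (update-same σ p 0) p<N at Ix mk links′
      where
      links′ : ∀ z → 2 ≤ mark z → mark z ≤ mark w → Link (σ [ p ↦ 0 ]) mark pv par (PathRoot mark exch
          (I [ x ↦ true ])) z
      links′ z 2≤ le with tree-links z 2≤
      ... | link s<N ver mk′ early v′ = link s<N ver mk′ early
            ([ (λ { (e , eq , j) → inj₁ (e , trans same-slot eq , j) })
             , (λ { (x′ , eq , x′<t , y<t , ρy , A , A⊆ , rest) → inj₂
                 (x′ , trans same-slot eq , x′<t , y<t , ρy , A ,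
                    (λ i i<t Ai → update-cases I x true (λ _ b → b ≡ true) i (λ _ → refl)
                        (λ _ → A⊆ i i<t Ai)) , rest) }) ]′ v′)
        where
        -- The slot `par z` belongs to a vertex of smaller mark than `z`, hence of smaller mark than
        -- `w`, to which `p` belongs.
        same-slot : (σ [ p ↦ 0 ]) (par z) ≡ σ (par z)
        same-slot = update-other σ p 0 (λ eq →
          <⇒≱ (subst (λ a → mark a < mark z) (trans ver (trans (cong (_% n) eq) at)) early) le)

  module _ {mark pv par exch σ : ℕ → ℕ} {J : ℕ → Bool} {w p : ℕ} (P : Path mark pv par exch σ J w p) (2≤ : 2 ≤ mark w) where

    private
      q = par w
      a = pv w
      L = pathLinks P w 2≤ ≤-refl
      q<N = slot<N L

      p≢q : p ≢ q
      p≢q eq = <⇒≢ (earlier L) (cong mark (trans (vertex L) (trans (cong (_% n) (sym eq)) (holeAt P))))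

      σ₀ : ℕ → ℕ
      σ₀ = σ [ q ↦ 0 ]

      hole₀ : σ₀ p ≡ 0
      hole₀ = trans (update-other σ q 0 p≢q) (hole P)

      new-hole : ∀ c → (σ₀ [ p ↦ c ]) q ≡ 0
      new-hole c = trans (update-other σ₀ p c (p≢q ∘ sym)) (update-same σ q 0)

      -- The slot from which `z` was reached belongs to a vertex of mark below `mark z`. The two
      -- slots that change, `q` at `a` and `p` at `w`, belong to vertices of mark at least `mark z`.
      untouched : ∀ c z → par z % n ≡ pv z → mark (pv z) < mark z → mark z ≤ mark a →
                  (σ₀ [ p ↦ c ]) (par z) ≡ σ (par z)
      untouched c z ver lt le = trans
        (update-other σ₀ p c (λ eq → <-irrefl refl (<-trans (earlier L) (≤-trans
          (subst (λ b → mark b < mark z) (trans (sym ver) (trans (cong (_% n) eq) (holeAt P))) lt) le))))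
        (update-other σ q 0 (λ eq → <⇒≱ (subst (λ b → mark b < mark z)
          (trans (sym ver) (trans (cong (_% n) eq) (sym (vertex L)))) lt) le))

    path-edge : ∀ {e} → σ q ≡ suc (t + e) → Joins e a w →
                Path mark pv par exch (σ₀ [ p ↦ suc (t + e) ]) J a q
    path-edge {e} σq j = path
      (holds-map
        (λ { (inj₁ (it , _)) → it ; (inj₂ refl) → proj₁ (sound (placement P) q<N σq) })
        (λ {i} it → case i ≟ t + e of λ { (yes eq) → inj₂ eq ; (no i≢) → inj₁ (it , i≢) })
        (holds-insert (hole<N P) hole₀ (λ { (_ , ≢) → ≢ refl })
          ((λ lt → ⊥-elim (<⇒≱ lt (m≤m+n t e))) ,
           (λ e′ eq → subst₂ (λ w e → w ≡ B₀ e ⊎ w ≡ B₁ e) (sym (holeAt P)) (+-cancelˡ-≡ t e e′ eq)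
               (joins-end j)))
          (holds-remove q<N σq (placement P))))
      (new-hole _) q<N (sym (vertex L)) (indep P) (marked L)
      λ z 2≤z le → case pathLinks P z 2≤z (≤-trans le (<⇒≤ (earlier L))) of λ
        { (link s<N ver mk early v′) → let same-slot = untouched (suc (t + e)) z (sym ver) early le in
          link s<N ver mk early ([ (λ { (e , eq , j) → inj₁ (e , trans same-slot eq , j) })
                                 , (λ { (x , eq , rest) → inj₂ (x , trans same-slot eq , rest) }) ]′ v′) }

    -- The new set is independent by `exchange`, applied to the witness `A`. A witness A′ for a
    -- vertex `z` with `mark z` at most `mark a` has its roots at vertices of mark at most `mark z`,
    -- whereas `y` sits at `w`, whose mark is larger. So A′ does not contain `y` and stays inside J
    -- - y + x.
    path-root : ∀ {x} → σ q ≡ suc x → x < t → PathRoot mark exch J x w →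
                Path mark pv par exch (σ₀ [ p ↦ suc (exch w) ]) ((J [ exch w ↦ false ]) [ x ↦ true ]) a q
    path-root {x} σq x<t (y<t , ρy , A , A⊆J , Ay , dep , ind , late) = path
      (holds-map to from
        (holds-insert (hole<N P) hole₀
          (λ { (inj₁ (_ , Jy) , _) → true≢false (A⊆J y y<t Ay) Jy ; (inj₂ (e , eq , _) , _) → <⇒≱ y<t
              (subst (t ≤_) (sym eq) (m≤m+n t e)) })
          ((λ _ → trans ρy (sym (holeAt P))) , (λ e eq → ⊥-elim (<⇒≱ y<t (subst (t ≤_) (sym eq)
              (m≤m+n t e)))))
          (holds-remove q<N σq (placement P))))
      (new-hole _) q<N (sym (vertex L)) (exchange (indep P) A⊆J x<t y<t Ay Jx dep ind) (marked L)
      λ z 2≤z le → case pathLinks P z 2≤z (≤-trans le (<⇒≤ (earlier L))) of λ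
        { (link s<N ver mk early v′) → let same-slot = untouched (suc y) z (sym ver) early le in
          link s<N ver mk early
            ([ (λ { (e , eq , j) → inj₁ (e , trans same-slot eq , j) })
             , (λ { (x′ , eq , x′<t , y′<t , ρy′ , A′ , A′⊆ , A′y′ , dep′ , ind′ , late′) →
                    inj₂ (x′ , trans same-slot eq , x′<t , y′<t , ρy′ , A′ ,
                     (λ i i<t A′i → exchange-true J y x
                        (λ { refl → <⇒≱ (earlier L) (≤-trans (subst (λ b → mark b ≤ mark z) ρy
                            (late′ i i<t A′i)) le) })
                        (A′⊆ i i<t A′i)) ,
                     A′y′ , dep′ , ind′ , late′) }) ]′ v′) }
      where
      y = exch w
      Jx : J x ≡ false
      Jx = [ proj₂ , (λ { (e , eq , _) → ⊥-elim (<⇒≱ x<t (subst (t ≤_) (sym eq) (m≤m+n t e))) }) ]′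
             (proj₁ (sound (placement P) q<N σq))
      J′ = (J [ y ↦ false ]) [ x ↦ true ]
      to : ∀ {i} → (i ∈ᴵ J × i ≢ x) ⊎ i ≡ y → i ∈ᴵ J′
      to {i} (inj₁ (inj₁ (i<t , Ji) , i≢x)) = inj₁ (i<t , trans (update-other
          (J [ y ↦ false ]) x true i≢x)
        (update-cases J y false (λ _ b → b ≡ false) i (λ _ → refl) (λ _ → Ji)))
      to (inj₁ (inj₂ e , _)) = inj₂ e
      to {i} (inj₂ refl) = inj₁ (y<t , trans (update-other (J [ y ↦ false ]) x true
          (λ { refl → true≢false (A⊆J y y<t Ay) Jx }))
        (update-same J i false))
      from : ∀ {i} → i ∈ᴵ J′ → (i ∈ᴵ J × i ≢ x) ⊎ i ≡ y
      from {i} (inj₁ (i<t , J′i)) with i ≟ x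
      ... | yes refl = true≢false (update-same (J [ y ↦ false ]) i true) J′i
      ... | no i≢x with i ≟ y
      ...   | yes i≡y = inj₂ i≡y
      ...   | no i≢y = inj₁ (inj₁ (i<t , trans (sym (trans (update-other (J [ y ↦ false ]) x true i≢x)
          (update-other J y false i≢y))) J′i) , i≢x)
      from (inj₂ (e , refl , pr)) = inj₁ (inj₂ (e , refl , pr) , λ { refl → <⇒≱ x<t (m≤m+n t e) })

-- What the success or failure of a search says about (C2).

∧-true : ∀ {a b} → a ∧ b ≡ true → a ≡ true × b ≡ true
∧-true {true} eq = refl , eq

∧-intro : ∀ {a b} → a ≡ true → b ≡ true → a ∧ b ≡ true
∧-intro refl eq = eq

not-true : ∀ {a} → not a ≡ true → a ≡ false
not-true {false} _ = refl

fromFin-< : ∀ {n} (f : Fin n → ℕ) {i} (i<n : i < n) → fromFin f i ≡ f (fromℕ< i<n)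
fromFin-< {n} f {i} i<n with i <? n
... | yes i<n′ = cong (λ lt → f (fromℕ< lt)) (<-irrelevant i<n′ i<n)
... | no ¬i<n  = ⊥-elim (¬i<n i<n)

fromFin-toℕ : ∀ {n} (f : Fin n → ℕ) i → fromFin f (toℕ i) ≡ f i
fromFin-toℕ f i = trans (fromFin-< f (toℕ<n i)) (cong f (fromℕ<-toℕ i (toℕ<n i)))

concat : ℕ → (ℕ → Bool) → (ℕ → Bool) → ℕ → Bool
concat m f g i = if i <ᵇ m then f i else g (i ∸ m)

concat-< : ∀ m f g {i} → i < m → concat m f g i ≡ f i
concat-< m f g {i} i<m rewrite dec-true (i <? m) i<m = refl

concat-≥ : ∀ m f g i → concat m f g (m + i) ≡ g i
concat-≥ m f g i rewrite dec-false (m + i <? m) (≤⇒≯ (m≤m+n m i)) = cong g (m+n∸m≡n m i)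

#-concat : ∀ m n f g → # (m + n) (concat m f g) ≡ # m f + # n g
#-concat m n f g = trans (#-+ m n (concat m f g))
  (cong₂ _+_ (#-cong m (λ i → concat-< m f g)) (#-cong n (λ i _ → concat-≥ m f g i)))

-- The roots at a vertex, in order, are placed in the first slots of the vertex.
module Homes (n-1 k t : ℕ) (ρ : ℕ → ℕ) (ρ<n : ∀ i → i < t → ρ i < suc n-1)
             (few : ∀ w → w < suc n-1 → # t (λ i → ρ i ≡ᵇ w) ≤ k) where

  before : ℕ → ℕ → ℕ
  before w i = # i (λ j → ρ j ≡ᵇ w)

  home : ℕ → ℕ
  home i = ρ i + before (ρ i) i * suc n-1

  before-suc : ∀ i → before (ρ i) (suc i) ≡ suc (before (ρ i) i)
  before-suc i = begin
    before (ρ i) (suc i)                   ≡⟨ #-suc i (λ j → ρ j ≡ᵇ ρ i) ⟩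
    before (ρ i) i + bit (ρ i ≡ᵇ ρ i)      ≡⟨ cong (λ b → before (ρ i) i + bit b) (≡ᵇ-refl (ρ i)) ⟩
    before (ρ i) i + 1                     ≡⟨ +-comm _ 1 ⟩
    suc (before (ρ i) i)                   ∎
    where open ≡-Reasoning

  home-% : ∀ {i} → i < t → home i % suc n-1 ≡ ρ i
  home-% {i} i<t = trans ([m+kn]%n≡m%n (ρ i) (before (ρ i) i) (suc n-1)) (m<n⇒m%n≡m (ρ<n i i<t))

  home-< : ∀ {i} → i < t → home i < k * suc n-1
  home-< {i} i<t = ≤-trans (+-monoˡ-≤ (before (ρ i) i * suc n-1) (ρ<n i i<t))
    (*-monoˡ-≤ (suc n-1) (≤-trans (≤-reflexive (sym (before-suc i))) (≤-trans (#-monoˡ _ i<t)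
        (few (ρ i) (ρ<n i i<t)))))

  home-injective : ∀ {i j} → i < t → j < t → home i ≡ home j → i ≡ j
  home-injective {i} {j} i<t j<t eq = case <-cmp i j of λ
    { (tri< i<j _ _) → ⊥-elim (<⇒≢ (increasing i j i<j ρ≡) before≡)
    ; (tri≈ _ i≡j _) → i≡j
    ; (tri> _ _ j<i) → ⊥-elim (<⇒≢ (increasing j i j<i (sym ρ≡)) (sym before≡)) }
    where
    ρ≡ : ρ i ≡ ρ j
    ρ≡ = trans (sym (home-% i<t)) (trans (cong (_% suc n-1) eq) (home-% j<t))
    before≡ : before (ρ i) i ≡ before (ρ j) j
    before≡ = *-cancelʳ-≡ _ _ (suc n-1) (+-cancelˡ-≡ (ρ i) _ _
        (trans eq (cong (_+ before (ρ j) j * suc n-1) (sym ρ≡))))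
    increasing : ∀ i j → i < j → ρ i ≡ ρ j → before (ρ i) i < before (ρ j) j
    increasing i j i<j eq = ≤-trans (≤-reflexive (sym (before-suc i)))
      (subst (λ w → before (ρ i) (suc i) ≤ before w j) eq (#-monoˡ _ i<j))

  #-roots : ∀ (Y : ℕ → Bool) → # t (Y ∘ ρ) ≤ k * # (suc n-1) Y
  #-roots Y = subst (# t (Y ∘ ρ) ≤_) (#-mod k n-1 Y)
    (#-inject (λ i p → i < t × home i ≡ p)
      (λ i i<t Yi → home i , home-< i<t , trans (cong Y (home-% i<t)) Yi , i<t , refl)
      (λ { (i<t , refl) (j<t , eq) → home-injective i<t j<t (sym eq) }))

module Certificates (n-1 E : ℕ) (ends : Fin E → Fin (suc n-1) × Fin (suc n-1))
                    {t : ℕ} (root : Fin t → Fin (suc n-1)) (M : Matroid t) (k : ℕ) where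

  G : Graph
  G = record { |V| = suc n-1 ; |E| = E ; ends = ends }

  open Graph G using (V⟨_⟩; Incident; incident?)
  open Conditions G root M k

  g₀ g₁ ρ : ℕ → ℕ
  g₀ = fromFin λ e → toℕ (proj₁ (ends e))
  g₁ = fromFin λ e → toℕ (proj₂ (ends e))
  ρ  = fromFin λ i → toℕ (root i)

  g₀<n : ∀ {e} → e < E → g₀ e < suc n-1
  g₀<n e<E rewrite fromFin-< (λ e → toℕ (proj₁ (ends e))) e<E = toℕ<n _

  g₁<n : ∀ {e} → e < E → g₁ e < suc n-1
  g₁<n e<E rewrite fromFin-< (λ e → toℕ (proj₂ (ends e))) e<E = toℕ<n _

  ρ<n : ∀ i → i < t → ρ i < suc n-1
  ρ<n i i<t rewrite fromFin-< (λ i → toℕ (root i)) i<t = toℕ<n _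

  module OfEdges (F : Subset E) where

    f VF RF : ℕ → Bool
    f  = restrict (lookup F)
    VF = restrict (lookup V⟨ F ⟩)
    RF = restrict (lookup R⟨ F ⟩)

    VF-toℕ : ∀ w → VF (toℕ w) ≡ does (any? λ e → (e ∈? F) ×-dec incident? w e)
    VF-toℕ w = trans (restrict-toℕ (lookup V⟨ F ⟩) w) (lookup∘tabulate (λ w → does (any? λ e →
        (e ∈? F) ×-dec incident? w e)) w)

    VF-intro : ∀ {e w} → e < E → f e ≡ true → w ≡ g₀ e ⊎ w ≡ g₁ e → VF w ≡ true
    VF-intro {e} {w} e<E fe inc = subst (λ w → VF w ≡ true) (toℕ-fromℕ< w<n) (trans (VF-toℕ w′)
      (dec-true (any? λ e → (e ∈? F) ×-dec incident? w′ e) (e′ , lookup⇒[]= e′ F f-e′ ,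
        [ (λ eq → inj₁ (toℕ-injective (trans (toℕ-fromℕ< w<n) (trans eq (fromFin-< _ e<E)))))
        , (λ eq → inj₂ (toℕ-injective (trans (toℕ-fromℕ< w<n) (trans eq (fromFin-< _ e<E))))) ]′ inc)))
      where
      w<n : w < suc n-1
      w<n = [ (λ { refl → g₀<n e<E }) , (λ { refl → g₁<n e<E }) ]′ inc
      w′ = fromℕ< w<n
      e′ = fromℕ< e<E
      f-e′ : lookup F e′ ≡ true
      f-e′ = trans (sym (restrict-toℕ (lookup F) e′)) (trans (cong f (toℕ-fromℕ< e<E)) fe)

    VF-elim : ∀ {w} → w < suc n-1 → VF w ≡ true → ∃[ e ] e < E × f e ≡ true × (w ≡ g₀ e ⊎ w ≡ g₁ e)
    VF-elim {w} w<n eq with holds (any? λ e → (e ∈? F) ×-dec incident? (fromℕ< w<n) e)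
      (trans (sym (VF-toℕ (fromℕ< w<n))) (trans (cong VF (toℕ-fromℕ< w<n)) eq))
    ... | e , e∈F , inc = toℕ e , toℕ<n e , trans (restrict-toℕ (lookup F) e) ([]=⇒lookup e∈F) ,
      [ (λ eq → inj₁ (trans (sym (toℕ-fromℕ< w<n)) (trans (cong toℕ eq) (sym (fromFin-toℕ _ e)))))
      , (λ eq → inj₂ (trans (sym (toℕ-fromℕ< w<n)) (trans (cong toℕ eq) (sym (fromFin-toℕ _ e))))) ]′ inc

    RF-VF : ∀ i → i < t → RF i ≡ VF (ρ i)
    RF-VF i i<t = begin
      RF i                     ≡⟨ cong RF (toℕ-fromℕ< i<t) ⟨
      RF (toℕ i′)              ≡⟨ restrict-toℕ (lookup R⟨ F ⟩) i′ ⟩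
      lookup R⟨ F ⟩ i′         ≡⟨ lookup∘tabulate _ i′ ⟩
      does (root i′ ∈? V⟨ F ⟩) ≡⟨ ∈?-lookup ⟩
      lookup V⟨ F ⟩ (root i′)  ≡⟨ restrict-toℕ (lookup V⟨ F ⟩) (root i′) ⟨
      VF (toℕ (root i′))       ≡⟨ cong VF (fromFin-< _ i<t) ⟨
      VF (ρ i)                 ∎
      where
      open ≡-Reasoning
      i′ = fromℕ< i<t
      ∈?-lookup : does (root i′ ∈? V⟨ F ⟩) ≡ lookup V⟨ F ⟩ (root i′)
      ∈?-lookup with lookup V⟨ F ⟩ (root i′) in eq
      ... | true  = dec-true (root i′ ∈? V⟨ F ⟩) (lookup⇒[]= (root i′) V⟨ F ⟩ eq)
      ... | false = dec-false (root i′ ∈? V⟨ F ⟩) (λ r∈ → true≢false ([]=⇒lookup r∈) eq)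

    ∣VF∣>0 : ∀ {e} → e < E → f e ≡ true → 1 ≤ # (suc n-1) VF
    ∣VF∣>0 {e} e<E fe = subst (1 ≤_) (sym (#-delete (suc n-1) VF (g₀ e) (g₀<n e<E) (VF-intro e<E fe
        (inj₁ refl)))) (s≤s z≤n)

    Inequality : Set
    Inequality = ∣ F ∣ + ∣ R⟨ F ⟩ ∣ ≤ (k * ∣ V⟨ F ⟩ ∣ ∸ k) + rank M R⟨ F ⟩

    k≤kVF : ∀ {e} → e < E → f e ≡ true → k ≤ k * # (suc n-1) VF
    k≤kVF e<E fe = subst (_≤ k * # (suc n-1) VF) (*-identityʳ k) (*-monoʳ-≤ k (∣VF∣>0 e<E fe))

    -- The edge `e` provides V(F) with a vertex, so the subtraction of k is not truncated and k can
    -- be moved to the left.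
    inequality⁺ : ∀ {e} → e < E → f e ≡ true →
                  # E f + # t RF + k ≤ k * # (suc n-1) VF + rank M R⟨ F ⟩ → Inequality
    inequality⁺ e<E fe le rewrite ∣lookup∣ F | ∣lookup∣ R⟨ F ⟩ | ∣lookup∣ V⟨ F ⟩ =
      +-cancelʳ-≤ k _ _ (≤-trans le (≤-reflexive (trans (cong (_+ rank M R⟨ F ⟩)
          (sym (m∸n+n≡m (k≤kVF e<E fe))))
        (swap (k * # (suc n-1) VF ∸ k) k (rank M R⟨ F ⟩)))))
      where
      swap : ∀ a b c → a + b + c ≡ a + c + b
      swap = solve-∀

    inequality⁻ : ∀ {e} → e < E → f e ≡ true → Inequality →
                  # E f + # t RF + k ≤ k * # (suc n-1) VF + rank M R⟨ F ⟩
    inequality⁻ e<E fe ineq rewrite ∣lookup∣ F | ∣lookup∣ R⟨ F ⟩ | ∣lookup∣ V⟨ F ⟩ =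
      ≤-trans (+-monoˡ-≤ k ineq) (≤-reflexive (trans (swap (k * # (suc n-1) VF ∸ k) (rank M R⟨ F ⟩) k)
        (cong (_+ rank M R⟨ F ⟩) (m∸n+n≡m (k≤kVF e<E fe)))))
      where
      swap : ∀ a b c → a + b + c ≡ a + c + b
      swap = solve-∀

  -- While edge m is processed, the edges before m and j copies of m are
  -- present; the copies have the indices from E on.
  Present : ℕ → ℕ → ℕ → Set
  Present m j e = e < m ⊎ (E ≤ e × e < E + j)

  module _ (B₀ B₁ : ℕ → ℕ) (m j : ℕ) (m<E : m < E)
           (B₀-old : ∀ e → e < E → B₀ e ≡ g₀ e) (B₁-old : ∀ e → e < E → B₁ e ≡ g₁ e)
           (B₀-copy : ∀ i → i < suc k → B₀ (E + i) ≡ g₀ m) (B₁-copy : ∀ i → i < suc k → B₁ (E + i) ≡ g₁ m) where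
    open Search M n-1 k ρ B₀ B₁ (Present m j)

    module _ {σ : ℕ → ℕ} {I : ℕ → Bool} (P : Placement I σ) (II : Ind I) where

      -- The edges of `F` other than m, the k + 1 copies of m and the roots of R_F outside `I`
      -- occupy distinct slots at V(F), of which there are k|V(F)|. The roots in R_F ∩ I are
      -- independent and are paid for by the rank. The k on the left is the excess of the k + 1
      -- copies over the one edge m.
      all-copies⇒inequality : j ≡ suc k → ∀ F → OfEdges.f F m ≡ true →
                              (∀ e → e < E → OfEdges.f F e ≡ true → e ≤ m) → OfEdges.Inequality F
      all-copies⇒inequality refl F fm f≤m = inequality⁺ m<E fm (begin
        # E f + # t RF + k
          ≡⟨ cong₂ (λ a b → a + b + k) ∣F∣≡ (#-split t RF I) ⟩
        suc (# E f<) + (# t (λ i → RF i ∧ I i) + # t R∖I) + k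
          ≡⟨ rearrange (# E f<) (# t (λ i → RF i ∧ I i)) (# t R∖I) k ⟩
        (# t R∖I + (# E f< + suc k)) + # t (λ i → RF i ∧ I i)
          ≤⟨ +-mono-≤ items≤slots (rank-≥ {λ i → RF i ∧ I i} (Ind-⊆ {g = I}
              (λ i _ → proj₂ ∘ ∧-true {RF i}) II)
               (λ i ri → lookup⇒[]= i _ (trans (sym (restrict-toℕ (lookup R⟨ F ⟩) i))
                   (proj₁ (∧-true {RF (toℕ i)} ri))))) ⟩
        k * # n VF + rank M R⟨ F ⟩ ∎)
        where
        open OfEdges F
        open ≤-Reasoning
        rearrange : ∀ a b c d → suc a + (b + c) + d ≡ (c + (a + suc d)) + b
        rearrange = solve-∀
        f< R∖I : ℕ → Bool
        f< e = f e ∧ (e <ᵇ m)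
        R∖I i = RF i ∧ not (I i)
        f<m : f< m ≡ false
        f<m = ≢true⇒≡false (λ eq → n≮n m (holds (m <? m) (proj₂ (∧-true {f m} eq))))
        ∣F∣≡ : # E f ≡ suc (# E f<)
        f≡f< : ∀ e → e < E → f e ≡ (f< [ m ↦ true ]) e
        f≡f< e e<E with e ≟ m
        ... | yes refl = trans fm (sym (update-same f< e true))
        ... | no e≢m = trans unchanged (sym (update-other f< m true e≢m))
          where
          unchanged : f e ≡ f< e
          unchanged with f e in eq
          ... | false = refl
          ... | true  = sym (dec-true (e <? m) (≤∧≢⇒< (f≤m e e<E eq) e≢m))
        ∣F∣≡ = trans (#-cong E f≡f<) (#-insert E f< m m<E f<m)
        items : ℕ → Bool
        items = concat t R∖I (concat E f< (λ _ → true))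
        place : ∀ {i} → i ∈ᴵ I → (∀ p → Fits i (p % n) → VF (p % n) ≡ true) →
                ∃[ p ] p < N × VF (p % n) ≡ true × σ p ≡ suc i
        place it at with complete P it
        ... | p , p<N , σp = p , p<N , at p (proj₂ (sound P p<N σp)) , σp
        place-item : ∀ i → i < t + (E + suc k) → items i ≡ true → ∃[ p ] p < N × VF (p % n) ≡ true ×
            σ p ≡ suc i
        place-item i i< it with i <? t
        ... | yes i<t = let rf , ni = ∧-true (trans (sym (concat-< t R∖I (concat E f< (λ _ → true)) i<t)) it) in
          place (inj₁ (i<t , not-true ni)) λ p fit →
            trans (cong VF (sym (proj₁ fit i<t))) (trans (sym (RF-VF i i<t)) rf)
        ... | no i≮t with m≤n⇒∃[o]m+o≡n (≮⇒≥ i≮t)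
        ...   | e , refl with e <? E
        ...     | yes e<E = let fe , e<m = ∧-true {f e} (trans (sym (concat-< E f< (λ _ → true) e<E))
                                             (trans (sym (concat-≥ t R∖I (concat E f< (λ _ → true)) e)) it)) in
          place (inj₂ (e , refl , inj₁ (holds (e <? m) e<m))) λ p fit →
            VF-intro e<E fe ([ (λ eq → inj₁ (trans eq (B₀-old e e<E))) , (λ eq → inj₂
                (trans eq (B₁-old e e<E))) ]′ (proj₂ fit e refl))
        ...     | no e≮E with m≤n⇒∃[o]m+o≡n (≮⇒≥ e≮E)
        ...       | c , refl =
          place (inj₂ (E + c , refl , inj₂ (m≤m+n E c , +-cancelˡ-< t _ _ i<))) λ p fit →
            VF-intro m<E fm ([ (λ eq → inj₁ (trans eq (B₀-copy c c<))) , (λ eq → inj₂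
                (trans eq (B₁-copy c c<))) ]′ (proj₂ fit (E + c) refl))
          where c< = +-cancelˡ-< E _ _ (+-cancelˡ-< t _ _ i<)
        items≤slots : # t R∖I + (# E f< + suc k) ≤ k * # n VF
        items≤slots = begin
          # t R∖I + (# E f< + suc k) ≡⟨ cong (# t R∖I +_) (trans (#-concat E (suc k) f< (λ _ → true))
              (cong (# E f< +_) (#-true (suc k)))) ⟨
          # t R∖I + # (E + suc k) (concat E f< (λ _ → true)) ≡⟨ #-concat t (E + suc k) R∖I _ ⟨
          # (t + (E + suc k)) items  ≤⟨ #-inject (λ i p → σ p ≡ suc i) place-item (λ eq eq′ →
              suc-injective (trans (sym eq) eq′)) ⟩
          # N (λ p → VF (p % n))     ≡⟨ #-mod k n-1 VF ⟩
          k * # n VF                 ∎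

      -- `F` consists of m and the earlier edges with both ends in `X`, the set of marked vertices.
      -- Three estimates are added: (C2) for `F`, with r(R_F) replaced by |R_X ∩ I|; |R_X| + k|V(F)|
      -- ≤ k|X| + |R_F|, which takes care of the vertices of `X` outside V(F); and k|X| ≤ |R_X - I|
      -- + (|F| - 1) + k, as all slots at `X` are occupied. Their sum says |F| ≤ |F| - 1.
      stuck⇒violated : j ≤ k → (∀ w → w < n → # t (λ i → ρ i ≡ᵇ w) ≤ k) →
        ∀ {mark done} → mark (g₀ m) ≢ 0 → mark (g₁ m) ≢ 0 →
        (∀ x → done x ≢ 0 → Closed I mark done t x) →
        (∀ p → p < N → mark (p % n) ≢ 0 → Scanned (g₀ m) (g₁ m) σ I mark done p) → ¬ C2
      stuck⇒violated j≤k few {mark} {done} mu mv closed scanned c2 = n≮n _ (begin-strict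
        total                       <⟨ n<1+n _ ⟩
        suc total                   ≡⟨ r₁ (# E f<) (# t RF) k (# t (λ i → XR i ∧ not (I i)))
            (# t (λ i → XR i ∧ I i)) (k * # n VF) (k * # n X) ⟨
        (suc (# E f<) + # t RF + k) + (# t (λ i → XR i ∧ I i) + # t (λ i → XR i ∧ not
            (I i)) + k * # n VF) + k * # n X
          ≡⟨ cong₂ (λ a b → (a + # t RF + k) + (b + k * # n VF) + k * # n X) (sym ∣F∣≡)
              (sym (#-split t XR I)) ⟩
        (# E f + # t RF + k) + (# t XR + k * # n VF) + k * # n X
          ≤⟨ +-mono-≤ (+-mono-≤ ineq roots-of-X) slots≤items ⟩
        (k * # n VF + # t (λ i → XR i ∧ I i)) + (k * # n X + # t RF) + (# t (λ i → XR i ∧ not (I i)) +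
            (# E f< + k))
          ≡⟨ r₂ (# E f<) (# t RF) k (# t (λ i → XR i ∧ not (I i))) (# t (λ i → XR i ∧ I i)) (k * # n VF)
              (k * # n X) ⟩
        total                       ∎)
        where
        open ≤-Reasoning
        X XR ff f< : ℕ → Bool
        X w = not (mark w ≡ᵇ 0)
        XR i = X (ρ i)
        f< e = (e <ᵇ m) ∧ (X (g₀ e) ∧ X (g₁ e))
        ff e = (e ≡ᵇ m) ∨ f< e
        F : Subset E
        F = sub ff
        open OfEdges F
        total = # E f< + # t RF + k + # t (λ i → XR i ∧ not (I i)) + # t
            (λ i → XR i ∧ I i) + k * # n VF + k * # n X
        r₁ : ∀ a b c d e x y → (suc a + b + c) + (e + d + x) + y ≡ suc (a + b + c + d + e + x + y)
        r₁ = solve-∀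
        r₂ : ∀ a b c d e x y → (x + e) + (y + b) + (d + (a + c)) ≡ a + b + c + d + e + x + y
        r₂ = solve-∀
        X-intro : ∀ {w} → mark w ≢ 0 → X w ≡ true
        X-intro {w} nz rewrite ≢⇒≡ᵇ nz = refl
        X-elim : ∀ {w} → X w ≡ true → mark w ≢ 0
        X-elim {w} eq = fails (mark w ≟ 0) (not-true eq)
        f-ff : ∀ e → e < E → f e ≡ ff e
        f-ff e e<E = trans (cong f (sym (toℕ-fromℕ< e<E))) (trans (restrict-toℕ (lookup F) (fromℕ< e<E))
          (trans (lookup∘tabulate (ff ∘ toℕ) (fromℕ< e<E)) (cong ff (toℕ-fromℕ< e<E))))
        fm : f m ≡ true
        fm = trans (f-ff m m<E) (cong (_∨ f< m) (≡ᵇ-refl m))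
        ff-ends : ∀ e → ff e ≡ true → X (g₀ e) ≡ true × X (g₁ e) ≡ true
        ff-ends e eq with e ≟ m
        ... | yes refl = X-intro mu , X-intro mv
        ... | no e≢m = ∧-true (proj₂ (∧-true {e <ᵇ m} (trans (sym (cong (_∨ f< e) (≢⇒≡ᵇ e≢m))) eq)))
        f<m : f< m ≡ false
        f<m = ≢true⇒≡false (λ eq → n≮n m (holds (m <? m) (proj₁ (∧-true {m <ᵇ m} eq))))
        ∣F∣≡ : # E f ≡ suc (# E f<)
        ∣F∣≡ = trans (#-cong E (λ e e<E → trans (f-ff e e<E) (ff-update e))) (#-insert E f< m m<E f<m)
          where
          ff-update : ∀ e → ff e ≡ (f< [ m ↦ true ]) e
          ff-update e with e ≟ m
          ... | yes refl = trans (cong (_∨ f< e) (≡ᵇ-refl e)) (sym (update-same f< e true))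
          ... | no e≢m = trans (cong (_∨ f< e) (≢⇒≡ᵇ e≢m)) (sym (update-other f< m true e≢m))
        VF⊆X : VF ⊆[ n ] X
        VF⊆X w w<n vf with VF-elim w<n vf
        ... | e , e<E , fe , inc = [ (λ { refl → proj₁ (ff-ends e (trans (sym (f-ff e e<E)) fe)) })
                                   , (λ { refl → proj₂ (ff-ends e (trans
                                       (sym (f-ff e e<E)) fe)) }) ]′ inc
        -- A root of R_X outside `I` lies in a scanned slot, so every element of `I` it can be
        -- exchanged against is at a marked vertex. Its fundamental circuit stays within R_X, which
        -- makes R_X ∩ I a maximal independent subset there.
        rank-X : rank M R⟨ F ⟩ ≤ # t (λ i → XR i ∧ I i)
        rank-X = ≤-trans (rank-mono R⟨F⟩⊆RX) (rank-≤ {IX} IX-indep maximal)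
          where
          IX = λ i → XR i ∧ I i
          IX-indep : Ind IX
          IX-indep = Ind-⊆ {g = I} (λ i _ → proj₂ ∘ ∧-true {XR i}) II
          R⟨F⟩⊆RX : R⟨ F ⟩ ⊆ sub XR
          R⟨F⟩⊆RX {i} i∈ = ∈-tabulate⁺ (XR ∘ toℕ) (VF⊆X (ρ (toℕ i)) (ρ<n _ (toℕ<n i))
            (trans (sym (RF-VF (toℕ i) (toℕ<n i))) (trans (restrict-toℕ (lookup R⟨ F ⟩) i)
                ([]=⇒lookup i∈))))
          maximal : ∀ x → x ∈ sub XR → IX (toℕ x) ≡ false → ¬ Ind (IX [ toℕ x ↦ true ])
          maximal x x∈ IXx ind with ∈-tabulate⁻ (XR ∘ toℕ) x∈
          ... | Xx with complete P (inj₁ (toℕ<n x , trans (sym (cong (_∧ I (toℕ x)) Xx)) IXx))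
          ...   | p , p<N , σp with scanned p p<N (subst (λ w → mark w ≢ 0)
              (proj₁ (proj₂ (sound P p<N σp)) (toℕ<n x)) (X-elim Xx))
          ...     | i , σp′ , dn , _ with suc-injective (trans (sym σp) σp′)
          ...       | refl = exchangeable-dependent {I} II (toℕ<n x) (outside c) (spanned c)
            (Ind-⊆ (λ i i<t → update-cases (exchangeable I (toℕ x)) (toℕ x) true (λ i b → i < t →
                b ≡ true → (IX [ toℕ x ↦ true ]) i ≡ true) i
               (λ { refl _ _ → update-same IX (toℕ x) true })
               (λ i≢x i<t e → let Ii , ind = exchangeable-true I (toℕ x) i e in
                  trans (update-other IX (toℕ x) true i≢x)
                      (∧-intro (X-intro (proj₁ (exchanged c i i<t Ii ind))) Ii)) i<t) ind)
            where c = closed (toℕ x) (dn (toℕ<n x))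
        ineq : # E f + # t RF + k ≤ k * # n VF + # t (λ i → XR i ∧ I i)
        ineq = ≤-trans (inequality⁻ m<E fm (c2 F (fromℕ< m<E , ∈-tabulate⁺ (ff ∘ toℕ)
          (trans (cong ff (toℕ-fromℕ< m<E)) (cong (_∨ f< m) (≡ᵇ-refl m))))))
              (+-monoʳ-≤ (k * # n VF) rank-X)
        -- The roots at X - V(F) have distinct homes among the k slots of each of these vertices, so
        -- there are at most k|X - V(F)| of them.
        roots-of-X : # t XR + k * # n VF ≤ k * # n X + # t RF
        roots-of-X = begin
          # t XR + k * # n VF
            ≡⟨ cong (_+ k * # n VF) (#-split t XR RF) ⟩
          # t (λ i → XR i ∧ RF i) + # t (λ i → XR i ∧ not (RF i)) + k * # n VF
            ≤⟨ +-mono-≤ (+-mono-≤ (#-mono t (λ i _ → proj₂ ∘ ∧-true {XR i}))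
                (≤-trans (≤-reflexive (#-cong t (λ i i<t → cong (λ b → XR i ∧ not b) (RF-VF i i<t))))
                    (#-roots (λ w → X w ∧ not (VF w)))))
                (*-monoʳ-≤ k (#-mono n (λ w w<n vf → ∧-intro (VF⊆X w w<n vf) vf))) ⟩
          # t RF + k * # n (λ w → X w ∧ not (VF w)) + k * # n (λ w → X w ∧ VF w)
            ≡⟨ r₃ (# t RF) k (# n (λ w → X w ∧ not (VF w))) (# n (λ w → X w ∧ VF w)) ⟩
          k * (# n (λ w → X w ∧ VF w) + # n (λ w → X w ∧ not (VF w))) + # t RF
            ≡⟨ cong (λ a → k * a + # t RF) (#-split n X VF) ⟨
          k * # n X + # t RF ∎
          where
          open Homes n-1 k t ρ ρ<n few
          r₃ : ∀ a k b c → a + k * b + k * c ≡ k * (c + b) + a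
          r₃ = solve-∀
        R∖I : ℕ → Bool
        R∖I i = XR i ∧ not (I i)
        items : ℕ → Bool
        items = concat t R∖I (concat E f< (λ _ → true))
        item-at : ∀ p → p < N → X (p % n) ≡ true →
                  ∃[ i ] i < t + (E + k) × items i ≡ true × (p < N × σ p ≡ suc i)
        item-at p p<N Xp with scanned p p<N (X-elim Xp)
        ... | i , σp , _ , ends-marked with sound P p<N σp
        ...   | inj₁ (i<t , Ii) , at , _ = i , ≤-trans i<t (m≤m+n t _) ,
          trans (concat-< t R∖I (concat E f< (λ _ → true)) i<t)
            (∧-intro (trans (cong X (at i<t)) Xp) (cong not Ii)) , p<N , σp
        ...   | inj₂ (e , refl , inj₁ e<m) , _ , at = t + e , +-monoʳ-< t (≤-trans e<E (m≤m+n E k)) ,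
          trans (concat-≥ t R∖I (concat E f< (λ _ → true)) e) (trans (concat-< E f< (λ _ → true) e<E)
            (∧-intro (dec-true (e <? m) e<m) (∧-intro
               (trans (cong X (sym (B₀-old e e<E))) (X-intro (proj₁ (ends-marked e refl))))
               (trans (cong X (sym (B₁-old e e<E))) (X-intro (proj₂ (ends-marked e refl))))))) , p<N , σp
          where e<E = <-trans e<m m<E
        ...   | inj₂ (e , refl , inj₂ (E≤e , e<)) , _ with m≤n⇒∃[o]m+o≡n E≤e
        ...     | c , refl = t + (E + c) , +-monoʳ-< t (≤-trans e< (+-monoʳ-≤ E j≤k)) ,
          trans (concat-≥ t R∖I (concat E f< (λ _ → true)) (E + c)) (concat-≥ E f<
              (λ _ → true) c) , p<N , σp
        slots≤items : k * # n X ≤ # t R∖I + (# E f< + k)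
        slots≤items = begin
          k * # n X                 ≡⟨ #-mod k n-1 X ⟨
          # N (λ p → X (p % n))     ≤⟨ #-inject (λ p i → p < N × σ p ≡ suc i) item-at
              (λ { (p<N , eq) (q<N , eq′) → unique P p<N q<N eq eq′ }) ⟩
          # (t + (E + k)) items     ≡⟨ #-concat t (E + k) R∖I _ ⟩
          # t R∖I + # (E + k) (concat E f< (λ _ → true)) ≡⟨ cong (# t R∖I +_) (trans (#-concat E k f<
              (λ _ → true)) (cong (# E f< +_) (#-true k))) ⟩
          # t R∖I + (# E f< + k)    ∎

-- The program.

pattern $n      = 0
pattern $E      = 1
pattern $t      = 2
pattern $k      = 3
pattern $N      = 4
pattern $copies = 5
pattern $ok     = 6
pattern $m      = 7
pattern $j      = 8
pattern $u      = 9
pattern $v      = 10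
pattern $head   = 11
pattern $tail   = 12
pattern $found  = 13
pattern $stamp  = 14
pattern $cv     = 15
pattern $p      = 16
pattern $c      = 17
pattern $x      = 18
pattern $y      = 19
pattern $w      = 20
pattern $q      = 21
pattern $answer = 22
pattern $l      = 23
pattern $e      = 24
pattern $fp     = 25
pattern $fv     = 26

-- aI is the indicator of the independent set I and aσ holds the slots; aMark w
-- is the time at which the vertex w was reached and aDone x the time at which
-- the root x was scanned, 0 standing for never.
pattern a₀     = 0
pattern a₁     = 1
pattern aρ     = 2
pattern aI     = 3
pattern aσ     = 4
pattern aPv    = 5
pattern aMark  = 6
pattern aPar   = 7
pattern aExch  = 8
pattern aQueue = 9
pattern aDone  = 10
pattern aTest  = 11
pattern aPos   = 12

markP foundP edgeSlotP exchangeP rootTestP markRootP rootBodyP rootSlotP slotP slotStepP : Program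
startScanP scanP loopBodyP searchLoopP startSearchP searchP : Program

markP =
  if arr aMark (reg $w) then skip else
    aMark [ reg $w ]≔ reg $stamp ；
    aPv [ reg $w ]≔ reg $cv ；
    aPar [ reg $w ]≔ reg $p ；
    aExch [ reg $w ]≔ reg $y ；
    aQueue [ reg $tail ]≔ reg $w ；
    $tail ≔ reg $tail ⊕ lit 1
  end

foundP = $found ≔ lit 1 ； $fp ≔ reg $p ； $fv ≔ reg $cv

edgeSlotP =
  $e ≔ reg $c ⊖ (reg $t ⊕ lit 1) ；
  -- The sum of both ends less the current vertex is the other end, also for a loop.
  $w ≔ (arr a₀ (reg $e) ⊕ arr a₁ (reg $e)) ⊖ reg $cv ；
  markP

exchangeP =
  if arr aI (reg $y) then
    aI [ reg $y ]≔ lit 0 ；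
    aI [ reg $x ]≔ lit 1 ；
    query $answer aI ；
    aI [ reg $y ]≔ lit 1 ；
    aI [ reg $x ]≔ lit 0 ；
    if reg $answer then $w ≔ arr aρ (reg $y) ； markP else skip end
  else skip end

rootTestP = aI [ reg $x ]≔ lit 1 ； query $answer aI ； aI [ reg $x ]≔ lit 0

markRootP = aDone [ reg $x ]≔ reg $stamp ； For $y $t exchangeP

rootBodyP = rootTestP ； if reg $answer then foundP else markRootP end

rootSlotP = $x ≔ reg $c ⊖ lit 1 ； if arr aDone (reg $x) then skip else rootBodyP end

slotP =
  $c ≔ arr aσ (reg $p) ；
  if reg $c then
    -- A slot stores the successor of its item, so the difference is non-zero exactly when the item
    -- is at least t, that is, an edge.
    if reg $c ⊖ reg $t then edgeSlotP else rootSlotP end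
  else foundP end

-- A `For` loop has no exit, so its remaining rounds idle once something is found. Adding n leads to
-- the next slot of the same vertex.
slotStepP = if reg $found then skip else slotP end ； $p ≔ reg $p ⊕ reg $n

-- The stamp is offset by 2 because 0 stands for unmarked and 1 is reserved for the ends of the new
-- edge.
startScanP = $cv ≔ arr aQueue (reg $head) ； $stamp ≔ reg $head ⊕ lit 2 ； $p ≔ reg $cv

scanP = startScanP ； For $l $k slotStepP

loopBodyP = if reg $found then skip else if reg $tail ⊖ reg $head then scanP else skip end end

-- n rounds suffice, since no vertex enters the queue twice.
searchLoopP = For $head $n loopBodyP

startSearchP =
  $tail ≔ lit 0 ； $stamp ≔ lit 1 ； $found ≔ lit 0 ；
  $w ≔ reg $u ； markP ； $w ≔ reg $v ； markP

searchP =
  For $w $n (aMark [ reg $w ]≔ lit 0) ；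
  For $x $t (aDone [ reg $x ]≔ lit 0) ；
  startSearchP ；
  searchLoopP

startWalkP stepP augmentP placeCopyP insertP startEdgeP copyP copiesP insertionsP cleanP edgeP : Program

startWalkP =
  $w ≔ reg $fv ； $p ≔ reg $fp ； $c ≔ arr aσ (reg $p) ；
  if reg $c then aI [ reg $c ⊖ lit 1 ]≔ lit 1 ； aσ [ reg $p ]≔ lit 0 else skip end

stepP =
  -- At mark 1 the walk has arrived at an end of the new edge, and the remaining rounds idle.
  if arr aMark (reg $w) ⊖ lit 1 then
    $q ≔ arr aPar (reg $w) ； $c ≔ arr aσ (reg $q) ； aσ [ reg $q ]≔ lit 0 ；
    if reg $c ⊖ reg $t then aσ [ reg $p ]≔ reg $c else
      $y ≔ arr aExch (reg $w) ； aI [ reg $y ]≔ lit 0 ； aI [ reg $c ⊖ lit 1 ]≔ lit 1 ；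
      aσ [ reg $p ]≔ reg $y ⊕ lit 1
    end ；
    $p ≔ reg $q ； $w ≔ arr aPv (reg $w)
  else skip end

augmentP = startWalkP ； For $l $n stepP

placeCopyP = aσ [ reg $p ]≔ reg $t ⊕ reg $E ⊕ reg $j ⊕ lit 1

insertP =
  searchP ；
  if reg $found then augmentP ； placeCopyP else $ok ≔ lit 0 end

startEdgeP = $u ≔ arr a₀ (reg $m) ； $v ≔ arr a₁ (reg $m)

copyP = a₀ [ reg $E ⊕ reg $l ]≔ reg $u ； a₁ [ reg $E ⊕ reg $l ]≔ reg $v

copiesP = For $l $copies copyP

insertionsP = For $j $copies (if reg $ok then insertP else skip end)

cleanP =
  -- Contents above t + E are copies, and t + E + 1 is the first of them.
  if arr aσ (reg $q) ⊖ (reg $t ⊕ reg $E) then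
    if arr aσ (reg $q) ⊖ (reg $t ⊕ reg $E ⊕ lit 1) then aσ [ reg $q ]≔ lit 0
    else aσ [ reg $q ]≔ reg $t ⊕ reg $m ⊕ lit 1 end
  else skip end

edgeP =
  startEdgeP ；
  copiesP ；
  insertionsP ；
  if reg $ok then For $q $N cleanP else skip end

testP answerP checkVertexP checkRootsP placeP placeRootsP edgesP checkedP multiplyP decideP answerOkP mainP : Program

-- The two truncated differences add up to the distance, and 1 minus the distance is the indicator
-- of equality.
testP = aTest [ reg $x ]≔ lit 1 ⊖ ((arr aρ (reg $x) ⊖ reg $w) ⊕ (reg $w ⊖ arr aρ (reg $x)))

answerP = query $answer aTest ； if reg $answer then skip else $ok ≔ lit 0 end

checkVertexP = For $x $t testP ； answerP

checkRootsP = For $w $n checkVertexP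

placeP =
  aσ [ arr aPos (arr aρ (reg $x)) ]≔ reg $x ⊕ lit 1 ；
  aPos [ arr aρ (reg $x) ]≔ arr aPos (arr aρ (reg $x)) ⊕ reg $n

placeRootsP =
  $copies ≔ reg $k ⊕ lit 1 ；
  For $w $n (aPos [ reg $w ]≔ reg $w) ；
  For $x $t placeP

edgesP = For $m $E (if reg $ok then edgeP else skip end)

checkedP = checkRootsP ； if reg $ok then placeRootsP ； edgesP else skip end

multiplyP = $N ≔ lit 0 ； For $l $k ($N ≔ reg $N ⊕ reg $n)

decideP =
  -- (C3) comes first: once it holds, the number of edges is at most k n, on which the time bound
  -- rests.
  if (reg $E ⊕ reg $t ⊖ reg $N) ⊕ (reg $N ⊖ (reg $E ⊕ reg $t)) then skip else
    $ok ≔ lit 1 ；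
    -- For k = 0, (C3) leaves neither edges nor roots, so there is nothing more to check.
    if reg $k then checkedP else skip end
  end

answerOkP = $n ≔ lit 1 ⊖ (lit 1 ⊖ reg $ok)

mainP = multiplyP ； decideP ； answerOkP

-- Correctness and cost of one search.

Represents : (ℕ → ℕ) → (ℕ → Bool) → Set
Represents a f = ∀ i → a i ≡ bit (f i)

represents-insert : ∀ {a f} x → Represents a f → Represents (a [ x ↦ 1 ]) (f [ x ↦ true ])
represents-insert {a} {f} x r i with x ≡ᵇ i
... | true  = refl
... | false = r i

represents-delete : ∀ {a f} x → Represents a f → Represents (a [ x ↦ 0 ]) (f [ x ↦ false ])
represents-delete {a} {f} x r i with x ≡ᵇ i
... | true  = refl
... | false = r i

bit-true : ∀ {b} → bit b ≢ 0 → b ≡ true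
bit-true {true}  _ = refl
bit-true {false} p = ⊥-elim (p refl)

bit-false : ∀ {b} → bit b ≡ 0 → b ≡ false
bit-false {false} _ = refl

module Oracle {t : ℕ} (M : Matroid t) (Q : ℕ) where
  open Semantics M Q
  open MatroidProperties M

  oracle-agrees : ∀ {a f} → (∀ i → i < t → a i ≡ bit (f i)) → oracle a ≡ bit (does (ind? f))
  oracle-agrees {a} {f} r = cong (λ S → bit (does (Matroid.indep? M S)))
    (tabulate-cong λ i → trans (cong (0 <ᵇ_) (r (toℕ i) (toℕ<n i))) (0<ᵇbit (f (toℕ i))))
    where
    0<ᵇbit : ∀ b → (0 <ᵇ bit b) ≡ b
    0<ᵇbit true  = refl
    0<ᵇbit false = refl

  oracle-yes : ∀ {a f} → Represents a f → oracle a ≢ 0 → Ind f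
  oracle-yes {f = f} r nz = holds (ind? f) (bit-true (nz ∘ trans (oracle-agrees {f = f} (λ i _ → r i))))

  oracle-no : ∀ {a f} → Represents a f → oracle a ≡ 0 → ¬ Ind f
  oracle-no {f = f} r z = fails (ind? f)
      (bit-false (trans (sym (oracle-agrees {f = f} (λ i _ → r i))) z))

-- What the search never undoes: marks, scans of roots, and the filled part of the queue. It carries
-- facts about scanned slots and the current visit over to later states.
record Grow (mark done queue : ℕ → ℕ) (tail : ℕ) (mark′ done′ queue′ : ℕ → ℕ) (tail′ : ℕ) : Set where
  constructor grow
  field
    markGrow  : ∀ w → mark w ≢ 0 → mark′ w ≢ 0
    doneGrow  : ∀ x → done x ≢ 0 → done′ x ≢ 0
    queueGrow : ∀ m → m < tail → queue′ m ≡ queue m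
    tailGrow  : tail ≤ tail′
open Grow public

grow-refl : ∀ {mark done queue tail} → Grow mark done queue tail mark done queue tail
grow-refl = grow (λ _ nz → nz) (λ _ nz → nz) (λ _ _ → refl) ≤-refl

grow-trans : ∀ {m d q t m′ d′ q′ t′ m″ d″ q″ t″} → Grow m d q t m′ d′ q′ t′ →
    Grow m′ d′ q′ t′ m″ d″ q″ t″ →
             Grow m d q t m″ d″ q″ t″
grow-trans (grow a b c d) (grow a′ b′ c′ d′) =
  grow (λ w → a′ w ∘ a w) (λ x → b′ x ∘ b x) (λ m m< → trans (c′ m (≤-trans m< d)) (c m m<))
      (≤-trans d d′)

-- These follow the shape of the programs: 2 is the test of a register, while 8 and 6 come from
-- `run-for`. `slotCost` leaves out `rootCost`, which is paid from the potential; `loopCost` adds it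
-- once for each root and once more for the success of the search.
module Costs (Q n t k : ℕ) where

  markRootCost rootCost slotCost slotStepCost scanCost clearCost loopCost searchCost walkCost insertCost : ℕ
  markRootCost = 3 + (t * (cost Q exchangeP + 8) + 6)
  rootCost     = cost Q rootTestP + (2 + markRootCost)
  slotCost     = 3 + (2 + (4 + cost Q edgeSlotP))
  slotStepCost = (2 + slotCost) + 4
  scanCost     = cost Q startScanP + (k * (slotStepCost + 8) + 6)
  clearCost    = (n * (3 + 8) + 6) + (t * (3 + 8) + 6)
  loopCost     = (n * ((2 + (4 + scanCost)) + 8) + 6) + rootCost * suc t
  searchCost   = clearCost + (cost Q startSearchP + loopCost)
  walkCost     = cost Q startWalkP + (n * (cost Q stepP + 8) + 6)
  insertCost   = searchCost + (2 + (walkCost + cost Q placeCopyP))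

  copiesCost edgeCost checkVertexCost checkRootsCost placeRootsCost checkedCost mainCost : ℕ
  edgesCost : ℕ → ℕ
  copiesCost      = suc k * (cost Q copyP + 8) + 6
  edgeCost        = cost Q startEdgeP + (copiesCost + ((suc k * ((2 + insertCost) + 8) + 6) +
                      (2 + (k * n * (cost Q cleanP + 8) + 6))))
  edgesCost E     = E * ((2 + edgeCost) + 8) + 6
  checkVertexCost = (t * (cost Q testP + 8) + 6) + cost Q answerP
  checkRootsCost  = n * (checkVertexCost + 8) + 6
  placeRootsCost  = 4 + ((n * (3 + 8) + 6) + (t * (cost Q placeP + 8) + 6))
  checkedCost     = checkRootsCost + (2 + (placeRootsCost + edgesCost (k * n)))
  mainCost        = (2 + (k * (4 + 8) + 6)) + ((12 + (2 + (2 + checkedCost))) + 6)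

module SearchProgram {t : ℕ} (M : Matroid t) (Q n-1 k : ℕ) (ρ B₀ B₁ : ℕ → ℕ) (Present : ℕ → Set)
  (ρ<n : ∀ i → i < t → ρ i < suc n-1)
  (B<n : ∀ e → Present e → B₀ e < suc n-1 × B₁ e < suc n-1)
  (u v : ℕ) (u<n : u < suc n-1) (v<n : v < suc n-1) (σ : ℕ → ℕ) (I : ℕ → Bool)
  (P : Search.Placement M n-1 k ρ B₀ B₁ Present I σ) (II : MatroidProperties.Ind M I)
  where

  open Search M n-1 k ρ B₀ B₁ Present
  open Logic M Q
  open Semantics M Q
  open Oracle M Q
  open Costs Q n t k

  -- Indexed by the registers and arrays that it speaks of rather than by the state, so that
  -- assignments elsewhere leave its type the same up to conversion.
  record EnvV (rn rt rk ru rv : ℕ) (b₀ b₁ r sg i : ℕ → ℕ) : Set where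
    constructor envV
    field
      n≡ : rn ≡ n
      t≡ : rt ≡ t
      k≡ : rk ≡ k
      u≡ : ru ≡ u
      v≡ : rv ≡ v
      B₀≡ : b₀ ≡ B₀
      B₁≡ : b₁ ≡ B₁
      ρ≡ : r ≡ ρ
      σ≡ : sg ≡ σ
      I≡ : Represents i I
  open EnvV public

  with-I : ∀ {rn rt rk ru rv b₀ b₁ r sg i i′} → Represents i′ I → EnvV rn rt rk ru rv b₀ b₁ r sg i →
           EnvV rn rt rk ru rv b₀ b₁ r sg i′
  with-I r (envV a b c d e f g h i _) = envV a b c d e f g h i r

  Env : State → Set
  Env s = EnvV (regs s $n) (regs s $t) (regs s $k) (regs s $u) (regs s $v)
               (arrays s a₀) (arrays s a₁) (arrays s aρ) (arrays s aσ) (arrays s aI)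

  TreeS : (ℕ → ℕ) → State → Set
  TreeS lim s = Tree u v σ I (arrays s aMark) (arrays s aPv) (arrays s aPar) (arrays s aExch)
                     (arrays s aQueue) (arrays s aDone) (regs s $tail) lim

  GrowS : State → State → Set
  GrowS s s′ = Grow (arrays s aMark) (arrays s aDone) (arrays s aQueue) (regs s $tail)
                    (arrays s′ aMark) (arrays s′ aDone) (arrays s′ aQueue) (regs s′ $tail)

  -- Guarantees that a vertex that is already marked when a root `x` is scanned has mark at most
  -- `done x`, as `Closed` requires.
  Bounded : State → Set
  Bounded s = ∀ w → arrays s aMark w ≤ regs s $stamp

  wp-mark : ∀ {lim} s (R : State → Set) → TreeS lim s → Bounded s → Env s → regs s $w < n →
    1 ≤ regs s $stamp → regs s $stamp ≤ suc (regs s $tail) →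
    (regs s $stamp ≡ 1 → regs s $w ≡ u ⊎ regs s $w ≡ v) →
    (2 ≤ regs s $stamp → regs s $p < N × regs s $cv ≡ regs s $p % n ×
      arrays s aMark (regs s $cv) ≢ 0 × arrays s aMark (regs s $cv) < regs s $stamp ×
        ((∃[ e ] σ (regs s $p) ≡ suc (t + e) × Joins e (regs s $cv) (regs s $w)) ⊎
         (∃[ x ] σ (regs s $p) ≡ suc x × x < t × arrays s aDone x ≡ regs s $stamp ×
           regs s $y < t × ρ (regs s $y) ≡ regs s $w × I (regs s $y) ≡ true ×
           Ind ((I [ regs s $y ↦ false ]) [ x ↦ true ])))) →
    (∀ s′ → TreeS lim s′ → Bounded s′ → Env s′ → GrowS s s′ → arrays s′ aMark (regs s $w) ≢ 0 →
      (∀ x → writesReg markP x ≡ false → regs s′ x ≡ regs s x) → arrays s′ aDone ≡ arrays s aDone →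
          R s′) →
    wp markP R s
  wp-mark {lim} s R T bd env w<n 1≤st st≤ org lnk next =
    (λ nz → next s T bd env grow-refl nz (λ _ _ → refl) refl) ,
    (λ z → next _ (subst (λ b → Tree u v σ I (arrays s aMark [ w ↦ st ])
        (arrays s aPv [ w ↦ regs s $cv ])
                           (arrays s aPar [ w ↦ regs s $p ]) (arrays s aExch [ w ↦ regs s $y ])
                           (arrays s aQueue [ regs s $tail ↦ w ]) (arrays s aDone) b lim)
                    (+-comm 1 (regs s $tail))
                    (push u v σ I w (regs s $p) (regs s $cv) (regs s $y) st T w<n z 1≤st st≤ org lnk))
             (λ z → update-cases (arrays s aMark) w st (λ _ b → b ≤ st) z (λ _ → ≤-refl) (λ _ → bd z))
             env
             (grow (λ z nz → update-cases (arrays s aMark) w st (λ _ b → b ≢ 0) z (λ _ → st≢0)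
                 (λ _ → nz)) (λ _ nz → nz)
                   (λ m m< → update-other (arrays s aQueue) (regs s $tail) w (<⇒≢ m<)) (m≤m+n _ 1))
             (subst (_≢ 0) (sym (update-same (arrays s aMark) w st)) st≢0)
             (λ x wr → cong (λ b → if b then regs s $tail + 1 else regs s x) wr) refl)
    where
    w = regs s $w
    st = regs s $stamp
    st≢0 : st ≢ 0
    st≢0 eq = case subst (1 ≤_) eq 1≤st of λ ()

  record VisitV (h : ℕ) (stamp cv tail : ℕ) (queue : ℕ → ℕ) : Set where
    constructor visitV
    field
      h<tail : h < tail
      stamp≡ : stamp ≡ 2 + h
      cv≡    : cv ≡ queue h
  open VisitV public

  Visit : ℕ → State → Set
  Visit h s = VisitV h (regs s $stamp) (regs s $cv) (regs s $tail) (arrays s aQueue)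

  wp-mark-visit : ∀ {lim} s h (R : State → Set) → TreeS lim s → Bounded s → Env s → Visit h s →
      regs s $w < n →
    regs s $p < N → regs s $cv ≡ regs s $p % n →
    ((∃[ e ] σ (regs s $p) ≡ suc (t + e) × Joins e (regs s $cv) (regs s $w)) ⊎
     (∃[ x ] σ (regs s $p) ≡ suc x × x < t × arrays s aDone x ≡ regs s $stamp ×
       regs s $y < t × ρ (regs s $y) ≡ regs s $w × I (regs s $y) ≡ true ×
       Ind ((I [ regs s $y ↦ false ]) [ x ↦ true ]))) →
    (∀ s′ → TreeS lim s′ → Bounded s′ → Env s′ → GrowS s s′ → Visit h s′ → arrays s′ aMark
        (regs s $w) ≢ 0 →
      (∀ x → writesReg markP x ≡ false → regs s′ x ≡ regs s x) → arrays s′ aDone ≡ arrays s aDone →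
          R s′) →
    wp markP R s
  wp-mark-visit s h R T bd env V w<n p<N cv≡p lnk next = wp-mark s R T bd env w<n
    (subst (1 ≤_) (sym (stamp≡ V)) (s≤s z≤n))
    (subst (_≤ suc (regs s $tail)) (sym (stamp≡ V)) (s≤s (h<tail V)))
    (λ eq → case trans (sym (stamp≡ V)) eq of λ ())
    (λ _ → p<N , cv≡p , subst (λ c → arrays s aMark c ≢ 0) (sym (cv≡ V)) (proj₁ ent) ,
      subst₂ _<_ (cong (arrays s aMark) (sym (cv≡ V))) (sym (stamp≡ V)) (s≤s (proj₁ (proj₂ ent))) , lnk)
    (λ s′ T′ bd′ env′ g nz sm dn → next s′ T′ bd′ env′ g
      (visitV (≤-trans (h<tail V) (tailGrow g)) (trans (sm $stamp refl) (stamp≡ V))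
        (trans (sm $cv refl) (trans (cv≡ V) (sym (queueGrow g h (h<tail V)))))) nz sm dn)
    where ent = entry T h (h<tail V)

  tLim : ℕ → ℕ
  tLim _ = t

  Slot : State → ℕ → Set
  Slot s p = Scanned u v σ I (arrays s aMark) (arrays s aDone) p

  Found : State → Set
  Found s = Terminal u v σ I (arrays s aMark) (regs s $fp) (regs s $fv)

  scanned-grow : ∀ {s s′ p} → GrowS s s′ → Slot s p → Slot s′ p
  scanned-grow g (i , σp , d , b) = i , σp , (λ i<t → doneGrow g i (d i<t)) ,
    (λ e eq → let nz , nz′ = b e eq in markGrow g _ nz , markGrow g _ nz′)

  record ScannedSlot (h p : ℕ) (s s′ : State) : Set where
    constructor scannedSlot
    field
      tree′    : TreeS tLim s′
      bounded′ : Bounded s′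
      env′     : Env s′
      visit′   : Visit h s′
      grow′    : GrowS s s′
      missed   : regs s′ $found ≡ 0 → Slot s′ p
      hit      : regs s′ $found ≢ 0 → Found s′
  open ScannedSlot public

  other-end : ∀ {e a} → a ≡ B₀ e ⊎ a ≡ B₁ e → Joins e a ((B₀ e + B₁ e) ∸ a)
  other-end {e} (inj₁ refl) = inj₁ (refl , sym (m+n∸m≡n (B₀ e) (B₁ e)))
  other-end {e} (inj₂ refl) = inj₂ (sym (m+n∸n≡m (B₀ e) (B₁ e)) , refl)

  EdgeScanned : State → ℕ → State → Set
  EdgeScanned s h s′ = ScannedSlot h (regs s $p) s s′ × regs s′ $found ≡ 0 ×
      arrays s′ aDone ≡ arrays s aDone

  wp-edgeSlot : ∀ s h i → TreeS tLim s → Bounded s → Env s → Visit h s → regs s $found ≡ 0 →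
    regs s $p < N → regs s $cv ≡ regs s $p % n → regs s $c ≡ suc i → σ (regs s $p) ≡ suc i → t ≤ i →
    wp edgeSlotP (EdgeScanned s h) s
  wp-edgeSlot s h i T bd env V nf p<N cv≡p c≡ σp t≤i = go (m≤n⇒∃[o]m+o≡n t≤i)
    where
    e′ = regs s $c ∸ (regs s $t + 1)
    w′ = (arrays s a₀ e′ + arrays s a₁ e′) ∸ regs s $cv
    go : (∃[ e ] t + e ≡ i) → wp edgeSlotP (EdgeScanned s h) s
    go (e , refl) = wp-mark-visit (setReg (setReg s $e e′) $w w′) h
        (EdgeScanned s h) T bd env V w<n p<N cv≡p
      (inj₁ (e , σp , joins))
      λ s′ T′ bd′ env″ g V′ nz sm dn → scannedSlot T′ bd′ env″ V′ g
        (λ _ → t + e , σp , (λ lt → ⊥-elim (<⇒≱ lt (m≤m+n t e))) ,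
          λ e₁ eq → subst (λ e → arrays s′ aMark (B₀ e) ≢ 0 × arrays s′ aMark (B₁ e) ≢ 0)
              (+-cancelˡ-≡ t e e₁ eq)
            (both {arrays s′ aMark} joins (markGrow g _ cv-marked) nz))
        (λ nz → ⊥-elim (nz (trans (sm $found refl) nf))) , trans (sm $found refl) nf , dn
      where
      at : Present e × (regs s $p % n ≡ B₀ e ⊎ regs s $p % n ≡ B₁ e)
      at with sound P p<N σp
      ... | inj₁ (lt , _) , _ = ⊥-elim (<⇒≱ lt (m≤m+n t e))
      ... | inj₂ (e₁ , eq , pr) , _ , at = subst Present (+-cancelˡ-≡ t e₁ e (sym eq)) pr , at e refl
      e′≡ : e′ ≡ e
      e′≡ = trans (cong₂ _∸_ c≡ (trans (cong (_+ 1) (t≡ env)) (+-comm t 1))) (m+n∸m≡n t e)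
      w≡ : w′ ≡ (B₀ e + B₁ e) ∸ regs s $cv
      w≡ = cong (_∸ regs s $cv) (cong₂ _+_ (trans (cong (λ b → b e′) (B₀≡ env)) (cong B₀ e′≡))
                                           (trans (cong (λ b → b e′) (B₁≡ env)) (cong B₁ e′≡)))
      joins : Joins e (regs s $cv) w′
      joins = subst (Joins e (regs s $cv)) (sym w≡)
        (other-end (subst (λ c → c ≡ B₀ e ⊎ c ≡ B₁ e) (sym cv≡p) (proj₂ at)))
      w<n : w′ < n
      w<n = [ (λ { eq → subst (_< n) (sym eq) (proj₁ (B<n e (proj₁ at))) })
            , (λ { eq → subst (_< n) (sym eq) (proj₂ (B<n e (proj₁ at))) }) ]′ (joins-end joins)
      cv-marked : arrays s aMark (regs s $cv) ≢ 0
      cv-marked = subst (λ c → arrays s aMark c ≢ 0) (sym (cv≡ V)) (proj₁ (entry T h (h<tail V)))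
      both : ∀ {mark : ℕ → ℕ} {e a b} → Joins e a b → mark a ≢ 0 → mark b ≢ 0 → mark (B₀ e) ≢ 0 × mark
          (B₁ e) ≢ 0
      both (inj₁ (refl , refl)) ma mb = ma , mb
      both (inj₂ (refl , refl)) ma mb = mb , ma

  restore-exchange : ∀ {a x y} → Represents a I → I y ≡ true → I x ≡ false →
    Represents ((((a [ y ↦ 0 ]) [ x ↦ 1 ]) [ y ↦ 1 ]) [ x ↦ 0 ]) I
  restore-exchange {a} {x} {y} r Iy Ix i with i ≟ x
  ... | yes refl = trans (update-same (((a [ y ↦ 0 ]) [ i ↦ 1 ]) [ y ↦ 1 ]) i 0) (cong bit (sym Ix))
  ... | no i≢x with i ≟ y
  ...   | yes refl = trans (update-other (((a [ i ↦ 0 ]) [ x ↦ 1 ]) [ i ↦ 1 ]) x 0 i≢x)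
                     (trans (update-same ((a [ i ↦ 0 ]) [ x ↦ 1 ]) i 1) (cong bit (sym Iy)))
  ...   | no i≢y = trans (update-other (((a [ y ↦ 0 ]) [ x ↦ 1 ]) [ y ↦ 1 ]) x 0 i≢x)
                   (trans (update-other ((a [ y ↦ 0 ]) [ x ↦ 1 ]) y 1 i≢y)
                   (trans (update-other (a [ y ↦ 0 ]) x 1 i≢x) (trans (update-other a y 0 i≢y) (r i))))

  restore-insert : ∀ {a x} → Represents a I → I x ≡ false → Represents ((a [ x ↦ 1 ]) [ x ↦ 0 ]) I
  restore-insert {a} {x} r Ix i with i ≟ x
  ... | yes refl = trans (update-same (a [ i ↦ 1 ]) i 0) (cong bit (sym Ix))
  ... | no i≢x = trans (update-other (a [ x ↦ 1 ]) x 0 i≢x) (trans (update-other a x 1 i≢x) (r i))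

  record Exchanging (h x : ℕ) (s₀ : State) (y : ℕ) (s : State) : Set where
    constructor exchanging
    field
      treeˣ    : TreeS (tLim [ x ↦ y ]) s
      boundedˣ : Bounded s
      envˣ     : Env s
      visitˣ   : Visit h s
      growˣ    : GrowS s₀ s
      doneˣ    : arrays s aDone ≡ arrays s₀ aDone
  open Exchanging

  -- Only an independent I - y + x obliges the vertex of `y` to be marked. Whether it is marked now
  -- or was before, `Bounded` keeps its mark at or below the stamp, which is `done x`. In the other
  -- outcomes the new instance of `Closed` is vacuous.
  wp-exchange : ∀ s₀ s h x y → Exchanging h x s₀ y s → y < t → regs s $y ≡ y → regs s $x ≡ x → x < t →
    I x ≡ false → arrays s aDone x ≡ regs s $stamp → regs s $p < N → regs s $cv ≡ regs s $p % n → σ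
        (regs s $p) ≡ suc x →
    wp exchangeP (λ s′ → Exchanging h x s₀ (suc y) (setReg s′ $y (suc y))) s
  wp-exchange s₀ s h x y (exchanging T bd env V g dn) y<t y≡ x≡ x<t Ix dx p<N cv≡p σp =
    (λ Iy≢0 → let Iy = bit-true (subst (_≢ 0) (trans (cong (arrays s aI) y≡) (I≡ env y)) Iy≢0)
                  env₁ = with-I (subst₂ (λ x′ y′ → Represents
                      ((((arrays s aI [ y′ ↦ 0 ]) [ x′ ↦ 1 ]) [ y′ ↦ 1 ]) [ x′ ↦ 0 ]) I)
                                            (sym x≡) (sym y≡) (restore-exchange (I≡ env) Iy Ix)) env
                  rep = subst₂ (λ x′ y′ → Represents ((arrays s aI [ y′ ↦ 0 ]) [ x′ ↦ 1 ])
                      ((I [ y ↦ false ]) [ x ↦ true ]))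
                          (sym x≡) (sym y≡) (represents-insert x (represents-delete y (I≡ env)))
                  ρy = trans (cong (λ r → r (regs s $y)) (ρ≡ env)) (cong ρ y≡)
              in
        (λ yes′ → let ind = oracle-yes rep yes′ in
          wp-mark-visit (s₁ (oracle a₂)) h R T bd env₁ V (subst (_< n) (sym ρy) (ρ<n y y<t)) p<N cv≡p
            (inj₂ (x , σp , x<t , dx , subst (_< t) (sym y≡) y<t ,
              trans (cong ρ y≡) (sym ρy) , trans (cong I y≡) Iy ,
              subst (λ y → Ind ((I [ y ↦ false ]) [ x ↦ true ])) (sym y≡) ind))
            λ s′ T′ bd′ env′ g′ V′ nz sm dn′ → exchanging
              (advance u v σ I {x = x} {y} T′ λ _ _ → subst (λ w → arrays s′ aMark w ≢ 0) ρy nz ,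
                ≤-trans (bd′ _) (≤-reflexive (trans (sm $stamp refl) (trans (sym dx) (cong (λ d → d x)
                    (sym dn′))))))
              bd′ env′ V′ (grow-trans g g′) (trans dn′ dn)) ,
        (λ no′ → exchanging (advance u v σ I {x = x} {y} T (λ _ ind → ⊥-elim
            (oracle-no rep no′ ind))) bd env₁ V g dn)) ,
    (λ Iy≡0 → exchanging (advance u v σ I {x = x} {y} T λ Iy _ → true≢false Iy
                 (bit-false (trans (sym (trans (cong (arrays s aI) y≡)
                     (I≡ env y))) Iy≡0))) bd env V g dn)
    where
    R : State → Set
    R s′ = Exchanging h x s₀ (suc y) (setReg s′ $y (suc y))
    a₂ : ℕ → ℕ
    a₂ = (arrays s aI [ regs s $y ↦ 0 ]) [ regs s $x ↦ 1 ]
    s₁ : ℕ → State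
    s₁ o = setReg (setArray (setArray (setReg (setArray (setArray s aI (regs s $y) 0) aI
        (regs s $x) 1) $answer o)
             aI (regs s $y) 1) aI (regs s $x) 0) $w (arrays s aρ (regs s $y))

  open Exchanging

  -- A root that is tested against `I` is either recorded as scanned or ends the search. Each such
  -- test thus lowers this number, and `run-pay` covers its cost with budget 0.
  potential : State → ℕ
  potential s = # t (λ x → arrays s aDone x ≡ᵇ 0) + (1 ∸ regs s $found)

  Φ : State → ℕ
  Φ s = rootCost * potential s

  Φ-same : ∀ s s′ {p} → Same p s s′ → writesReg p $found ≡ false → writesArray p aDone ≡ false →
      Φ s′ ≤ Φ s
  Φ-same s s′ sm wf wd rewrite sameReg sm $found wf | sameArray sm aDone wd = ≤-refl

  run-pay : ∀ {p s R} → Run still p s rootCost (λ s′ → suc (potential s′) ≤ potential s × R s′) →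
      Run Φ p s 0 R
  run-pay {s = s} (run {final = s′} {τ} d a (lt , r)) = run d (begin
    τ + rootCost * potential s′         ≤⟨ +-monoˡ-≤ _ (subst₂ _≤_ (+-identityʳ _) (+-identityʳ _) a) ⟩
    rootCost + rootCost * potential s′  ≡⟨ *-suc rootCost _ ⟨
    rootCost * suc (potential s′)       ≤⟨ *-monoʳ-≤ rootCost lt ⟩
    rootCost * potential s              ∎) r
    where open ≤-Reasoning

  run-found : ∀ s h p → TreeS tLim s → Bounded s → Env s → Visit h s → regs s $p ≡ p → p < N →
      regs s $cv ≡ p % n →
    (σ p ≡ 0 ⊎ (∃[ x ] σ p ≡ suc x × x < t × Ind (I [ x ↦ true ]))) → ∀ s₀ → GrowS s₀ s →
    Run still foundP s 6 (λ s′ → ScannedSlot h p s₀ s′ × regs s′ $found ≡ 1 ×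
        arrays s′ aDone ≡ arrays s aDone)
  run-found s h p T bd env V refl p<N cv≡p item s₀ g = run-flat foundP _ (scannedSlot T bd env V g (λ ())
    (λ _ → terminal p<N (sym cv≡p) (subst (λ c → arrays s aMark c ≢ 0) (sym (cv≡ V))
        (proj₁ (entry T h (h<tail V)))) item) ,
    refl , refl)

  run-markRoot : ∀ s₀ s h x p → TreeS tLim s → Bounded s → Env s → Visit h s → GrowS s₀ s →
      regs s $found ≡ 0 →
    regs s $p ≡ p → p < N → regs s $cv ≡ p % n → regs s $x ≡ x → σ p ≡ suc x → x < t → I x ≡ false →
    ¬ Ind (I [ x ↦ true ]) → arrays s aDone x ≡ 0 → arrays s aDone ≡ arrays s₀ aDone →
    Run still markRootP s markRootCost (λ s′ → ScannedSlot h p s₀ s′ × regs s′ $found ≡ 0 ×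
      arrays s′ aDone ≡ arrays s₀ aDone [ x ↦ regs s $stamp ])
  run-markRoot s₀ s h x p T bd env V g nf refl p<N cv≡p refl σp x<t Ix dep dx dn =
    run-seq (run-flat (aDone [ reg $x ]≔ reg $stamp) (λ s′ → s′ ≡ s₁) refl) λ { s′ _ refl →
      run-map after (run-for $y $t exchangeP Inv refl refl refl (λ _ _ → refl) (t≡ env)
        (exchanging (start-root u v σ I x st T dx x<t Ix dep) bd env V grow-refl refl)
        λ i s₂ i<t sm yi inv → let open Same′ sm in
          run-flat exchangeP (λ s′ → Inv (suc i) (setReg s′ $y (suc i)))
              (wp-exchange s₁ s₂ h x i inv i<t yi x≡′ x<t Ix
            (trans (cong (λ d → d x) (doneˣ inv)) (trans (update-same (arrays s aDone) x st)
                (sym stamp≡′)))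
            (subst (_< N) (sym p≡′) p<N) (trans cv≡′ (trans cv≡p (cong (_% n) (sym p≡′))))
                (trans (cong σ p≡′) σp))) }
    where
    st = regs s $stamp
    s₁ = setArray s aDone x st
    Inv : ℕ → State → Set
    Inv = Exchanging h x s₁
    module Same′ {s₂} (sm : Same (For $y $t exchangeP) s₁ s₂) where
      x≡′ = sameReg sm $x refl
      p≡′ = sameReg sm $p refl
      cv≡′ = sameReg sm $cv refl
      stamp≡′ = sameReg sm $stamp refl
    dn-grow : GrowS s s₁
    dn-grow = grow (λ _ nz → nz) (λ z nz → update-cases (arrays s aDone) x st (λ _ b → b ≢ 0) z
                (λ _ → st≢0) (λ _ → nz)) (λ _ _ → refl) ≤-refl
      where st≢0 : st ≢ 0
            st≢0 eq = case trans (sym eq) (stamp≡ V) of λ ()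
    after : ∀ {s′} → Same (For $y $t exchangeP) s₁ s′ → Inv t s′ →
      ScannedSlot h p s₀ s′ × regs s′ $found ≡ 0 × arrays s′ aDone ≡ arrays s₀ aDone [ x ↦ st ]
    after {s′} sm inv = scannedSlot (finish-root u v σ I {x = x} (treeˣ inv)) (boundedˣ inv) (envˣ inv)
        (visitˣ inv)
      (grow-trans g (grow-trans dn-grow (growˣ inv)))
      (λ _ → x , σp , (λ _ → doneGrow (growˣ inv) x λ eq → case trans (sym (stamp≡ V))
          (trans (sym (update-same (arrays s aDone) x st)) eq) of λ ()) ,
             λ e eq → ⊥-elim (<⇒≱ x<t (subst (t ≤_) (sym eq) (m≤m+n t e))))
      (λ nz → ⊥-elim (nz (trans (sameReg sm $found refl) nf))) ,
      trans (sameReg sm $found refl) nf , trans (doneˣ inv) (cong (λ d → d [ x ↦ st ]) dn)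

  run-rootBody : ∀ s h x p → TreeS tLim s → Bounded s → Env s → Visit h s → regs s $found ≡ 0 →
    regs s $p ≡ p → p < N → regs s $cv ≡ p % n → regs s $x ≡ x → σ p ≡ suc x → x < t → I x ≡ false →
    arrays s aDone x ≡ 0 → Run Φ rootBodyP s 0 (ScannedSlot h p s)
  run-rootBody s h x p T bd env V nf refl p<N cv≡p refl σp x<t Ix dx =
    run-pay (run-seq {R = AfterTest} (run-flat rootTestP AfterTest test)
      λ { s₁ sm (T₁ , bd₁ , env₁ , V₁ , g₁ , dn₁ , yes′ , no′) →
        let p≡ = sameReg sm $p refl
            x≡ = sameReg sm $x refl
            cv≡₁ = trans (sameReg sm $cv refl) cv≡p
            nf₁ = trans (sameReg sm $found refl) nf
        in
        run-if
          (λ a≢0 → run-≤ (≤-trans (m≤n+m 6 (t * (cost Q exchangeP + 8))) (m≤n+m _ 3))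
            (run-map (λ { {s′} _ (r , fd , dn) → pay-found s′ fd (trans dn dn₁) , r })
              (run-found s₁ h p T₁ bd₁ env₁ V₁ p≡ p<N cv≡₁ (inj₂ (x , σp , x<t , yes′ a≢0)) s g₁)))
          (λ a≡0 → run-map (λ { {s′} _ (r , fd , dn) → pay-root s′ fd (stamp≢0 s₁ V₁) dn , r })
            (run-markRoot s s₁ h x p T₁ bd₁ env₁ V₁ g₁ nf₁ p≡ p<N cv≡₁ x≡ σp x<t Ix (no′ a≡0)
              (trans (cong (λ d → d x) dn₁) dx) dn₁)) })
    where
    AfterTest : State → Set
    AfterTest s₁ = TreeS tLim s₁ × Bounded s₁ × Env s₁ × Visit h s₁ × GrowS s s₁ ×
        arrays s₁ aDone ≡ arrays s aDone ×
      (regs s₁ $answer ≢ 0 → Ind (I [ x ↦ true ])) × (regs s₁ $answer ≡ 0 → ¬ Ind (I [ x ↦ true ]))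
    test : wp rootTestP AfterTest s
    test = T , bd , with-I (restore-insert {x = x} (I≡ env) Ix) env , V , grow-refl , refl ,
      oracle-yes (represents-insert {arrays s aI} {I} x (I≡ env)) , oracle-no
          (represents-insert {arrays s aI} {I} x (I≡ env))
    stamp≢0 : ∀ s₁ → Visit h s₁ → regs s₁ $stamp ≢ 0
    stamp≢0 s₁ V eq = case trans (sym eq) (stamp≡ V) of λ ()
    pay-found : ∀ s′ → regs s′ $found ≡ 1 → arrays s′ aDone ≡ arrays s aDone → suc
        (potential s′) ≤ potential s
    pay-found s′ fd dn rewrite fd | dn | nf = ≤-reflexive (sym (+-suc _ 0))
    pay-root : ∀ s′ {st} → regs s′ $found ≡ 0 → st ≢ 0 → arrays s′ aDone ≡ arrays s aDone [ x ↦ st ] →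
               suc (potential s′) ≤ potential s
    pay-root s′ {st} fd st≢0 dn rewrite fd | dn | nf = +-monoˡ-≤ 1 (≤-reflexive (sym
      (trans (#-delete t (λ y → arrays s aDone y ≡ᵇ 0) x x<t (cong (_≡ᵇ 0) dx))
          (cong suc (#-cong t λ y _ →
        sym (update-cases (arrays s aDone) x st (λ y b → (b ≡ᵇ 0) ≡
            ((λ y → arrays s aDone y ≡ᵇ 0) [ x ↦ false ]) y) y
          (λ { refl → trans (≢⇒≡ᵇ st≢0) (sym (update-same (λ y → arrays s aDone y ≡ᵇ 0) y false)) })
          (λ y≢x → sym (update-other (λ y → arrays s aDone y ≡ᵇ 0) x false y≢x))))))))

  SlotDone : ℕ → State → State → Set
  SlotDone h s s′ = ScannedSlot h (regs s $p) s s′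

  run-slot : ∀ s h → TreeS tLim s → Bounded s → Env s → Visit h s → regs s $found ≡ 0 →
    regs s $p < N → regs s $cv ≡ regs s $p % n → Run Φ slotP s slotCost (SlotDone h s)
  run-slot s h T bd env V nf p<N cv≡p =
    run-seq (run-wp ($c ≔ arr aσ (reg $p)) (λ s′ → s′ ≡ s₁) refl λ { _ refl → ≤-refl }) λ { _ _ refl →
      run-if (λ c≢0 → let i , c≡ = positive c c≢0 in
               run-if (λ c∸t≢0 → edge i c≡ (t≤ i c≡ c∸t≢0))
                      -- The 8 covers the assignment to `$x`, the test of `aDone` and a `skip`; the
                      -- test of the root itself is paid from the potential.
                      (λ c∸t≡0 → run-≤ (≤ᵇ⇒≤ 8 (cost Q edgeSlotP) _) (rootCase i c≡ (i<t i c≡ c∸t≡0))))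
             (λ c≡0 → run-≤ (≤ᵇ⇒≤ 6 (4 + cost Q edgeSlotP) _)
                 (run-lift (run-map (λ { {s′} _ (r , fd , dn) →
               cheap s′ (subst (_≢ 0) (sym fd) (λ ())) dn , r })
               (run-found s₁ h p T bd env V refl p<N cv≡p (inj₁ (trans (sym σp≡c) c≡0)) s grow-refl)))) }
    where
    p = regs s $p
    c = arrays s aσ p
    s₁ = setReg s $c c
    σp≡c : c ≡ σ p
    σp≡c = cong (λ a → a p) (σ≡ env)
    positive : ∀ c → c ≢ 0 → ∃[ i ] c ≡ suc i
    positive zero    c≢0 = ⊥-elim (c≢0 refl)
    positive (suc i) _   = i , refl
    t≤ : ∀ i → c ≡ suc i → c ∸ regs s $t ≢ 0 → t ≤ i
    t≤ i c≡ nz = s≤s⁻¹ (≰⇒> λ le → nz (m≤n⇒m∸n≡0 (≤-trans (≤-reflexive c≡) (≤-trans le (≤-reflexive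
        (sym (t≡ env)))))))
    i<t : ∀ i → c ≡ suc i → c ∸ regs s $t ≡ 0 → i < t
    i<t i c≡ z = ≤-trans (≤-reflexive (sym c≡)) (≤-trans (m∸n≡0⇒m≤n z) (≤-reflexive (t≡ env)))
    cheap : ∀ s′ → regs s′ $found ≢ 0 → arrays s′ aDone ≡ arrays s aDone → Φ s′ ≤ Φ s
    cheap s′ fd dn rewrite dn | nf = *-monoʳ-≤ rootCost (+-monoʳ-≤ (# t (λ x → arrays s aDone x ≡ᵇ 0))
        (m∸n≤m 1 (regs s′ $found)))
    rescan : ∀ {s₀ s′} → (GrowS s₀ s′ → GrowS s s′) → ScannedSlot h p s₀ s′ → SlotDone h s s′
    rescan g (scannedSlot a b c d e f i) = scannedSlot a b c d (g e) f i
    same-potential : ∀ s′ → regs s′ $found ≡ 0 → arrays s′ aDone ≡ arrays s aDone → Φ s′ ≤ Φ s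
    same-potential s′ fd dn rewrite dn | nf | fd = ≤-refl
    edge : ∀ i → c ≡ suc i → t ≤ i → Run Φ edgeSlotP s₁ (cost Q edgeSlotP) (SlotDone h s)
    edge i c≡ t≤i = run-map (λ _ r → rescan id (proj₁ r))
      (run-wp edgeSlotP (EdgeScanned s₁ h)
        (wp-edgeSlot s₁ h i T bd env V nf p<N cv≡p c≡ (trans (sym σp≡c) c≡) t≤i)
        λ { {s′} _ (_ , fd , dn) → same-potential s′ fd dn })
    rootCase : ∀ i → c ≡ suc i → i < t → Run Φ rootSlotP s₁ 8 (SlotDone h s)
    rootCase i c≡ i<t = run-seq {B = 4} {C = 4}
      (run-wp ($x ≔ reg $c ⊖ lit 1) (λ s′ → s′ ≡ s₂) refl λ { _ refl → ≤-refl }) λ { _ _ refl →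
        run-if (λ d≢0 → run-wp skip (SlotDone h s)
                  (scannedSlot T bd env V grow-refl (λ _ → i , σp , (λ _ → subst
                      (λ x → arrays s aDone x ≢ 0) x≡ d≢0) ,
                      λ e eq → ⊥-elim (<⇒≱ i<t (subst (t ≤_) (sym eq) (m≤m+n t e))))
                    (λ nz → ⊥-elim (nz nf))) (λ sm _ → Φ-same _ _ sm refl refl))
               (λ d≡0 → run-≤ z≤n (run-map (λ _ → rescan id)
                   (run-rootBody s₂ h i p T bd env V nf refl p<N cv≡p x≡ σp i<t
                  Ii (subst (λ x → arrays s aDone x ≡ 0) x≡ d≡0)))) }
      where
      s₂ = setReg s₁ $x (c ∸ 1)
      σp : σ p ≡ suc i
      σp = trans (sym σp≡c) c≡
      x≡ : c ∸ 1 ≡ i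
      x≡ = cong (_∸ 1) c≡
      Ii : I i ≡ false
      Ii = [ proj₂ , (λ { (e , eq , _) → ⊥-elim (<⇒≱ i<t (subst (t ≤_) (sym eq) (m≤m+n t e))) }) ]′
          (proj₁ (sound P p<N σp))

  record Scanning (h : ℕ) (s₀ : State) (j : ℕ) (s : State) : Set where
    constructor scanning
    field
      treeᵛ    : TreeS tLim s
      boundedᵛ : Bounded s
      envᵛ     : Env s
      visitᵛ   : Visit h s
      growᵛ    : GrowS s₀ s
      position : regs s $p ≡ regs s₀ $cv + j * n
      missedᵛ  : regs s $found ≡ 0 → ∀ i → i < j → Slot s (regs s₀ $cv + i * n)
      hitᵛ     : regs s $found ≢ 0 → Found s
  open Scanning public

  run-slotStep : ∀ s₀ s h j → j < k → Scanning h s₀ j s → regs s₀ $cv < n → regs s $cv ≡ regs s₀ $cv →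
    Run Φ slotStepP s slotStepCost (λ s′ → Scanning h s₀ (suc j) (setReg s′ $l (suc j)))
  run-slotStep s₀ s h j j<k S cv<n cv≡₀ = run-seq {R = Mid} before λ s₁ sm (S₁ , Sj) →
    run-wp ($p ≔ reg $p ⊕ reg $n) _ (scanning (treeᵛ S₁) (boundedᵛ S₁) (envᵛ S₁) (visitᵛ S₁) (growᵛ S₁)
      (trans (cong₂ _+_ (position S₁) (n≡ (envᵛ S₁))) (trans (+-assoc cv₀ (j * n) n) (cong (cv₀ +_)
          (+-comm (j * n) n))))
      (λ nf i i<sj → case i ≟ j of λ
        { (yes refl) → Sj nf
        ; (no i≢j) → missedᵛ S₁ nf i (≤∧≢⇒< (s≤s⁻¹ i<sj) i≢j) })
      (hitᵛ S₁)) (λ {s′} sm _ → Φ-same _ _ sm refl refl)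
    where
    cv₀ = regs s₀ $cv
    Mid : State → Set
    Mid s₁ = Scanning h s₀ j s₁ × (regs s₁ $found ≡ 0 → Slot s₁ (cv₀ + j * n))
    p<N : regs s $p < N
    p<N = subst (_< N) (sym (position S)) (≤-trans (+-monoˡ-< (j * n) cv<n) (*-monoˡ-≤ n j<k))
    cv≡p : regs s $cv ≡ regs s $p % n
    cv≡p = trans cv≡₀ (sym (trans (cong (_% n) (position S)) (trans ([m+kn]%n≡m%n cv₀ j n)
        (m<n⇒m%n≡m cv<n))))
    before : Run Φ (if reg $found then skip else slotP end) s (2 + slotCost) Mid
    before = run-if
      (λ fd → run-≤ (s≤s z≤n) (run-wp skip Mid (S , λ nf → ⊥-elim (fd nf)) λ sm _ →
          Φ-same _ _ sm refl refl))
      (λ nf → run-map (λ { {s₁} sm r → scanning (tree′ r) (bounded′ r) (env′ r) (visit′ r) (grow-trans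
          (growᵛ S) (grow′ r))
                  (trans (sameReg sm $p refl) (position S))
                  (λ nf₁ i i<j → scanned-grow {s} {s₁} (grow′ r) (missedᵛ S nf i i<j)) (hit r) ,
                λ nf₁ → subst (Slot s₁) (position S) (missed r nf₁) })
        (run-slot s h (treeᵛ S) (boundedᵛ S) (envᵛ S) (visitᵛ S) nf p<N cv≡p))

  ScannedVertex : ℕ → State → Set
  ScannedVertex a s = ∀ p → p < N → p % n ≡ a → Slot s p

  record ScanDone (h : ℕ) (s s′ : State) : Set where
    constructor scanDone
    field
      treeᵈ    : TreeS tLim s′
      boundedᵈ : Bounded s′
      envᵈ     : Env s′
      growᵈ    : GrowS s s′
      stampᵈ   : regs s′ $stamp ≡ 2 + h
      missedᵈ  : regs s′ $found ≡ 0 → ScannedVertex (arrays s aQueue h) s′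
      hitᵈ     : regs s′ $found ≢ 0 → Found s′
  open ScanDone public

  run-scan : ∀ s h → regs s $head ≡ h → h < regs s $tail → regs s $found ≡ 0 → regs s $stamp ≤ suc h →
    TreeS tLim s → Bounded s → Env s → Run Φ scanP s scanCost (ScanDone h s)
  run-scan s h refl h<tail nf st≤ T bd env =
    run-seq (run-wp startScanP (λ s′ → s′ ≡ s₁) refl λ sm _ → Φ-same _ _ sm refl refl) λ { _ _ refl →
      run-map (λ { {s′} sm S → scanDone (treeᵛ S) (boundedᵛ S) (envᵛ S) (growᵛ S)
          (sameReg sm $stamp refl ∙ +-comm h 2)
                  (λ nf p p<N p%n → subst (Slot s′) (sym (decompose p p%n)) (missedᵛ S nf (p / n)
                      (m<n*o⇒m/o<n {p} {k} {n} p<N)))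
                  (hitᵛ S) })
        (run-for $l $k slotStepP (Scanning h s₁) refl refl refl (λ _ _ → refl) (k≡ env)
          (scanning T (λ w → ≤-trans (bd w) (≤-trans st≤ (≤-trans (n≤1+n _) (≤-reflexive
              (+-comm 2 h))))) env
            (visitV h<tail (+-comm h 2) refl) grow-refl (sym (+-identityʳ _)) (λ _ _ ()) (λ nz → ⊥-elim
                (nz nf)))
          λ j s₂ j<k sm _ S → run-slotStep s₁ s₂ h j j<k S cv<n (sameReg sm $cv refl)) }
    where
    infixr 4 _∙_
    _∙_ : ∀ {a b c : ℕ} → a ≡ b → b ≡ c → a ≡ c
    _∙_ = trans
    s₁ = setReg (setReg (setReg s $cv (arrays s aQueue h)) $stamp (h + 2)) $p (arrays s aQueue h)
    cv<n : arrays s aQueue h < n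
    cv<n = proj₂ (proj₂ (entry T h h<tail))
    decompose : ∀ p → p % n ≡ arrays s aQueue h → p ≡ arrays s aQueue h + p / n * n
    decompose p eq = trans (m≡m%n+[m/n]*n p n) (cong (_+ p / n * n) eq)

  record Searching (h : ℕ) (s : State) : Set where
    constructor searching
    field
      treeᴸ    : TreeS tLim s
      boundedᴸ : Bounded s
      envᴸ     : Env s
      stampᴸ   : regs s $stamp ≤ suc h
      startᴸ   : arrays s aMark u ≢ 0 × arrays s aMark v ≢ 0
      missedᴸ  : regs s $found ≡ 0 → ∀ m → m < h → m < regs s $tail → ScannedVertex (arrays s aQueue m) s
      hitᴸ     : regs s $found ≢ 0 → Found s
  open Searching public

  run-loopBody : ∀ s h → regs s $head ≡ h → Searching h s →
    Run Φ loopBodyP s (2 + (4 + scanCost)) (λ s′ → Searching (suc h) (setReg s′ $head (suc h)))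
  run-loopBody s h h≡ S = run-if
    (λ fd → run-≤ (s≤s z≤n) (run-wp skip _ (idle λ nf → ⊥-elim (fd nf)) λ sm _ →
        Φ-same _ _ sm refl refl))
    (λ nf → run-if
      (λ pending → let h<tail = subst (_< regs s $tail) h≡ (≰⇒> λ le → pending (m≤n⇒m∸n≡0 le)) in
        run-map (λ { {s′} sm D → searching (treeᵈ D) (boundedᵈ D) (envᵈ D) (≤-reflexive (stampᵈ D))
            (markGrow (growᵈ D) u (proj₁ (startᴸ S)) , markGrow (growᵈ D) v (proj₂ (startᴸ S)))
            (λ nf′ m m<sh m<tail p p<N p% → case m ≟ h of λ
              { (yes refl) → missedᵈ D nf′ p p<N (trans p% (queueGrow (growᵈ D) m h<tail))
              ; (no m≢h) → let m<h = ≤∧≢⇒< (s≤s⁻¹ m<sh) m≢h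
                               m<tail′ = <-trans m<h h<tail in
                  scanned-grow {s} {s′} (growᵈ D) (missedᴸ S nf m m<h m<tail′ p p<N
                      (trans p% (queueGrow (growᵈ D) m m<tail′))) })
            (hitᵈ D) })
          (run-scan s h h≡ h<tail nf (stampᴸ S) (treeᴸ S) (boundedᴸ S) (envᴸ S)))
      -- The queue is exhausted, so the position h holds no vertex and this round has nothing to
      -- scan.
      (λ none → run-≤ (s≤s z≤n) (run-wp skip _ (idle λ nf m m≤h m<tail →
          missedᴸ S nf m (≤-trans m<tail (≤-trans (m∸n≡0⇒m≤n none) (≤-reflexive h≡))) m<tail)
        λ sm _ → Φ-same _ _ sm refl refl)))
    where
    idle : (regs s $found ≡ 0 → ∀ m → m < suc h → m < regs s $tail → ScannedVertex
        (arrays s aQueue m) s) →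
           Searching (suc h) (setReg s $head (suc h))
    idle missed = searching (treeᴸ S) (boundedᴸ S) (envᴸ S) (m≤n⇒m≤1+n (stampᴸ S)) (startᴸ S) missed
        (hitᴸ S)

  -- Arrays are never written outside the ranges of vertices and roots.
  Clean : State → Set
  Clean s = (∀ z → n ≤ z → arrays s aMark z ≡ 0) × (∀ x → t ≤ x → arrays s aDone x ≡ 0)

  record Searched (s : State) : Set where
    constructor searched
    field
      treeᴿ   : TreeS tLim s
      envᴿ    : Env s
      startᴿ  : arrays s aMark u ≢ 0 × arrays s aMark v ≢ 0
      missedᴿ : regs s $found ≡ 0 → ∀ p → p < N → arrays s aMark (p % n) ≢ 0 → Slot s p
      hitᴿ    : regs s $found ≢ 0 → Found s
      cleanᴿ  : Clean s
  open Searched public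

  Started : State → Set
  Started s = Searching 0 (setReg s $head 0)

  wp-startSearch : ∀ s → Env s → (∀ z → arrays s aMark z ≡ 0) → (∀ x → arrays s aDone x ≡ 0) →
      wp startSearchP Started s
  wp-startSearch s env mark0 done0 =
    wp-mark {lim = tLim} s₁ (wp ($w ≔ reg $v ； markP) Started)
      (tree (λ w eq → case trans (sym eq) (mark0 w) of λ ()) (λ w 2≤ → case subst (2 ≤_)
          (mark0 w) 2≤ of λ ())
            (λ x nz → ⊥-elim (nz (done0 x))) (λ w nz → ⊥-elim (nz (mark0 w))) (λ _ ()) (λ ()))
      (λ w → subst (_≤ 1) (sym (mark0 w)) z≤n) env (subst (_< n) (sym (u≡ env)) u<n)
      ≤-refl ≤-refl (λ _ → inj₁ (u≡ env)) (λ { (s≤s ()) })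
      λ s₂ T₂ bd₂ env₂ g₂ mu sm₂ dn₂ →
        wp-mark {lim = tLim} (setReg s₂ $w (regs s₂ $v)) Started T₂ bd₂ env₂ (subst (_< n)
            (sym (v≡ env₂)) v<n)
          (≤-reflexive (sym (sm₂ $stamp refl))) (≤-trans (≤-reflexive (sm₂ $stamp refl)) (s≤s z≤n))
          (λ _ → inj₂ (v≡ env₂)) (λ 2≤ → case subst (2 ≤_) (sm₂ $stamp refl) 2≤ of λ { (s≤s ()) })
          λ s₃ T₃ bd₃ env₃ g₃ mv sm₃ dn₃ → searching T₃ bd₃ env₃
            (≤-reflexive (trans (sm₃ $stamp refl) (sm₂ $stamp refl)))
            (subst (λ w → arrays s₃ aMark w ≢ 0) (u≡ env) (markGrow g₃ (regs s $u) mu) ,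
             subst (λ w → arrays s₃ aMark w ≢ 0) (v≡ env₂) mv)
            (λ _ _ ())
            (λ nz → ⊥-elim (nz (trans (sm₃ $found refl) (sm₂ $found refl))))
    where
    s₁ = setReg (setReg (setReg (setReg s $tail 0) $stamp 1) $found 0) $w (regs s $u)

  run-settle : ∀ {p s B R} → Run Φ p s B R → Run still p s (B + Φ s) R
  run-settle (run d a r) = run d (≤-trans (≤-reflexive (+-identityʳ _)) (≤-trans (m≤m+n _ _)
      (≤-trans a (≤-reflexive (sym (+-identityʳ _)))))) r

  -- After n rounds the whole queue has been scanned, as it holds at most n vertices. The potential
  -- starts at t + 1 or less, and each unit is settled at `rootCost`.
  run-loop : ∀ s → Started s → Run still searchLoopP s loopCost Searched
  run-loop s S = run-map (λ sm S′ → searched (treeᴸ S′) (envᴸ S′) (startᴸ S′)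
        (λ nf p p<N nz → let m , m< , eq = queued (treeᴸ S′) (p % n) nz in
           missedᴸ S′ nf m (≤-trans m< (tail≤n u v σ I (treeᴸ S′))) m< p p<N (sym eq))
        (hitᴸ S′)
        ((λ z n≤z → zero? (λ nz → <⇒≱ (marked<n u v σ I (treeᴸ S′) z nz) n≤z)) ,
         (λ x t≤x → zero? (λ nz → <⇒≱ (root (closed (treeᴸ S′) x nz)) t≤x))))
    (run-≤ (+-monoʳ-≤ _ (*-monoʳ-≤ rootCost
        (≤-trans (+-mono-≤ (#-≤ t _) (m∸n≤m 1 (regs s $found))) (≤-reflexive (+-comm t 1)))))
      (run-settle (run-for $head $n loopBodyP Searching refl refl refl (λ _ _ → refl) (n≡ (envᴸ S)) S
        λ h s₁ _ _ h≡ S₁ → run-loopBody s₁ h h≡ S₁)))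
    where
    zero? : ∀ {a} → ¬ (a ≢ 0) → a ≡ 0
    zero? {zero} _ = refl
    zero? {suc a} nn = ⊥-elim (nn λ ())

  run-search : ∀ s → Env s → Clean s → Run still searchP s searchCost Searched
  run-search s env (mark0 , done0) = run-≤ (≤-reflexive (sym (+-assoc (n * (3 + 8) + 6)
      (t * (3 + 8) + 6) _)))
    (run-seq clear-mark λ s₁ sm₁ (env₁ , m₁) →
     run-seq (clear-done s₁ env₁ sm₁ m₁) λ s₂ sm₂ (env₂ , m₂ , d₂) →
     run-seq (run-flat startSearchP Started (wp-startSearch s₂ env₂ m₂ d₂)) λ s₃ _ S → run-loop s₃ S)
    where
    cleared : ∀ {b} (a : ℕ → ℕ) i → (∀ z → z < i ⊎ b ≤ z → a z ≡ 0) → ∀ z → z < suc i ⊎ b ≤ z →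
        (a [ i ↦ 0 ]) z ≡ 0
    cleared {b} a i h z = update-cases a i 0 (λ z c → z < suc i ⊎ b ≤ z → c ≡ 0) z (λ _ _ → refl)
      (λ z≢i → λ { (inj₁ z<si) → h z (inj₁ (≤∧≢⇒< (s≤s⁻¹ z<si) z≢i)) ; (inj₂ b≤z) → h z (inj₂ b≤z) })
    full : ∀ {b} {a : ℕ → ℕ} → (∀ z → z < b ⊎ b ≤ z → a z ≡ 0) → ∀ z → a z ≡ 0
    full {b} h z = h z (<-≤-connex z b)
    clear-mark : Run still (For $w $n (aMark [ reg $w ]≔ lit 0)) s (n * (3 + 8) + 6) (λ s′ → Env s′ ×
        (∀ z → arrays s′ aMark z ≡ 0))
    clear-mark = run-map (λ { _ (e , m) → e , full m })
      (run-for $w $n (aMark [ reg $w ]≔ lit 0) (λ i s′ → Env s′ × (∀ z → z < i ⊎ n ≤ z →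
          arrays s′ aMark z ≡ 0))
        refl refl refl (λ _ _ → refl) (n≡ env) (env , λ { z (inj₂ n≤z) → mark0 z n≤z })
        λ { i s′ i<n sm refl (e , m) → run-flat (aMark [ reg $w ]≔ lit 0) _ (e , cleared
            (arrays s′ aMark) i m) })
    clear-done : ∀ s₁ → Env s₁ → Same (For $w $n (aMark [ reg $w ]≔ lit 0)) s s₁ →
        (∀ z → arrays s₁ aMark z ≡ 0) →
      Run still (For $x $t (aDone [ reg $x ]≔ lit 0)) s₁ (t * (3 + 8) + 6)
        (λ s′ → Env s′ × (∀ z → arrays s′ aMark z ≡ 0) × (∀ x → arrays s′ aDone x ≡ 0))
    clear-done s₁ env₁ sm₁ m₁ = run-map (λ { _ (e , m , d) → e , m , full d })
      (run-for $x $t (aDone [ reg $x ]≔ lit 0) (λ i s′ → Env s′ × (∀ z → arrays s′ aMark z ≡ 0) ×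
          (∀ x → x < i ⊎ t ≤ x → arrays s′ aDone x ≡ 0))
        refl refl refl (λ _ _ → refl) (t≡ env₁)
        (env₁ , m₁ , λ { x (inj₂ t≤x) → trans (cong (λ d → d x) (sameArray sm₁ aDone refl))
            (done0 x t≤x) })
        λ { i s′ i<t sm refl (e , m , d) → run-flat (aDone [ reg $x ]≔ lit 0) _ (e , m , cleared
            (arrays s′ aDone) i d) })

-- Augmentation along the path found.

module WalkProgram {t : ℕ} (M : Matroid t) (Q n-1 k : ℕ) (ρ B₀ B₁ : ℕ → ℕ) (Present : ℕ → Set) where
  open Search M n-1 k ρ B₀ B₁ Present
  open Logic M Q
  open Costs Q n t k

  -- The marks decrease along the path, which bounds the number of steps.
  record Walk (i : ℕ) (s : State) : Set where
    constructor walk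
    field
      {set}    : ℕ → Bool
      repJ     : Represents (arrays s aI) set
      onPath   : Path (arrays s aMark) (arrays s aPv) (arrays s aPar) (arrays s aExch) (arrays s aσ) set
          (regs s $w) (regs s $p)
      mark≤    : arrays s aMark (regs s $w) ≤ suc (n ∸ i)
  open Walk public

  Stepped : ℕ → State → Set
  Stepped i s = Walk (suc i) (setReg s $l (suc i))

  wp-step : ∀ s i → i < n → regs s $t ≡ t → Walk i s → wp stepP (Stepped i) s
  wp-step s i i<n t≡ (walk {J} rep P mark≤) =
    (λ nz → advance-walk (≰⇒> λ le → nz (m≤n⇒m∸n≡0 le))) ,
    (λ z → walk rep P (≤-trans (m∸n≡0⇒m≤n z) (s≤s z≤n)))
    where
    mark = arrays s aMark
    pv = arrays s aPv
    par = arrays s aPar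
    exch = arrays s aExch
    w = regs s $w
    p = regs s $p
    q = par w
    σ₀ = arrays s aσ [ q ↦ 0 ]
    c = arrays s aσ q
    Moved : (ℕ → Bool) → ℕ → Set
    Moved J c = Path mark pv par exch (σ₀ [ p ↦ c ]) J (pv w) q
    advance-walk : 2 ≤ mark w → wp (
      $q ≔ arr aPar (reg $w) ； $c ≔ arr aσ (reg $q) ； aσ [ reg $q ]≔ lit 0 ；
      if reg $c ⊖ reg $t then aσ [ reg $p ]≔ reg $c else
        $y ≔ arr aExch (reg $w) ； aI [ reg $y ]≔ lit 0 ； aI [ reg $c ⊖ lit 1 ]≔ lit 1 ；
        aσ [ reg $p ]≔ reg $y ⊕ lit 1
      end ；
      $p ≔ reg $q ； $w ≔ arr aPv (reg $w)) (Stepped i) s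
    advance-walk 2≤ with pathLinks P w 2≤ ≤-refl
    ... | L = [ by-edge , by-root ]′ (via L)
      where
      lower : mark (pv w) ≤ suc (n ∸ suc i)
      lower = s≤s⁻¹ (≤-trans (earlier L) (≤-trans mark≤ (≤-reflexive (cong suc (+-∸-assoc 1 i<n)))))
      by-edge : (∃[ e ] c ≡ suc (t + e) × Joins e (pv w) w) → _
      by-edge (e , eq , j) =
        (λ _ → walk rep (subst (Moved J) (sym eq) (path-edge P 2≤ eq j)) lower) ,
        (λ z → ⊥-elim (<⇒≱ (s≤s (m≤m+n t e)) (subst₂ _≤_ eq t≡ (m∸n≡0⇒m≤n z))))
      by-root : (∃[ x ] c ≡ suc x × x < t × PathRoot mark exch J x w) → _
      by-root (x , eq , x<t , R) =
        (λ nz → ⊥-elim (nz (m≤n⇒m∸n≡0 (subst₂ _≤_ (sym eq) (sym t≡) x<t)))) ,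
        (λ _ → walk (subst (λ a → Represents ((arrays s aI [ exch w ↦ 0 ]) [ a ↦ 1 ]) J′)
            (sym (cong (_∸ 1) eq))
                      (represents-insert x (represents-delete (exch w) rep)))
                    (subst (Moved J′) (+-comm 1 (exch w)) (path-root P 2≤ eq x<t R)) lower)
        where J′ = (J [ exch w ↦ false ]) [ x ↦ true ]

  module _ {u v : ℕ} {σ : ℕ → ℕ} {I : ℕ → Bool} (P : Placement I σ) (II : Ind I) where

    wp-startWalk : ∀ s → Represents (arrays s aI) I → arrays s aσ ≡ σ →
      Tree u v σ I (arrays s aMark) (arrays s aPv) (arrays s aPar) (arrays s aExch) (arrays s aQueue)
          (arrays s aDone) (regs s $tail) (λ _ → t) →
      Terminal u v σ I (arrays s aMark) (regs s $fp) (regs s $fv) →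
      wp startWalkP (λ s′ → Walk 0 (setReg s′ $l 0)) s
    wp-startWalk s rep refl T F =
      (λ nz → case terminalItem F of λ
        { (inj₁ z) → ⊥-elim (nz z)
        ; (inj₂ (x , σp , x<t , Ix)) → walk
            (subst (λ a → Represents (arrays s aI [ a ↦ 1 ]) (I [ x ↦ true ])) (sym (cong (_∸ 1) σp))
                (represents-insert x rep))
            (path-free T P II F σp x<t Ix) mark≤′ }) ,
      (λ z → walk rep (path-empty T P II F z) mark≤′)
      where
      mark≤′ : arrays s aMark (regs s $fv) ≤ suc n
      mark≤′ = m≤n⇒m≤1+n (mark≤n u v σ I T (regs s $fv))

    run-augment : ∀ s → regs s $n ≡ n → regs s $t ≡ t → Represents (arrays s aI) I → arrays s aσ ≡ σ →
      Tree u v σ I (arrays s aMark) (arrays s aPv) (arrays s aPar) (arrays s aExch) (arrays s aQueue)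
          (arrays s aDone) (regs s $tail) (λ _ → t) →
      Terminal u v σ I (arrays s aMark) (regs s $fp) (regs s $fv) →
      Run still augmentP s walkCost (Walk n)
    run-augment s n≡ t≡ rep σ≡ T F =
      run-seq (run-flat startWalkP (λ s′ → Walk 0 (setReg s′ $l 0))
          (wp-startWalk s rep σ≡ T F)) λ s₁ sm₁ W₁ →
        run-for $l $n stepP Walk refl refl refl (λ _ _ → refl) (trans (sameReg sm₁ $n refl) n≡) W₁
          λ i s₂ i<n sm₂ _ W → run-flat stepP (Stepped i)
            (wp-step s₂ i i<n (trans (sameReg sm₂ $t refl) (trans (sameReg sm₁ $t refl) t≡)) W)

-- Inserting one copy of an edge.

module InsertProgram (n-1 E : ℕ) (ends : Fin E → Fin (suc n-1) × Fin (suc n-1))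
                     {t : ℕ} (root : Fin t → Fin (suc n-1)) (M : Matroid t) (k Q : ℕ) where

  open Certificates n-1 E ends root M k
  open Conditions G root M k
  open Logic M Q
  open MatroidProperties M

  private
    n N : ℕ
    n = suc n-1
    N = k * n

  open Costs Q n t k

  record ConstV (rn rE rt rk rN rc : ℕ) (r : ℕ → ℕ) : Set where
    constructor constV
    field
      n≡ : rn ≡ n
      E≡ : rE ≡ E
      t≡ : rt ≡ t
      k≡ : rk ≡ k
      N≡ : rN ≡ N
      copies≡ : rc ≡ suc k
      ρ≡ : r ≡ ρ
  open ConstV public

  Const : State → Set
  Const s = ConstV (regs s $n) (regs s $E) (regs s $t) (regs s $k) (regs s $N) (regs s $copies)
      (arrays s aρ)

  const-same : ∀ {p s s′} → Same p s s′ →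
    (∀ x → x ≤ 5 → writesReg p x ≡ false) → writesArray p aρ ≡ false → Const s → Const s′
  const-same sm wr wa (constV a b c d e f g) = constV
    (trans (sameReg sm $n (wr 0 (≤ᵇ⇒≤ 0 5 _))) a) (trans (sameReg sm $E (wr 1 (≤ᵇ⇒≤ 1 5 _))) b)
        (trans (sameReg sm $t (wr 2 (≤ᵇ⇒≤ 2 5 _))) c)
    (trans (sameReg sm $k (wr 3 (≤ᵇ⇒≤ 3 5 _))) d) (trans (sameReg sm $N (wr 4 (≤ᵇ⇒≤ 4 5 _))) e)
        (trans (sameReg sm $copies (wr 5 (≤ᵇ⇒≤ 5 5 _))) f)
    (trans (sameArray sm aρ wa) g)

  keeps : (p : Program) → writesReg p 0 ≡ false → writesReg p 1 ≡ false → writesReg p 2 ≡ false →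
          writesReg p 3 ≡ false → writesReg p 4 ≡ false → writesReg p 5 ≡ false → ∀ x → x ≤ 5 →
              writesReg p x ≡ false
  keeps p a b c d e f 0 _ = a
  keeps p a b c d e f 1 _ = b
  keeps p a b c d e f 2 _ = c
  keeps p a b c d e f 3 _ = d
  keeps p a b c d e f 4 _ = e
  keeps p a b c d e f 5 _ = f
  keeps p a b c d e f (suc (suc (suc (suc (suc (suc _)))))) (s≤s (s≤s (s≤s (s≤s (s≤s ())))))

  Clean : State → Set
  Clean s = (∀ z → n ≤ z → arrays s aMark z ≡ 0) × (∀ x → t ≤ x → arrays s aDone x ≡ 0)

  clean-same : ∀ {p s s′} → Same p s s′ → writesArray p aMark ≡ false → writesArray p aDone ≡ false →
      Clean s → Clean s′
  clean-same sm wm wd (c , d) = (λ z le → trans (cong (λ a → a z) (sameArray sm aMark wm)) (c z le)) ,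
                                (λ z le → trans (cong (λ a → a z) (sameArray sm aDone wd)) (d z le))

  record Config (B₀ B₁ : ℕ → ℕ) (m j : ℕ) (σ i : ℕ → ℕ) : Set where
    constructor config
    open Search M n-1 k ρ B₀ B₁ (Present m j) using (Placement)
    field
      {current} : ℕ → Bool
      repᶜ      : Represents i current
      indᶜ      : Ind current
      placedᶜ   : Placement current σ
  open Config public

  module ForEdge (few : ∀ w → w < n → # t (λ i → ρ i ≡ᵇ w) ≤ k) (m : ℕ) (m<E : m < E) (B₀ B₁ : ℕ → ℕ)
           (B₀-old : ∀ e → e < E → B₀ e ≡ g₀ e) (B₁-old : ∀ e → e < E → B₁ e ≡ g₁ e)
           (B₀-copy : ∀ i → i < suc k → B₀ (E + i) ≡ g₀ m) (B₁-copy : ∀ i → i < suc k → B₁ (E + i) ≡ g₁ m) where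

    record EdgeEnvV (ru rv : ℕ) (b₀ b₁ : ℕ → ℕ) : Set where
      constructor edgeEnvV
      field
        u≡  : ru ≡ g₀ m
        v≡  : rv ≡ g₁ m
        B₀≡ : b₀ ≡ B₀
        B₁≡ : b₁ ≡ B₁
    open EdgeEnvV public

    EdgeEnv : State → Set
    EdgeEnv s = EdgeEnvV (regs s $u) (regs s $v) (arrays s a₀) (arrays s a₁)

    -- A failure is kept as a refutation of (C2), after which no placement has to be maintained.
    Inserted : ℕ → State → Set
    Inserted j s = Clean s × (regs s $ok ≢ 0 → Config B₀ B₁ m j (arrays s aσ) (arrays s aI)) ×
        (regs s $ok ≡ 0 → ¬ C2)

    module _ (j : ℕ) (j≤k : j ≤ k) where
      open Search M n-1 k ρ B₀ B₁ (Present m j) hiding (n; N; Ind; ind?)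

      ends<n : ∀ e → Present m j e → B₀ e < n × B₁ e < n
      ends<n e (inj₁ e<m) = let e<E = <-trans e<m m<E in
        subst (_< n) (sym (B₀-old e e<E)) (g₀<n e<E) , subst (_< n) (sym (B₁-old e e<E)) (g₁<n e<E)
      ends<n e (inj₂ (E≤e , e<)) with m≤n⇒∃[o]m+o≡n E≤e
      ... | c , refl = let c<k = ≤-trans (+-cancelˡ-< E _ _ e<) (m≤n⇒m≤1+n j≤k) in
        subst (_< n) (sym (B₀-copy c c<k)) (g₀<n m<E) , subst (_< n) (sym (B₁-copy c c<k)) (g₁<n m<E)

      module _ {σ : ℕ → ℕ} {I : ℕ → Bool} (P : Placement I σ) (II : Ind I) where
        module R = SearchProgram M Q n-1 k ρ B₀ B₁ (Present m j) ρ<n ends<n (g₀ m) (g₁ m) (g₀<n m<E) (g₁<n m<E) σ I P II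
        open WalkProgram M Q n-1 k ρ B₀ B₁ (Present m j)

        finish : ∀ {s} → Const s → regs s $j ≡ j → Walk n s → 
          (∀ w → arrays s aMark w ≡ 1 → w ≡ g₀ m ⊎ w ≡ g₁ m) →
          Config B₀ B₁ m (suc j) (arrays s aσ [ regs s $p ↦ regs s $t + regs s $E + regs s $j + 1 ])
              (arrays s aI)
        finish {s} C j≡ (walk {J} rep W mark≤) orig = config rep (indep W)
          (subst (λ c → Search.Placement M n-1 k ρ B₀ B₁ (Present m (suc j)) J
              (arrays s aσ [ regs s $p ↦ c ])) (sym code)
            (holds-map to from (holds-insert (hole<N W) (hole W) not-present
              ((λ lt → ⊥-elim (<⇒≱ lt (m≤m+n t _))) , λ e eq →
                 subst (λ e → regs s $p % n ≡ B₀ e ⊎ regs s $p % n ≡ B₁ e) (+-cancelˡ-≡ t _ _ eq)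
                   ([ (λ eq → inj₁ (trans (trans (holeAt W) eq) (sym (B₀-copy j (s≤s j≤k)))))
                    , (λ eq → inj₂ (trans (trans (holeAt W) eq) (sym (B₁-copy j (s≤s j≤k))))) ]′ at-end))
              (placement W))))
          where
          code : regs s $t + regs s $E + regs s $j + 1 ≡ suc (t + (E + j))
          code = trans (+-comm _ 1) (cong suc (trans (cong₂ _+_ (cong₂ _+_ (t≡ C) (E≡ C)) j≡)
              (+-assoc t E j)))
          -- After n steps the bound on the mark has come down to 1, so the hole is at an end of m,
          -- where a copy fits.
          at-end : regs s $w ≡ g₀ m ⊎ regs s $w ≡ g₁ m
          at-end = orig (regs s $w) (≤-antisym (subst (λ d → arrays s aMark (regs s $w) ≤ suc d)
              (n∸n≡0 n) mark≤)
            (n≢0⇒n>0 (reached W)))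
          not-present : ¬ (t + (E + j)) ∈ᴵ J
          not-present (inj₁ (lt , _)) = <⇒≱ lt (m≤m+n t _)
          not-present (inj₂ (e , eq , pr)) with +-cancelˡ-≡ t _ _ eq
          not-present (inj₂ (e , eq , inj₁ e<m)) | refl = <⇒≱ (<-trans e<m m<E) (m≤m+n E j)
          not-present (inj₂ (e , eq , inj₂ (_ , lt))) | refl = n≮n _ lt
          to : ∀ {i} → i ∈ᴵ J ⊎ i ≡ t + (E + j) → Search._∈ᴵ_ M n-1 k ρ B₀ B₁ (Present m (suc j)) i J
          to (inj₁ (inj₁ r)) = inj₁ r
          to (inj₁ (inj₂ (e , refl , inj₁ e<m))) = inj₂ (e , refl , inj₁ e<m)
          to (inj₁ (inj₂ (e , refl , inj₂ (E≤e , e<)))) = inj₂ (e , refl , inj₂ (E≤e , <-trans e<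
              (+-monoʳ-< E ≤-refl)))
          to (inj₂ refl) = inj₂ (E + j , refl , inj₂ (m≤m+n E j , +-monoʳ-< E ≤-refl))
          from : ∀ {i} → Search._∈ᴵ_ M n-1 k ρ B₀ B₁ (Present m (suc j)) i J → i ∈ᴵ J ⊎ i ≡ t + (E + j)
          from (inj₁ r) = inj₁ (inj₁ r)
          from (inj₂ (e , refl , inj₁ e<m)) = inj₁ (inj₂ (e , refl , inj₁ e<m))
          from (inj₂ (e , refl , inj₂ (E≤e , e<))) with e ≟ E + j
          ... | yes refl = inj₂ refl
          ... | no e≢ = inj₁ (inj₂ (e , refl , inj₂ (E≤e , ≤∧≢⇒<
              (s≤s⁻¹ (subst (e <_) (+-suc E j) e<)) e≢)))

        run-insert : ∀ s → Const s → EdgeEnv s → Clean s → regs s $j ≡ j → regs s $ok ≢ 0 →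
          Represents (arrays s aI) I → arrays s aσ ≡ σ → Run still insertP s insertCost
              (Inserted (suc j))
        run-insert s C EE cl j≡ ok rep σ≡ =
          run-seq (R.run-search s (R.envV (n≡ C) (t≡ C) (k≡ C) (u≡ EE) (v≡ EE) (B₀≡ EE) (B₁≡ EE)
              (ρ≡ C) σ≡ rep) cl) λ s₁ sm₁ S →
          let C₁ = const-same sm₁ (keeps searchP refl refl refl refl refl refl) refl C
              ok₁ = sameReg sm₁ $ok refl
          in run-if
            (λ fd → run-seq (run-augment {g₀ m} {g₁ m} P II s₁ (n≡ C₁) (t≡ C₁) (R.EnvV.I≡ (R.envᴿ S))
                (R.EnvV.σ≡ (R.envᴿ S)) (R.treeᴿ S) (R.hitᴿ S fd))
              λ s₂ sm₂ W → let C₂ = const-same sm₂ (keeps augmentP refl refl refl refl refl refl) refl C₁ in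
              run-flat placeCopyP (Inserted (suc j))
                (clean-same sm₂ refl refl (R.cleanᴿ S) ,
                 (λ _ → finish C₂ (trans (sameReg sm₂ $j refl) (trans (sameReg sm₁ $j refl) j≡)) W
                    (λ w eq → origin (R.treeᴿ S) w (trans
                        (sym (cong (λ a → a w) (sameArray sm₂ aMark refl))) eq))) ,
                 (λ z → ⊥-elim (ok (trans (sym (trans (sameReg sm₂ $ok refl) ok₁)) z)))))
            (λ nf → run-≤ (s≤s (s≤s z≤n)) (run-flat ($ok ≔ lit 0) (Inserted (suc j))
              (R.cleanᴿ S , (λ nz → ⊥-elim (nz refl)) ,
               (λ _ → stuck⇒violated B₀ B₁ m j m<E B₀-old B₁-old B₀-copy B₁-copy P II j≤k few
                  (proj₁ (R.startᴿ S)) (proj₂ (R.startᴿ S)) (closed (R.treeᴿ S)) (R.missedᴿ S nf)))))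

-- Processing one edge, and all edges in order.

holds-fit : ∀ {n-1 k Item Fit Fit′ σ} → let open Slots n-1 k in
            (∀ {i w} → Item i → Fit i w → Fit′ i w) → Holds Item Fit σ → Holds Item Fit′ σ
holds-fit f H = record
  { sound = λ p<N eq → let it , fit = Slots.Holds.sound H p<N eq in it , f it fit
  ; unique = Slots.Holds.unique H ; complete = Slots.Holds.complete H }

module EdgeProgram (n-1 E : ℕ) (ends : Fin E → Fin (suc n-1) × Fin (suc n-1))
                   {t : ℕ} (root : Fin t → Fin (suc n-1)) (M : Matroid t) (k Q : ℕ)
                   (few : ∀ w → w < suc n-1 → # t (λ i → Certificates.ρ n-1 E ends root M k i ≡ᵇ w) ≤ k) where

  open Certificates n-1 E ends root M k
  open Conditions G root M k
  open Logic M Q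
  open MatroidProperties M
  open InsertProgram n-1 E ends root M k Q

  private
    n N : ℕ
    n = suc n-1
    N = k * n

  open Costs Q n t k

  -- The last step for an edge m: its first copy becomes the edge itself and
  -- the other copies are removed.
  data Cleaned (m : ℕ) : ℕ → ℕ → Set where
    old   : ∀ {i} → i < t + E → Cleaned m (suc i) (suc i)
    none  : Cleaned m 0 0
    first : Cleaned m (suc (t + E)) (suc (t + m))
    other : ∀ {i} → t + E < i → Cleaned m (suc i) 0

  module _ (m : ℕ) (m<E : m < E) (B₀ B₁ : ℕ → ℕ)
           (B₀-old : ∀ e → e < E → B₀ e ≡ g₀ e) (B₁-old : ∀ e → e < E → B₁ e ≡ g₁ e)
           (B₀-copy : ∀ i → i < suc k → B₀ (E + i) ≡ g₀ m) (B₁-copy : ∀ i → i < suc k → B₁ (E + i) ≡ g₁ m) where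

    private
      module S = Search M n-1 k ρ B₀ B₁ (Present m (suc k))
      module S₀ = Search M n-1 k ρ B₀ B₁ (Present m 0)
      module G₀ = Search M n-1 k ρ g₀ g₁ (Present m 0)
      module S′ = Search M n-1 k ρ g₀ g₁ (Present (suc m) 0)

    -- The edges present lie before m, and the arrays of ends have changed only from E on, so these
    -- edges keep their ends.
    placement-ends : ∀ {J σ} → G₀.Placement J σ → S₀.Placement J σ
    placement-ends {J} = holds-fit λ { {i} {w} it (r , e) → r , λ e′ eq → transfer it e′ eq (e e′ eq) }
      where
      transfer : ∀ {i w} → Search._∈ᴵ_ M n-1 k ρ g₀ g₁ (Present m 0) i J → ∀ e → i ≡ t + e →
          w ≡ g₀ e ⊎ w ≡ g₁ e → w ≡ B₀ e ⊎ w ≡ B₁ e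
      transfer (inj₁ (lt , _)) e refl _ = ⊥-elim (<⇒≱ lt (m≤m+n t e))
      transfer (inj₂ (e′ , eq , pr)) e refl at with +-cancelˡ-≡ t _ _ eq
      transfer (inj₂ (e , _ , inj₂ (E≤e , e<))) e refl at | refl = ⊥-elim
          (<⇒≱ (subst (e <_) (+-identityʳ E) e<) E≤e)
      transfer (inj₂ (e , _ , inj₁ e<m)) e refl at | refl =
        [ (λ eq → inj₁ (trans eq (sym (B₀-old e e<E)))) , (λ eq → inj₂
            (trans eq (sym (B₁-old e e<E)))) ]′ at
        where e<E = <-trans e<m m<E

    module _ {J : ℕ → Bool} {σ σ′ : ℕ → ℕ} (P : S.Placement J σ) (C : ∀ p → p < N → Cleaned m (σ p) (σ′ p)) where

      private
        -- The origin of an item `i` after cleaning: it was there before, or it is m and replaces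
        -- the first copy. The exclusion of m in the first case makes the two disjoint, which
        -- uniqueness needs.
        Source : ℕ → ℕ → Set
        Source p i = (i < t + E × i ≢ t + m × σ p ≡ suc i) ⊎ (i ≡ t + m × σ p ≡ suc (t + E))

        m∉ : ∀ {p} → p < N → σ p ≢ suc (t + m)
        m∉ p<N eq with proj₁ (S.sound P p<N eq)
        ... | inj₁ (lt , _) = <⇒≱ lt (m≤m+n t m)
        ... | inj₂ (e , eq′ , pr) with +-cancelˡ-≡ t _ _ eq′
        m∉ p<N eq | inj₂ (e , eq′ , inj₁ lt) | refl = n≮n m lt
        m∉ p<N eq | inj₂ (e , eq′ , inj₂ (le , _)) | refl = <⇒≱ m<E le

        source : ∀ {p i} → p < N → σ′ p ≡ suc i → Source p i
        source {p} p<N eq = go (C p p<N) refl eq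
          where
          go : ∀ {c c′ i} → Cleaned m c c′ → c ≡ σ p → c′ ≡ suc i → Source p i
          go (old lt) eq refl = inj₁ (lt , (λ { refl → m∉ p<N (sym eq) }) , sym eq)
          go first eq refl = inj₂ (refl , sym eq)

        target-old : ∀ {p i} → p < N → i < t + E → σ p ≡ suc i → σ′ p ≡ suc i
        target-old {p} {i} p<N lt eq = go (C p p<N) eq
          where
          go : ∀ {c c′} → Cleaned m c c′ → c ≡ suc i → c′ ≡ suc i
          go (old _) refl = refl
          go first refl = ⊥-elim (n≮n _ lt)
          go (other lt′) refl = ⊥-elim (<-asym lt lt′)

        target-first : ∀ {p} → p < N → σ p ≡ suc (t + E) → σ′ p ≡ suc (t + m)
        target-first {p} p<N eq = go (C p p<N) eq
          where
          go : ∀ {c c′} → Cleaned m c c′ → c ≡ suc (t + E) → c′ ≡ suc (t + m)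
          go (old lt) refl = ⊥-elim (n≮n _ lt)
          go first _ = refl
          go (other lt) refl = ⊥-elim (n≮n _ lt)

      placement-cleaned : S′.Placement J σ′
      placement-cleaned = record { sound = λ p<N eq → sound′ p<N
          (source p<N eq) ; unique = λ p<N q<N eq eq′ → unique′ p<N q<N (source p<N eq)
              (source q<N eq′) ; complete = complete′ }
        where
        e<E : ∀ {e} → t + e < t + E → e < E
        e<E = +-cancelˡ-< t _ _
        sound′ : ∀ {p i} → p < N → Source p i → Search._∈ᴵ_ M n-1 k ρ g₀ g₁ (Present (suc m) 0) i J ×
            S′.Fits i (p % n)
        sound′ p<N (inj₂ (refl , eq)) with S.sound P p<N eq
        ... | _ , _ , at = inj₂ (m , refl , inj₁ ≤-refl) , (λ lt → ⊥-elim (<⇒≱ lt (m≤m+n t m))) ,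
          λ e eq′ → subst (λ e → _ ≡ g₀ e ⊎ _ ≡ g₁ e) (+-cancelˡ-≡ t _ _ eq′)
            ([ (λ eq → inj₁ (trans eq (copy₀ refl))) , (λ eq → inj₂ (trans eq (copy₁ refl))) ]′
                (at E refl))
          where
          copy₀ : ∀ {e} → e ≡ E → B₀ e ≡ g₀ m
          copy₀ refl = trans (cong B₀ (sym (+-identityʳ E))) (B₀-copy 0 (s≤s z≤n))
          copy₁ : ∀ {e} → e ≡ E → B₁ e ≡ g₁ m
          copy₁ refl = trans (cong B₁ (sym (+-identityʳ E))) (B₁-copy 0 (s≤s z≤n))
        sound′ p<N (inj₁ (lt , _ , eq)) with S.sound P p<N eq
        ... | inj₁ r , at , _ = inj₁ r , at , λ { e refl → ⊥-elim (<⇒≱ (proj₁ r) (m≤m+n t e)) }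
        ... | inj₂ (e , refl , inj₂ (E≤e , _)) , _ = ⊥-elim (<⇒≱ (e<E lt) E≤e)
        ... | inj₂ (e , refl , inj₁ e<m) , at , at′ = inj₂ (e , refl , inj₁ (m<n⇒m<1+n e<m)) , at ,
          λ e′ eq′ → subst (λ e → _ ≡ g₀ e ⊎ _ ≡ g₁ e) (+-cancelˡ-≡ t _ _ eq′)
            ([ (λ eq → inj₁ (trans eq (B₀-old e (e<E lt)))) , (λ eq → inj₂
                (trans eq (B₁-old e (e<E lt)))) ]′ (at′ e refl))
        unique′ : ∀ {p q i} → p < N → q < N → Source p i → Source q i → p ≡ q
        unique′ p<N q<N (inj₁ (_ , _ , eq)) (inj₁ (_ , _ , eq′)) = S.unique P p<N q<N eq eq′
        unique′ p<N q<N (inj₂ (_ , eq)) (inj₂ (_ , eq′)) = S.unique P p<N q<N eq eq′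
        unique′ p<N q<N (inj₁ (_ , i≢ , _)) (inj₂ (i≡ , _)) = ⊥-elim (i≢ i≡)
        unique′ p<N q<N (inj₂ (i≡ , _)) (inj₁ (_ , i≢ , _)) = ⊥-elim (i≢ i≡)
        complete′ : ∀ {i} → Search._∈ᴵ_ M n-1 k ρ g₀ g₁ (Present (suc m) 0) i J → ∃[ p ] p < N ×
            σ′ p ≡ suc i
        complete′ (inj₁ (i<t , Ji)) with S.complete P (inj₁ (i<t , Ji))
        ... | p , p<N , eq = p , p<N , target-old p<N (≤-trans i<t (m≤m+n t E)) eq
        complete′ (inj₂ (e , refl , inj₂ (E≤e , e<))) = ⊥-elim
            (<⇒≱ (subst (e <_) (+-identityʳ E) e<) E≤e)
        complete′ (inj₂ (e , refl , inj₁ e<sm)) with e ≟ m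
        ... | no e≢m with S.complete P (inj₂ (e , refl , inj₁ (≤∧≢⇒< (s≤s⁻¹ e<sm) e≢m)))
        ...   | p , p<N , eq = p , p<N , target-old p<N (+-monoʳ-< t (≤-trans e<sm m<E)) eq
        complete′ (inj₂ (e , refl , inj₁ e<sm)) | yes refl
          with S.complete P (inj₂ (E , refl , inj₂ (≤-refl , subst (E <_) (+-comm (suc k) E)
              (s≤s (m≤n+m E k)))))
        ... | p , p<N , eq = p , p<N , target-first p<N eq

  -- Sorting the edge sets by their last edge splits (C2) into one claim per edge. At m = E this is
  -- (C2) itself.
  C2-below : ℕ → Set
  C2-below m = ∀ F → Nonempty F → (∀ e → restrict (lookup F) e ≡ true → e < m) → OfEdges.Inequality F

  restrict-< : ∀ {a} (f : Fin a → Bool) {i} → restrict f i ≡ true → i < a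
  restrict-< {suc a} f {zero}  _ = s≤s z≤n
  restrict-< {suc a} f {suc i} h = s≤s (restrict-< (f ∘ Fin.suc) h)

  record Progress (m : ℕ) (s : State) : Set where
    constructor progress
    field
      constᵐ : ConstV (regs s $n) (regs s $E) (regs s $t) (regs s $k) (regs s $N) (regs s $copies)
          (arrays s aρ)
      cleanᵐ : Clean s
      ends₀  : ∀ e → e < E → arrays s a₀ e ≡ g₀ e
      ends₁  : ∀ e → e < E → arrays s a₁ e ≡ g₁ e
      goodᵐ  : regs s $ok ≢ 0 → Config g₀ g₁ m 0 (arrays s aσ) (arrays s aI) × C2-below m
      badᵐ   : regs s $ok ≡ 0 → ¬ C2
  open Progress public

  module _ (m : ℕ) (m<E : m < E) where

    record Copied (i : ℕ) (s : State) : Set where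
      constructor copied
      field
        old₀  : ∀ e → e < E → arrays s a₀ e ≡ g₀ e
        old₁  : ∀ e → e < E → arrays s a₁ e ≡ g₁ e
        copy₀ : ∀ c → c < i → arrays s a₀ (E + c) ≡ g₀ m
        copy₁ : ∀ c → c < i → arrays s a₁ (E + c) ≡ g₁ m
    open Copied

    run-copies : ∀ s → regs s $E ≡ E → regs s $copies ≡ suc k → regs s $u ≡ g₀ m → regs s $v ≡ g₁ m →
      (∀ e → e < E → arrays s a₀ e ≡ g₀ e) → (∀ e → e < E → arrays s a₁ e ≡ g₁ e) →
      Run still copiesP s copiesCost (Copied (suc k))
    run-copies s E≡′ c≡ u≡′ v≡′ o₀ o₁ = run-for $l $copies copyP Copied refl refl refl (λ _ _ → refl) c≡
      (copied o₀ o₁ (λ _ ()) (λ _ ()))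
      λ { i s₁ i< sm refl C → let E≡₁ = trans (sameReg sm $E refl) E≡′
                                  u≡₁ = trans (sameReg sm $u refl) u≡′
                                  v≡₁ = trans (sameReg sm $v refl) v≡′ in
        run-flat copyP (λ s′ → Copied (suc i) (setReg s′ $l (suc i)))
          (copied (keep E≡₁ (old₀ C)) (keep E≡₁ (old₁ C)) (write {arrays s₁ a₀} E≡₁ u≡₁ (copy₀ C))
              (write {arrays s₁ a₁} E≡₁ v≡₁ (copy₁ C))) }
      where
      keep : ∀ {a : ℕ → ℕ} {r i x} {g : ℕ → ℕ} → r ≡ E → (∀ e → e < E → a e ≡ g e) → ∀ e → e < E →
          (a [ r + i ↦ x ]) e ≡ g e
      keep {a} {r} {i} {x} refl h e e<E = trans (update-other a (r + i) x
          (<⇒≢ (≤-trans e<E (m≤m+n E i)))) (h e e<E)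
      write : ∀ {a : ℕ → ℕ} {r i x y} → r ≡ E → x ≡ y → (∀ c → c < i → a (E + c) ≡ y) → ∀ c → c < suc i →
          (a [ r + i ↦ x ]) (E + c) ≡ y
      write {a} {r} {i} {x} refl refl h c c<si with c ≟ i
      ... | yes refl = update-same a (E + c) x
      ... | no c≢i = trans (update-other a (E + i) x (c≢i ∘ +-cancelˡ-≡ E _ _))
          (h c (≤∧≢⇒< (s≤s⁻¹ c<si) c≢i))

    Cleaning : State → ℕ → State → Set
    Cleaning s₀ i s = ∀ p → (p < i → Cleaned m (arrays s₀ aσ p) (arrays s aσ p)) ×
        (i ≤ p → arrays s aσ p ≡ arrays s₀ aσ p)

    cleaning-write : ∀ {σ₀ σ : ℕ → ℕ} i c → Cleaned m (σ₀ i) c →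
      (∀ p → (p < i → Cleaned m (σ₀ p) (σ p)) × (i ≤ p → σ p ≡ σ₀ p)) →
      ∀ p → (p < suc i → Cleaned m (σ₀ p) ((σ [ i ↦ c ]) p)) × (suc i ≤ p → (σ [ i ↦ c ]) p ≡ σ₀ p)
    cleaning-write {σ₀} {σ} i c cl h p with p ≟ i
    ... | yes refl = (λ _ → subst (Cleaned m (σ₀ p)) (sym (update-same σ p c)) cl) , (λ lt → ⊥-elim
        (n≮n p lt))
    ... | no p≢i = (λ lt → subst (Cleaned m (σ₀ p)) (sym (update-other σ i c p≢i)) (proj₁ (h p)
        (≤∧≢⇒< (s≤s⁻¹ lt) p≢i))) ,
                   (λ lt → trans (update-other σ i c p≢i) (proj₂ (h p) (<⇒≤ lt)))

    run-clean : ∀ s → regs s $t ≡ t → regs s $E ≡ E → regs s $m ≡ m → regs s $N ≡ N →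
      Run still (For $q $N cleanP) s (N * (cost Q cleanP + 8) + 6) (Cleaning s N)
    run-clean s t≡′ E≡′ m≡′ N≡′ = run-for $q $N cleanP (Cleaning s) refl refl refl (λ _ _ → refl) N≡′
      (λ p → (λ ()) , λ _ → refl)
      λ { i s₁ i<N sm refl h → run-flat cleanP (λ s′ → Cleaning s (suc i) (setReg s′ $q (suc i)))
        (step s₁ (trans (sameReg sm $t refl) t≡′) (trans (sameReg sm $E refl) E≡′)
            (trans (sameReg sm $m refl) m≡′) h) }
      where
      clean-old : ∀ c → c ≤ t + E → Cleaned m c c
      clean-old zero    _  = none
      clean-old (suc c) le = old le
      clean-other : ∀ c → suc (t + E) < c → Cleaned m c 0
      clean-other (suc c) (s≤s lt) = other lt
      step : ∀ s₁ → regs s₁ $t ≡ t → regs s₁ $E ≡ E → regs s₁ $m ≡ m → Cleaning s (regs s₁ $q) s₁ →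
        wp cleanP (λ s′ → Cleaning s (suc (regs s₁ $q)) (setReg s′ $q (suc (regs s₁ $q)))) s₁
      step s₁ t≡₁ E≡₁ m≡₁ h =
        (λ big → (λ bigger → cleaning-write i 0 (subst (λ c → Cleaned m c 0) c≡
                    (clean-other c (≰⇒> λ le → bigger (m≤n⇒m∸n≡0 (subst (c ≤_) (sym big≡) le))))) h)
               , (λ exact → cleaning-write i (regs s₁ $t + regs s₁ $m + 1)
                    (subst₂ (Cleaned m) (trans (sym (≤-antisym (subst (c ≤_) big≡ (m∸n≡0⇒m≤n exact))
                        (above big))) c≡)
                       (sym (trans (+-comm _ 1) (cong₂ (λ a b → suc (a + b)) t≡₁ m≡₁))) first) h))
        , (λ small → λ p → (λ lt → case p ≟ i of λ
              { (yes refl) → subst (λ c′ → Cleaned m c′ c) c≡ (clean-old c (subst (c ≤_) small≡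
                  (m∸n≡0⇒m≤n small)))
              ; (no p≢i) → proj₁ (h p) (≤∧≢⇒< (s≤s⁻¹ lt) p≢i) }) , (λ lt → proj₂ (h p) (<⇒≤ lt)))
        where
        i = regs s₁ $q
        c = arrays s₁ aσ i
        c≡ : c ≡ arrays s aσ i
        c≡ = proj₂ (h i) ≤-refl
        small≡ : regs s₁ $t + regs s₁ $E ≡ t + E
        small≡ = cong₂ _+_ t≡₁ E≡₁
        big≡ : regs s₁ $t + regs s₁ $E + 1 ≡ suc (t + E)
        big≡ = trans (+-comm _ 1) (cong suc small≡)
        above : c ∸ (regs s₁ $t + regs s₁ $E) ≢ 0 → suc (t + E) ≤ c
        above nz = ≰⇒> λ le → nz (m≤n⇒m∸n≡0 (subst (c ≤_) (sym small≡) le))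

    run-edge : ∀ s → regs s $m ≡ m → regs s $ok ≢ 0 → Progress m s →
      Run still edgeP s edgeCost (λ s′ → Progress (suc m) (setReg s′ $m (suc m)))
    run-edge s m≡ ok P = run-seq (run-flat startEdgeP (λ s′ → s′ ≡ s₁) refl) λ { _ _ refl →
      run-seq (run-copies s₁ (E≡ (constᵐ P)) (copies≡ (constᵐ P)) u≡₁ v≡₁ (ends₀ P)
          (ends₁ P)) λ s₂ sm₂ C →
      let const₂ = const-same sm₂ (keeps copiesP refl refl refl refl refl refl) refl (constᵐ P) in
      run-seq (run-insertions s₂ C const₂ (trans (sameReg sm₂ $m refl) m≡)
          (edge-env s₂ C (trans (sameReg sm₂ $u refl) u≡₁) (trans (sameReg sm₂ $v refl) v≡₁))
              (start₂ s₂ C sm₂)) λ s₃ sm₃ (m₃ , ins) →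
      let const₃ = const-same sm₃ (keeps insertionsP refl refl refl refl refl refl) refl const₂ in
      finish s₂ C s₃ const₃ m₃
        (λ e e<E → trans (cong (λ a → a e) (sameArray sm₃ a₀ refl)) (old₀ C e e<E))
        (λ e e<E → trans (cong (λ a → a e) (sameArray sm₃ a₁ refl)) (old₁ C e e<E))
        ins }
      where
      s₁ = setReg (setReg s $u (arrays s a₀ (regs s $m))) $v (arrays s a₁ (regs s $m))
      u≡₁ : regs s₁ $u ≡ g₀ m
      u≡₁ = trans (cong (arrays s a₀) m≡) (ends₀ P m m<E)
      v≡₁ : regs s₁ $v ≡ g₁ m
      v≡₁ = trans (cong (arrays s a₁) m≡) (ends₁ P m m<E)
      module _ (s₂ : State) (C : Copied (suc k) s₂) where
        module F = ForEdge few m m<E (arrays s₂ a₀) (arrays s₂ a₁) (old₀ C) (old₁ C) (copy₀ C) (copy₁ C)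
        edge-env : regs s₂ $u ≡ g₀ m → regs s₂ $v ≡ g₁ m → F.EdgeEnv s₂
        edge-env u v = F.edgeEnvV u v refl refl
        start₂ : Same copiesP s₁ s₂ → regs s₂ $ok ≢ 0 × F.Inserted 0 s₂
        start₂ sm = ok ∘ trans (sym ok≡) , clean-same sm refl refl (cleanᵐ P) ,
          (λ _ → let config rep ind pl = proj₁ (goodᵐ P ok) in
            config (subst (λ a → Represents a _) (sym (sameArray sm aI refl)) rep) ind
              (subst (Search.Placement M n-1 k ρ (arrays s₂ a₀) (arrays s₂ a₁) (Present m 0) _)
                  (sym (sameArray sm aσ refl))
                (placement-ends m m<E _ _ (old₀ C) (old₁ C) (copy₀ C) (copy₁ C) pl))) ,
          λ z → ⊥-elim (ok (trans (sym ok≡) z))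
          where ok≡ = sameReg sm $ok refl
        run-insertions : ConstV (regs s₂ $n) (regs s₂ $E) (regs s₂ $t) (regs s₂ $k) (regs s₂ $N)
            (regs s₂ $copies) (arrays s₂ aρ) →
          regs s₂ $m ≡ m → F.EdgeEnv s₂ → regs s₂ $ok ≢ 0 × F.Inserted 0 s₂ →
          Run still insertionsP s₂ (suc k * ((2 + insertCost) + 8) + 6) (λ s₃ → regs s₃ $m ≡ m ×
              F.Inserted (suc k) s₃)
        run-insertions const₂ m₂ env (_ , start) = run-map (λ sm ins → trans
            (sameReg sm $m refl) m₂ , ins)
          (run-for $j $copies (if reg $ok then insertP else skip end) F.Inserted refl refl refl
              (λ _ _ → refl) (copies≡ const₂) start
            λ j s₃ j< sm j≡ (cl , good , bad) → run-if
              (λ ok₃ → let config {I} rep ind pl = good ok₃ in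
                run-map (λ _ r → r) (F.run-insert j (s≤s⁻¹ j<) pl ind s₃
                  (const-same sm (keeps insertionsP refl refl refl refl refl refl) refl const₂)
                  (F.edgeEnvV (trans (sameReg sm $u refl) (F.EdgeEnvV.u≡ env))
                      (trans (sameReg sm $v refl) (F.EdgeEnvV.v≡ env))
                              (sameArray sm a₀ refl) (sameArray sm a₁ refl)) cl j≡ ok₃ rep refl))
              (λ z → run-≤ (s≤s z≤n) (run-flat skip (λ s′ → F.Inserted (suc j) (setReg s′ $j (suc j)))
                (cl , (λ nz → ⊥-elim (nz z)) , bad))))
        finish : ∀ s₃ → ConstV (regs s₃ $n) (regs s₃ $E) (regs s₃ $t) (regs s₃ $k) (regs s₃ $N)
            (regs s₃ $copies) (arrays s₃ aρ) →
          regs s₃ $m ≡ m → (∀ e → e < E → arrays s₃ a₀ e ≡ g₀ e) → (∀ e → e < E →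
              arrays s₃ a₁ e ≡ g₁ e) → F.Inserted (suc k) s₃ →
          Run still (if reg $ok then For $q $N cleanP else skip end) s₃
              (2 + (N * (cost Q cleanP + 8) + 6))
            (λ s′ → Progress (suc m) (setReg s′ $m (suc m)))
        finish s₃ const₃ m₃ o₀ o₁ (cl , good , bad) = run-if
          (λ ok₃ → let config {J} rep ind pl = good ok₃ in
            run-map (λ {s₄} sm₄ c → progress (const-same sm₄
                (keeps (For $q $N cleanP) refl refl refl refl refl refl) refl const₃)
                (clean-same sm₄ refl refl cl)
                (λ e e<E → trans (cong (λ a → a e) (sameArray sm₄ a₀ refl)) (o₀ e e<E))
                (λ e e<E → trans (cong (λ a → a e) (sameArray sm₄ a₁ refl)) (o₁ e e<E))
                (λ _ → config (subst (λ a → Represents a J) (sym (sameArray sm₄ aI refl)) rep) ind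
                         (placement-cleaned m m<E _ _ (old₀ C) (old₁ C) (copy₀ C) (copy₁ C) pl
                             (λ p p<N → proj₁ (c p) p<N)) ,
                       extend-C2 pl ind)
                (λ z → ⊥-elim (ok₃ (trans (sym (sameReg sm₄ $ok refl)) z))))
              (run-clean s₃ (t≡ const₃) (E≡ const₃) m₃ (N≡ const₃)))
          (λ z → run-≤ (≤-trans (s≤s z≤n) (m≤n+m 6 _)) (run-flat skip (λ s′ → Progress (suc m)
              (setReg s′ $m (suc m)))
            (progress const₃ cl o₀ o₁ (λ nz → ⊥-elim (nz z)) bad)))
          where
          extend-C2 : ∀ {σ J} → Search.Placement M n-1 k ρ (arrays s₂ a₀) (arrays s₂ a₁)
              (Present m (suc k)) J σ → Ind J → C2-below (suc m)
          -- Sets with last edge m are settled by the k + 1 copies, and all others by the edges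
          -- processed before.
          extend-C2 pl ind F ne below with restrict (lookup F) m in fm
          ... | true = all-copies⇒inequality _ _ m (suc k) m<E (old₀ C) (old₁ C) (copy₀ C)
              (copy₁ C) pl ind refl F fm
                         (λ e _ fe → s≤s⁻¹ (below e fe))
          ... | false = proj₂ (goodᵐ P ok) F ne λ e fe → ≤∧≢⇒< (s≤s⁻¹ (below e fe))
              (λ { refl → true≢false fe fm })

  run-edges : ∀ s → regs s $E ≡ E → Progress 0 s → Run still
      (For $m $E (if reg $ok then edgeP else skip end)) s (edgesCost E) (Progress E)
  run-edges s E≡′ P = run-for $m $E (if reg $ok then edgeP else skip end) Progress refl refl refl
      (λ _ _ → refl) E≡′
    (progress (constᵐ P) (cleanᵐ P) (ends₀ P) (ends₁ P) (goodᵐ P) (badᵐ P))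
    λ m s₁ m<E _ m≡ P₁ → run-if (λ ok → run-edge m m<E s₁ m≡ ok P₁)
      (λ z → run-≤ (s≤s z≤n) (run-flat skip (λ s′ → Progress (suc m) (setReg s′ $m (suc m)))
        (progress (constᵐ P₁) (cleanᵐ P₁) (ends₀ P₁) (ends₁ P₁) (λ nz → ⊥-elim (nz z)) (badᵐ P₁))))

-- Testing (C1), the initial placement, and the decision.

distance-zero : ∀ a b → (a ∸ b) + (b ∸ a) ≡ 0 → a ≡ b
distance-zero a b z = ≤-antisym (m∸n≡0⇒m≤n (m+n≡0⇒m≡0 (a ∸ b) z)) (m∸n≡0⇒m≤n (m+n≡0⇒n≡0 (a ∸ b) z))

distance-refl : ∀ a → (a ∸ a) + (a ∸ a) ≡ 0
distance-refl a rewrite n∸n≡0 a = refl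

equal-bit : ∀ a b → 1 ∸ ((a ∸ b) + (b ∸ a)) ≡ bit (a ≡ᵇ b)
equal-bit a b with a ≟ b
... | yes refl rewrite distance-refl a | ≡ᵇ-refl a = refl
... | no a≢b rewrite ≢⇒≡ᵇ a≢b with (a ∸ b) + (b ∸ a) in eq
...   | zero  = ⊥-elim (a≢b (distance-zero a b eq))
...   | suc d = 0∸n≡0 d

module MainProgram (n-1 E : ℕ) (ends : Fin E → Fin (suc n-1) × Fin (suc n-1))
                   {t : ℕ} (root : Fin t → Fin (suc n-1)) (M : Matroid t) (k Q : ℕ) (rank≡k : rank M ⊤ ≡ k) where

  open Certificates n-1 E ends root M k
  open Conditions G root M k
  open Logic M Q
  open MatroidProperties M
  open InsertProgram n-1 E ends root M k Q
  open Semantics M Q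
  open Oracle M Q
  open Costs Q (suc n-1) t k

  private
    n N : ℕ
    n = suc n-1
    N = k * n

  IndepAt : ℕ → Set
  IndepAt w = Ind (λ i → ρ i ≡ᵇ w)

  R≡sub : ∀ v → R[ v ] ≡ sub (λ i → ρ i ≡ᵇ toℕ v)
  R≡sub v = tabulate-cong λ i → trans (eq (root i)) (cong (_≡ᵇ toℕ v)
      (sym (fromFin-toℕ (λ i → toℕ (root i)) i)))
    where
    eq : ∀ r → does (r Fin.≟ v) ≡ (toℕ r ≡ᵇ toℕ v)
    eq r with r Fin.≟ v
    ... | yes refl = sym (≡ᵇ-refl (toℕ r))
    ... | no r≢v   = sym (≢⇒≡ᵇ (r≢v ∘ toℕ-injective))

  C1⁺ : (∀ w → w < n → IndepAt w) → C1
  C1⁺ h v = subst (Matroid.Indep M) (sym (R≡sub v)) (h (toℕ v) (toℕ<n v))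

  C1⁻ : C1 → ∀ w → w < n → IndepAt w
  C1⁻ c1 w w<n = subst IndepAt (toℕ-fromℕ< w<n) (subst (Matroid.Indep M) (R≡sub (fromℕ< w<n))
      (c1 (fromℕ< w<n)))

  record Base (rn rE rt rk rN : ℕ) (r : ℕ → ℕ) : Set where
    constructor base
    field
      n≡ᵇ : rn ≡ n
      E≡ᵇ : rE ≡ E
      t≡ᵇ : rt ≡ t
      k≡ᵇ : rk ≡ k
      N≡ᵇ : rN ≡ N
      ρ≡ᵇ : r ≡ ρ
  open Base

  BaseS : State → Set
  BaseS s = Base (regs s $n) (regs s $E) (regs s $t) (regs s $k) (regs s $N) (arrays s aρ)

  Checked : ℕ → State → Set
  Checked w s = (regs s $ok ≢ 0 → ∀ w′ → w′ < w → IndepAt w′) × (regs s $ok ≡ 0 → ¬ C1)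

  run-checkVertex : ∀ s w → w < n → regs s $t ≡ t → arrays s aρ ≡ ρ → regs s $w ≡ w → Checked w s →
    Run still checkVertexP s checkVertexCost (λ s′ → Checked (suc w) (setReg s′ $w (suc w)))
  run-checkVertex s w w<n t≡ ρ≡ refl (good , bad) =
    run-seq (run-for $x $t testP (λ i s′ → ∀ z → z < i → arrays s′ aTest z ≡ bit
        (ρ z ≡ᵇ w)) refl refl refl (λ _ _ → refl) t≡ (λ _ ())
      λ { i s₁ i<t sm refl h → run-flat testP _ (write s₁ i (sameReg sm $w refl)
          (trans (sameArray sm aρ refl) ρ≡) h) }) λ s₁ sm₁ tested →
    let o≡ = oracle-agrees {arrays s₁ aTest} {λ i → ρ i ≡ᵇ w} tested
        ok≡ = sameReg sm₁ $ok refl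
    in run-flat answerP (λ s′ → Checked (suc w) (setReg s′ $w (suc w)))
      ((λ yes′ → (λ ok w′ w′<sw → case w′ ≟ w of λ
           { (yes refl) → holds (ind? (λ i → ρ i ≡ᵇ w)) (bit-true (yes′ ∘ trans o≡))
           ; (no w′≢w) → good (ok ∘ trans ok≡) w′ (≤∧≢⇒< (s≤s⁻¹ w′<sw) w′≢w) }) ,
               (λ z → bad (trans (sym ok≡) z))) ,
       (λ no′ → (λ nz → ⊥-elim (nz refl)) , λ _ c1 → fails (ind? (λ i → ρ i ≡ᵇ w))
           (bit-false (trans (sym o≡) no′)) (C1⁻ c1 w w<n)))
    where
    write : ∀ s₁ i → regs s₁ $w ≡ w → arrays s₁ aρ ≡ ρ → (∀ z → z < i → arrays s₁ aTest z ≡ bit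
        (ρ z ≡ᵇ w)) →
      ∀ z → z < suc i → (arrays s₁ aTest [ i ↦ 1 ∸ ((arrays s₁ aρ i ∸ regs s₁ $w) +
          (regs s₁ $w ∸ arrays s₁ aρ i)) ]) z ≡ bit (ρ z ≡ᵇ w)
    write s₁ i w≡ ρ≡₁ h z z<si rewrite w≡ | ρ≡₁ = update-cases (arrays s₁ aTest) i _ (λ z b → z < suc i →
        b ≡ bit (ρ z ≡ᵇ w)) z
      (λ { refl _ → equal-bit (ρ z) w }) (λ z≢i z<si → h z (≤∧≢⇒< (s≤s⁻¹ z<si) z≢i)) z<si

  run-checkRoots : ∀ s → BaseS s → regs s $ok ≡ 1 → Run still checkRootsP s checkRootsCost (Checked n)
  run-checkRoots s B ok = run-for $w $n checkVertexP Checked refl refl refl (λ _ _ → refl) (n≡ᵇ B)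
    ((λ _ _ ()) , λ z → case trans (sym ok) z of λ ())
    λ w s₁ w<n sm w≡ c → run-checkVertex s₁ w w<n (trans (sameReg sm $t refl) (t≡ᵇ B))
        (trans (sameArray sm aρ refl) (ρ≡ᵇ B)) w≡ c

  module _ (few : ∀ w → w < n → # t (λ i → ρ i ≡ᵇ w) ≤ k) where
    open Homes n-1 k t ρ ρ<n few
    open EdgeProgram n-1 E ends root M k Q few

    record Placing (i : ℕ) (s : State) : Set where
      constructor placing
      field
        next   : ∀ w → w < n → arrays s aPos w ≡ w + before w i * n
        placed : ∀ z → z < i → arrays s aσ (home z) ≡ suc z
        origin : ∀ p z → arrays s aσ p ≡ suc z → z < i × p ≡ home z
    open Placing

    wp-place : ∀ s → regs s $x < t → regs s $n ≡ n → arrays s aρ ≡ ρ → Placing (regs s $x) s →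
      wp placeP (λ s′ → Placing (suc (regs s $x)) (setReg s′ $x (suc (regs s $x)))) s
    wp-place s i<t n≡ ρ≡ P rewrite ρ≡ | n≡ | next P (ρ (regs s $x)) (ρ<n _ i<t) = placing
      (λ w w<n → update-cases (arrays s aPos) (ρ i) (home i + n) (λ w b → w < n → b ≡ w + before w
          (suc i) * n) w
        (λ { refl _ → trans (+-assoc (ρ i) _ n) (cong (ρ i +_) (trans (+-comm _ n) (cong (_* n)
            (sym (before-suc i))))) })
        (λ w≢ w<n → trans (next P w w<n) (cong (λ b → w + b * n) (sym (before-other w w≢)))) w<n)
      (λ z z<si → update-cases (arrays s aσ) (home i) (i + 1) (λ p b → p ≡ home z → b ≡ suc z) (home z)
        (λ eq _ → trans (+-comm i 1) (cong suc (home-injective i<t (≤-trans z<si i<t) (sym eq))))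
        (λ hz≢ _ → placed P z (≤∧≢⇒< (s≤s⁻¹ z<si) λ { refl → hz≢ refl })) refl)
      (λ p z → update-cases (arrays s aσ) (home i) (i + 1) (λ p b → b ≡ suc z → z < suc i × p ≡ home z) p
        (λ { refl eq → case suc-injective (trans (+-comm 1 i) eq) of λ { refl → ≤-refl , refl } })
        (λ _ eq → let z<i , p≡ = origin P p z eq in m<n⇒m<1+n z<i , p≡))
      where
      i = regs s $x
      before-other : ∀ w → w ≢ ρ i → before w (suc i) ≡ before w i
      before-other w w≢ = trans (#-suc i (λ j → ρ j ≡ᵇ w)) (trans (cong (λ b → before w i + bit b)
          (≢⇒≡ᵇ (w≢ ∘ sym))) (+-identityʳ _))

    run-placeRoots : ∀ s → BaseS s → (∀ p → arrays s aσ p ≡ 0) → Run still placeRootsP s placeRootsCost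
        (λ s′ → regs s′ $copies ≡ suc k × Placing t s′)
    run-placeRoots s B empty =
      run-seq (run-flat ($copies ≔ reg $k ⊕ lit 1) (λ s′ → s′ ≡ s₁) refl) λ { _ _ refl →
      run-seq (run-for $w $n (aPos [ reg $w ]≔ reg $w) (λ i s′ → ∀ w → w < i →
          arrays s′ aPos w ≡ w) refl refl refl (λ _ _ → refl) (n≡ᵇ B) (λ _ ())
        λ { i s₂ _ _ refl h → run-flat (aPos [ reg $w ]≔ reg $w) (λ s′ → ∀ w → w < suc i →
            arrays s′ aPos w ≡ w)
          (λ w w<si → update-cases (arrays s₂ aPos) i i (λ w b → w < suc i → b ≡ w) w
              (λ { refl _ → refl })
            (λ w≢i w<si → h w (≤∧≢⇒< (s≤s⁻¹ w<si) w≢i)) w<si) }) λ s₂ sm₂ pos →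
      run-map (λ {s₃} sm₃ P → trans (sameReg sm₃ $copies refl) (trans (sameReg sm₂ $copies refl)
          (trans (+-comm _ 1) (cong suc (k≡ᵇ B)))) , P)
      (run-for $x $t placeP Placing refl refl refl (λ _ _ → refl) (trans (sameReg sm₂ $t refl) (t≡ᵇ B))
        (placing (λ w w<n → trans (pos w w<n) (sym (+-identityʳ w))) (λ _ ())
          (λ p z eq → case trans (sym eq) (trans (cong (λ a → a p) (sameArray sm₂ aσ refl))
              (empty p)) of λ ()))
        λ { i s₃ i<t sm₃ refl P → run-flat placeP (λ s′ → Placing (suc i) (setReg s′ $x (suc i)))
          (wp-place s₃ i<t (trans (sameReg sm₃ $n refl) (trans (sameReg sm₂ $n refl) (n≡ᵇ B)))
                           (trans (sameArray sm₃ aρ refl) (trans (sameArray sm₂ aρ refl)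
                               (ρ≡ᵇ B))) P) }) }
      where s₁ = setReg s $copies (regs s $k + 1)

    -- With `I` empty, every root is an item and sits in its home.
    placing⇒config : ∀ {s} → Placing t s → (∀ i → arrays s aI i ≡ 0) → Config g₀ g₁ 0 0 (arrays s aσ)
        (arrays s aI)
    placing⇒config {s} P zero-I = config {current = λ _ → false} zero-I Ind-∅ (record
      { sound = λ {p} {i} _ eq → let i<t , p≡ = origin P p i eq in inj₁ (i<t , refl) ,
          (λ _ → sym (trans (cong (_% n) p≡) (home-% i<t))) , λ { e refl → ⊥-elim (<⇒≱ i<t (m≤m+n t e)) }
      ; unique = λ {p} {q} {i} _ _ eq eq′ → trans (proj₂ (origin P p i eq))
          (sym (proj₂ (origin P q i eq′)))
      ; complete = λ { {i} (inj₁ (i<t , _)) → home i , home-< i<t , placed P i i<t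
                     ; (inj₂ (e , _ , inj₁ ()))
                     ; (inj₂ (e , _ , inj₂ (E≤e , e<))) → ⊥-elim
                         (<⇒≱ (subst (e <_) (+-identityʳ E) e<) E≤e) } })

  -- An independent set has at most as many elements as the rank, which is k. In this form (C1)
  -- provides each vertex with slots for all its roots.
  few-roots : (∀ w → w < n → IndepAt w) → ∀ w → w < n → # t (λ i → ρ i ≡ᵇ w) ≤ k
  few-roots h w w<n = subst (# t (λ i → ρ i ≡ᵇ w) ≤_) rank≡k (#-≤-rank (h w w<n))

  record Initial (s : State) : Set where
    constructor initial
    field
      initial-a₀ : arrays s a₀ ≡ g₀
      initial-a₁ : arrays s a₁ ≡ g₁
      zeros      : ∀ a → 3 ≤ a → ∀ i → arrays s a i ≡ 0
  open Initial

  Decided : State → Set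
  Decided s = (regs s $ok ≢ 0 → C1 × C2) × (regs s $ok ≡ 0 → ¬ (C1 × C2))

  run-checked : ∀ s → BaseS s → Initial s → regs s $ok ≡ 1 → E ≤ N →
      Run still checkedP s checkedCost Decided
  run-checked s B In ok≡1 E≤N = run-seq (run-checkRoots s B ok≡1) λ s₁ sm₁ (good , bad) → run-if
    (λ ok₁ → let few = few-roots (good ok₁) in
      run-seq (run-placeRoots few s₁ (base₁ sm₁) (λ p → zero₁ sm₁ aσ refl (≤ᵇ⇒≤ 3 4 _) p)) λ s₂ sm₂
          (copies , P) →
      run-map (λ _ P′ → (λ ok → C1⁺ (good ok₁) , λ F ne → proj₂ (goodᵐ P′ ok) F ne (λ e → restrict-< few
          (lookup F))) ,
                        (λ z → badᵐ P′ z ∘ proj₂))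
        -- (C3) has given E ≤ k n, which frees the cost of the loop over the edges from E.
        (run-≤ (+-monoˡ-≤ 6 (*-monoˡ-≤ _ E≤N)) (run-edges few s₂ (trans (sameReg sm₂ $E refl)
            (E≡ᵇ (base₁ sm₁))) (progress
          (constV (trans (sameReg sm₂ $n refl) (n≡ᵇ (base₁ sm₁))) (trans (sameReg sm₂ $E refl)
              (E≡ᵇ (base₁ sm₁)))
                  (trans (sameReg sm₂ $t refl) (t≡ᵇ (base₁ sm₁))) (trans (sameReg sm₂ $k refl)
                      (k≡ᵇ (base₁ sm₁)))
                  (trans (sameReg sm₂ $N refl) (N≡ᵇ (base₁ sm₁))) copies (trans (sameArray sm₂ aρ refl)
                      (ρ≡ᵇ (base₁ sm₁))))
          ((λ z _ → trans (cong (λ a → a z) (sameArray sm₂ aMark refl)) (zero₁ sm₁ aMark refl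
              (≤ᵇ⇒≤ 3 6 _) z)) ,
           (λ z _ → trans (cong (λ a → a z) (sameArray sm₂ aDone refl)) (zero₁ sm₁ aDone refl
               (≤ᵇ⇒≤ 3 10 _) z)))
          (λ e _ → cong (λ a → a e) (trans (sameArray sm₂ a₀ refl) (trans (sameArray sm₁ a₀ refl)
              (initial-a₀ In))))
          (λ e _ → cong (λ a → a e) (trans (sameArray sm₂ a₁ refl) (trans (sameArray sm₁ a₁ refl)
              (initial-a₁ In))))
          (λ _ → placing⇒config few P (λ i → trans (cong (λ a → a i) (sameArray sm₂ aI refl))
              (zero₁ sm₁ aI refl ≤-refl i)) ,
                 λ { F (e , e∈F) below → case below (toℕ e) (trans (restrict-toℕ (lookup F) e)
                     ([]=⇒lookup e∈F)) of λ () })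
          (λ z → ⊥-elim (ok₁ (trans (sym (sameReg sm₂ $ok refl)) z)))))))
    (λ z → run-≤ (s≤s z≤n) (run-flat skip Decided ((λ nz → ⊥-elim (nz z)) , λ _ → bad z ∘ proj₁)))
    where
    open EdgeProgram n-1 E ends root M k Q
    base₁ : ∀ {s₁} → Same checkRootsP s s₁ → BaseS s₁
    base₁ sm = base (trans (sameReg sm $n refl) (n≡ᵇ B)) (trans (sameReg sm $E refl) (E≡ᵇ B))
        (trans (sameReg sm $t refl) (t≡ᵇ B))
                    (trans (sameReg sm $k refl) (k≡ᵇ B)) (trans (sameReg sm $N refl) (N≡ᵇ B))
                        (trans (sameArray sm aρ refl) (ρ≡ᵇ B))
    zero₁ : ∀ {s₁} → Same checkRootsP s s₁ → ∀ a → writesArray checkRootsP a ≡ false → 3 ≤ a → ∀ i →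
        arrays s₁ a i ≡ 0
    zero₁ sm a wa 3≤ i = trans (cong (λ f → f i) (sameArray sm a wa)) (zeros In a 3≤ i)

-- The order of the running time.

record Sizes : Set where
  field
    n t k Q : ℕ
    n≥1 : 1 ≤ n
    t≥1 : 1 ≤ t
    k≥1 : 1 ≤ k
    Q≥1 : 1 ≤ Q
open Sizes

infix 4 _≲_

-- One constant for all sizes at once. As every size is at least 1, additive constants are absorbed
-- by any product of sizes.
_≲_ : (Sizes → ℕ) → (Sizes → ℕ) → Set
f ≲ g = ∃[ c ] ∀ π → f π ≤ c * g π

private variable
  f g h f′ g′ : Sizes → ℕ

≤⇒≲ : (∀ π → f π ≤ g π) → f ≲ g
≤⇒≲ le = 1 , λ π → ≤-trans (le π) (≤-reflexive (sym (*-identityˡ _)))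

≲-refl : f ≲ f
≲-refl = ≤⇒≲ (λ _ → ≤-refl)

≲-trans : f ≲ g → g ≲ h → f ≲ h
≲-trans {h = h} (c , le) (d , le′) = c * d , λ π → ≤-trans (le π)
  (≤-trans (*-monoʳ-≤ c (le′ π)) (≤-reflexive (sym (*-assoc c d (h π)))))

≲-+ : f ≲ h → g ≲ h → (λ π → f π + g π) ≲ h
≲-+ {h = h} (c , le) (d , le′) = c + d , λ π → ≤-trans (+-mono-≤ (le π) (le′ π)) (≤-reflexive
    (sym (*-distribʳ-+ (h π) c d)))

≲-* : f ≲ g → f′ ≲ g′ → (λ π → f π * f′ π) ≲ (λ π → g π * g′ π)
≲-* {g = g} {g′ = g′} (c , le) (d , le′) = c * d , λ π → ≤-trans (*-mono-≤ (le π) (le′ π))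
  (≤-reflexive ([m*n]*[o*p]≡[m*o]*[n*p] c (g π) d (g′ π)))

const-≲ : ∀ m → (∀ π → 1 ≤ g π) → (λ _ → m) ≲ g
const-≲ m g≥1 = m , λ π → ≤-trans (≤-reflexive (sym (*-identityʳ m))) (*-monoʳ-≤ m (g≥1 π))

≲-const+ : ∀ m → (∀ π → 1 ≤ g π) → f ≲ g → (λ π → m + f π) ≲ g
≲-const+ m g≥1 = ≲-+ (const-≲ m g≥1)

cost-≲ : ∀ p → (λ π → cost (Q π) p) ≲ Q
cost-≲ p = ≲-+ (const-≲ (ops p) Q≥1) (queries p , λ _ → ≤-refl)

≤-*ˡ : ∀ {a b} → 1 ≤ a → b ≤ a * b
≤-*ˡ {a} {b} 1≤a = ≤-trans (≤-reflexive (sym (*-identityˡ b))) (*-monoˡ-≤ b 1≤a)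

≤-*ʳ : ∀ {a b} → 1 ≤ b → a ≤ a * b
≤-*ʳ {a} {b} 1≤b = ≤-trans (≤-reflexive (sym (*-identityʳ a))) (*-monoʳ-≤ a 1≤b)

1≤* : ∀ {a b} → 1 ≤ a → 1 ≤ b → 1 ≤ a * b
1≤* = *-mono-≤

module Asymptotics where
  module C (π : Sizes) = Costs (Q π) (n π) (t π) (k π)

  -- `work` is the order of one search: k slots at each of n vertices and, for each of t roots,
  -- about t queries.
  tQ work total : Sizes → ℕ
  tQ π = t π * Q π
  work π = k π * n π + t π * tQ π
  total π = bound (k π) (n π) (t π) (Q π)

  tQ≥1 : ∀ π → 1 ≤ tQ π
  tQ≥1 π = 1≤* (t≥1 π) (Q≥1 π)

  kn≤work : (λ π → k π * n π) ≲ work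
  kn≤work = ≤⇒≲ (λ π → m≤m+n _ _)

  ttQ≤work : (λ π → t π * tQ π) ≲ work
  ttQ≤work = ≤⇒≲ (λ π → m≤n+m _ (k π * n π))

  work≥1 : ∀ π → 1 ≤ work π
  work≥1 π = ≤-trans (1≤* (k≥1 π) (n≥1 π)) (m≤m+n _ _)

  n≤work : n ≲ work
  n≤work = ≲-trans (≤⇒≲ (λ π → ≤-*ˡ (k≥1 π))) kn≤work

  t≤work : t ≲ work
  t≤work = ≲-trans (≤⇒≲ (λ π → ≤-*ʳ (tQ≥1 π))) ttQ≤work

  times-const : ∀ m → (λ π → f π * m) ≲ f
  times-const m = m , λ π → ≤-reflexive (*-comm _ m)

  exchange-≲ : (λ π → cost (Q π) exchangeP) ≲ Q
  exchange-≲ = cost-≲ exchangeP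

  root-≲ : C.rootCost ≲ tQ
  root-≲ = ≲-+ {f = λ π → cost (Q π) rootTestP} (≲-trans (cost-≲ rootTestP) (≤⇒≲ (λ π → ≤-*ˡ (t≥1 π))))
    (≲-const+ 5 tQ≥1 (≲-+ (≲-* (≲-refl {t}) (≲-+ {f = λ π → cost (Q π) exchangeP} exchange-≲
        (const-≲ 8 Q≥1))) (const-≲ 6 tQ≥1)))

  -- A scan involves no query here, since root tests are charged to the potential. `cost 0` stands
  -- for the cost of a program without queries, whose multiple of `Q` reduces to 0.
  scan-≲ : C.scanCost ≲ k
  scan-≲ = ≲-const+ (cost 0 startScanP) k≥1 (≲-+ (times-const _) (const-≲ 6 k≥1))

  scan-all-≲ : (λ π → n π * ((2 + (4 + C.scanCost π)) + 8)) ≲ work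
  scan-all-≲ = ≲-trans (≲-trans (≲-* (≲-refl {n}) (≲-+ {f = λ π → 6 + C.scanCost π}
      (≲-const+ 6 k≥1 scan-≲) (const-≲ 8 k≥1)))
    (≤⇒≲ (λ π → ≤-reflexive (*-comm (n π) (k π))))) kn≤work

  roots-all-≲ : (λ π → C.rootCost π * suc (t π)) ≲ work
  roots-all-≲ = ≲-trans (≲-* root-≲ (≲-const+ 1 t≥1 ≲-refl))
      (≲-trans (≤⇒≲ (λ π → ≤-reflexive (*-comm (tQ π) (t π)))) ttQ≤work)

  search-≲ : C.searchCost ≲ work
  search-≲ = ≲-+
    (≲-+ (≲-+ (≲-trans (times-const _) n≤work) (const-≲ 6 work≥1)) (≲-+ (≲-trans (times-const _) t≤work)
        (const-≲ 6 work≥1)))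
    (≲-const+ (cost 0 startSearchP) work≥1 (≲-+ {f = λ π → n π * ((2 + (4 + C.scanCost π)) + 8) + 6}
        (≲-+ scan-all-≲ (const-≲ 6 work≥1)) roots-all-≲))

  insert-≲ : C.insertCost ≲ work
  insert-≲ = ≲-+ {f = C.searchCost} search-≲ (≲-const+ 2 work≥1
    (≲-+ {f = C.walkCost} (≲-const+ (cost 0 startWalkP) work≥1 (≲-+ (≲-trans (times-const _) n≤work)
        (const-≲ 6 work≥1))) (const-≲ (cost 0 placeCopyP) work≥1)))

  kwork : Sizes → ℕ
  kwork π = k π * work π

  kwork≥1 : ∀ π → 1 ≤ kwork π
  kwork≥1 π = 1≤* (k≥1 π) (work≥1 π)

  copies-≲ : C.copiesCost ≲ kwork
  copies-≲ = ≲-+ {f = λ π → suc (k π) * (cost 0 copyP + 8)}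
    (≲-trans (≲-trans (times-const _) (≲-const+ 1 k≥1 ≲-refl)) (≤⇒≲ (λ π → ≤-*ʳ (work≥1 π))))
        (const-≲ 6 kwork≥1)

  insertions-≲ : (λ π → suc (k π) * ((2 + C.insertCost π) + 8)) ≲ kwork
  insertions-≲ = ≲-* (≲-const+ 1 k≥1 ≲-refl) (≲-+ {f = λ π → 2 + C.insertCost π}
      (≲-const+ 2 work≥1 insert-≲) (const-≲ 8 work≥1))

  clean-≲ : (λ π → k π * n π * (cost (Q π) cleanP + 8)) ≲ kwork
  clean-≲ = ≲-trans (times-const _) (≲-trans kn≤work (≤⇒≲ (λ π → ≤-*ˡ (k≥1 π))))

  edge-≲ : C.edgeCost ≲ kwork
  edge-≲ = ≲-const+ (cost 0 startEdgeP) kwork≥1 (≲-+ {f = C.copiesCost} copies-≲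
    (≲-+ {f = λ π → suc (k π) * ((2 + C.insertCost π) + 8) + 6} (≲-+ {f = λ π → suc (k π) *
        ((2 + C.insertCost π) + 8)} insertions-≲ (const-≲ 6 kwork≥1))
      (≲-const+ 2 kwork≥1 (≲-+ clean-≲ (const-≲ 6 kwork≥1)))))

  total-split : ∀ a b c d → a * b * (a * (a * b + c * (c * d))) ≡ (a * (a * (a * 1))) * (b * (b * 1)) +
      (a * (a * 1)) * b * (c * (c * 1)) * d
  total-split = solve-∀

  -- k n edges with O(k) searches of order `work` each give k³n² + k²nt²Q, and k ≥ 1 raises the
  -- first term to k⁴n².
  edges-total : (λ π → k π * n π * kwork π) ≲ total
  edges-total = ≤⇒≲ λ π → ≤-trans (≤-reflexive (total-split (k π) (n π) (t π) (Q π)))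
    (+-monoˡ-≤ _ (*-monoˡ-≤ (n π ^ 2) (≤-*ˡ (k≥1 π))))

  total≥1 : ∀ π → 1 ≤ total π
  total≥1 π = ≤-trans (1≤* (1≤^ 4 (k≥1 π)) (1≤^ 2 (n≥1 π))) (m≤m+n _ _)
    where
    1≤^ : ∀ {a} i → 1 ≤ a → 1 ≤ a ^ i
    1≤^ zero    _ = ≤-refl
    1≤^ (suc i) h = 1≤* h (1≤^ i h)

  edges-≲ : (λ π → C.edgesCost π (k π * n π)) ≲ total
  edges-≲ = ≲-+ (≲-trans (≲-* (≲-refl {λ π → k π * n π}) (≲-+ {f = λ π → 2 + C.edgeCost π}
      (≲-const+ 2 kwork≥1 edge-≲) (const-≲ 8 kwork≥1))) edges-total) (const-≲ 6 total≥1)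

  nwork-total : (λ π → n π * work π) ≲ total
  nwork-total = ≲-trans (≲-* (≤⇒≲ (λ π → ≤-*ˡ (k≥1 π))) (≤⇒≲ (λ π → ≤-*ˡ (k≥1 π)))) edges-total

  work-total : work ≲ total
  work-total = ≲-trans (≤⇒≲ (λ π → ≤-*ˡ (n≥1 π))) nwork-total

  tQ≤work : tQ ≲ work
  tQ≤work = ≲-trans (≤⇒≲ (λ π → ≤-*ˡ (t≥1 π))) ttQ≤work

  check-≲ : C.checkRootsCost ≲ total
  check-≲ = ≲-+ (≲-trans (≲-* (≲-refl {n}) (≲-+ {f = C.checkVertexCost} vertex-≲
      (const-≲ 8 work≥1))) nwork-total) (const-≲ 6 total≥1)
    where
    vertex-≲ : C.checkVertexCost ≲ work
    vertex-≲ = ≲-+ (≲-+ (≲-trans (times-const _) t≤work) (const-≲ 6 work≥1))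
                   (≲-trans (cost-≲ answerP) (≲-trans (≤⇒≲ (λ π → ≤-*ˡ (t≥1 π))) tQ≤work))

  place-≲ : C.placeRootsCost ≲ total
  place-≲ = ≲-const+ 4 total≥1
    (≲-+ (≲-+ (≲-trans (times-const _) (≲-trans n≤work work-total)) (const-≲ 6 total≥1))
         (≲-+ (≲-trans (times-const _) (≲-trans t≤work work-total)) (const-≲ 6 total≥1)))

  checked-≲ : C.checkedCost ≲ total
  checked-≲ = ≲-+ {f = C.checkRootsCost} check-≲ (≲-const+ 2 total≥1
      (≲-+ {f = C.placeRootsCost} place-≲ edges-≲))

  abstract
    main-≲ : C.mainCost ≲ total
    main-≲ = ≲-const+ 2 total≥1
      (≲-+ (≲-+ (≲-trans (≲-trans (times-const {k} _) (≤⇒≲ (λ π → ≤-*ʳ (n≥1 π))))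
          (≲-trans kn≤work work-total)) (const-≲ 6 total≥1))
      (≲-+ {f = λ π → 16 + C.checkedCost π} (≲-const+ 16 total≥1 checked-≲) (const-≲ 6 total≥1)))

-- The whole program, and the case k = 0.

answers : ∀ {P : Set} s → (regs s $ok ≢ 0 → P) → (regs s $ok ≡ 0 → ¬ P) →
          Answers (setReg s $n (1 ∸ (1 ∸ regs s $ok))) P
answers s good bad with regs s $ok
... | zero  = inj₂ (refl , bad refl)
... | suc r = inj₁ (cong (1 ∸_) (0∸n≡0 r) , good λ ())

module _ {t : ℕ} (M : Matroid t) (Q : ℕ) where
  open Logic M Q

  run-multiply : ∀ s {a b} → regs s $k ≡ a → regs s $n ≡ b →
                 Run still multiplyP s (2 + (a * (4 + 8) + 6)) (λ s′ → regs s′ $N ≡ a * b)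
  run-multiply s {a} {b} k≡ n≡ = run-seq (run-flat ($N ≔ lit 0)
      (λ s′ → s′ ≡ setReg s $N 0) refl) λ { _ _ refl →
    run-for $l $k ($N ≔ reg $N ⊕ reg $n) (λ i s′ → regs s′ $N ≡ i * b) refl refl refl
        (λ _ _ → refl) k≡ refl
      λ i s₁ _ sm _ N≡ → run-flat ($N ≔ reg $N ⊕ reg $n) (λ s′ → regs s′ $N ≡ suc i * b)
        (trans (cong₂ _+_ N≡ (trans (sameReg sm $n refl) n≡)) (+-comm (i * b) b)) }

module _ (n-1 E : ℕ) (ends : Fin E → Fin (suc n-1) × Fin (suc n-1))
         {t : ℕ} (root : Fin t → Fin (suc n-1)) (M : Matroid t) (k Q : ℕ) (rank≡k : rank M ⊤ ≡ k) where
  open Certificates n-1 E ends root M k using (G)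
  open Conditions G root M k
  open Logic M Q
  open MainProgram n-1 E ends root M k Q rank≡k
  open Costs Q (suc n-1) t k

  run-main : k ≢ 0 → Run still mainP (input G root k) mainCost (λ s → Answers s (C1 × C2 × C3))
  run-main k≢0 = run-seq (run-multiply M Q s₀ refl refl) λ s₁ sm₁ N≡ →
    let ok₁ = sameReg sm₁ $ok refl
        k₁ = sameReg sm₁ $k refl
        C3-test = λ (eq : E + t ≡ k * suc n-1) → trans (cong₂ (λ a b → (a ∸ b) + (b ∸ a))
          (cong₂ _+_ (sameReg sm₁ $E refl) (sameReg sm₁ $t refl)) (trans N≡ (sym eq))) (distance-refl
              (E + t))
    in run-seq {R = λ s → (regs s $ok ≢ 0 → C1 × C2 × C3) × (regs s $ok ≡ 0 → ¬ (C1 × C2 × C3))}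
      (run-if
        (λ ¬c3 → run-≤ (s≤s z≤n) (run-flat skip _
          ((λ nz → ⊥-elim (nz ok₁)) , λ _ (_ , _ , c3) → ¬c3 (C3-test c3))))
        (λ eq → let c3 = trans (sym (cong₂ _+_ (sameReg sm₁ $E refl) (sameReg sm₁ $t refl))) (trans (distance-zero _ _ eq) N≡) in
          run-seq (run-flat ($ok ≔ lit 1) (λ s → s ≡ setReg s₁ $ok 1) refl) λ { _ _ refl →
            run-if
              (λ _ → run-map (λ _ (good , bad) → (λ ok → let c1 , c2 = good ok in c1 , c2 , c3) ,
                                                 λ z (c1 , c2 , _) → bad z (c1 , c2))
                (run-checked (setReg s₁ $ok 1)
                  (base (sameReg sm₁ $n refl) (sameReg sm₁ $E refl) (sameReg sm₁ $t refl) k₁ N≡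
                      (sameArray sm₁ aρ refl))
                  (initial (sameArray sm₁ a₀ refl) (sameArray sm₁ a₁ refl) (zero-arrays s₁ sm₁))
                  refl (≤-trans (m≤m+n E t) (≤-reflexive c3))))
              (λ z → ⊥-elim (k≢0 (trans (sym k₁) z))) }))
      λ s₂ _ (good , bad) → run-flat answerOkP (λ s → Answers s (C1 × C2 × C3)) (answers s₂ good bad)
    where
    s₀ = input G root k
    zero-arrays : ∀ s₁ → Same multiplyP s₀ s₁ → ∀ a → 3 ≤ a → ∀ i → arrays s₁ a i ≡ 0
    zero-arrays s₁ sm (suc (suc (suc a))) _ i = cong (λ f → f i) (sameArray sm (suc (suc (suc a))) refl)
    zero-arrays s₁ sm 1 (s≤s ()) i
    zero-arrays s₁ sm 2 (s≤s (s≤s ())) i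

-- For k = 0 the product takes no rounds, and (C3) either fails or leaves neither edges nor roots,
-- so that (C1) and (C2) are trivial. The 31 steps are 8 for the product, 17 for the decision and 6
-- for the answer.
run-rank-zero : ∀ G {t} (root : Fin t → Fin (Graph.|V| G)) (M : Matroid t) Q →
  let open Conditions G root M 0
      open Logic M Q
  in Run still mainP (input G root 0) 31 (λ s → Answers s (C1 × C2 × C3))
run-rank-zero G {t} root M Q = run-seq {B = 8} (run-multiply M Q s₀ refl refl) λ s₁ sm₁ N≡ →
    let ok₁ = sameReg sm₁ $ok refl
        C3-test = λ (eq : E + t ≡ 0) → trans (cong₂ (λ a b → (a ∸ b) + (b ∸ a))
          (cong₂ _+_ (sameReg sm₁ $E refl) (sameReg sm₁ $t refl)) (trans N≡ (sym eq))) (distance-refl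
              (E + t))
    in run-seq {B = 17} {R = λ s → (regs s $ok ≢ 0 → C1 × C2 × C3) × (regs s $ok ≡ 0 → ¬ (C1 × C2 × C3))}
      (run-if
        (λ ¬c3 → run-≤ (s≤s z≤n) (run-flat skip _
          ((λ nz → ⊥-elim (nz ok₁)) , λ _ (_ , _ , c3) → ¬c3 (C3-test c3))))
        (λ eq → let c3 = trans (sym (cong₂ _+_ (sameReg sm₁ $E refl) (sameReg sm₁ $t refl))) (trans (distance-zero _ _ eq) N≡) in
          run-seq (run-flat ($ok ≔ lit 1) (λ s → s ≡ setReg s₁ $ok 1) refl) λ { _ _ refl →
            run-if (λ k≢0 → ⊥-elim (k≢0 (sameReg sm₁ $k refl)))
                   (λ _ → run-flat skip _ ((λ _ → trivial c3) , λ ())) }))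
      λ s₂ _ (good , bad) → run-flat answerOkP (λ s → Answers s (C1 × C2 × C3)) (answers s₂ good bad)
  where
  open Conditions G root M 0
  open Logic M Q
  E = Graph.|E| G
  s₀ = input G root 0
  trivial : E + t ≡ 0 → C1 × C2 × C3
  trivial eq = (λ v → Matroid.hereditary M (λ {i} _ → ⊥-elim (n≮0 (subst (toℕ i <_) (m+n≡0⇒n≡0 E eq)
      (toℕ<n i)))) (Matroid.⊥-indep M)) ,
    (λ F (e , _) → ⊥-elim (n≮0 (subst (toℕ e <_) (m+n≡0⇒m≡0 E eq) (toℕ<n e)))) , eq

halts : ∀ {t} (M : Matroid t) Q {p s B B′} {R : State → Set} → let open Semantics M Q in
        Logic.Run M Q (Logic.still M Q) p s B R → B ≤ B′ → ∃[ s′ ] ∃[ T ] (p ∶ s ⇓ s′ # T) × T ≤ B′ ×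
            R s′
halts M Q (Logic.run d le r) B≤ = _ , _ , d , ≤-trans (subst₂ _≤_ (+-identityʳ _)
    (+-identityʳ _) le) B≤ , r

theorem4p3 :
    ∃[ p ] ∃[ c ]
      ((G : Graph) (t : ℕ) (root : Fin t → Fin (Graph.|V| G)) (M : Matroid t)
       (k : ℕ) → rank M ⊤ ≡ k → (Q : ℕ) → 1 ≤ Q →
       let open Conditions G root M k
           open Semantics M Q
       in ∃[ s ] ∃[ T ]
            (p ∶ input G root k ⇓ s # T)
            × T ≤ c * suc (bound k (Graph.|V| G) t Q)
            × Answers s (C1 × C2 × C3))
-- The 31 pays for k = 0, where `bound` vanishes, and `c` for k ≥ 1.
theorem4p3 = mainP , 31 + c , decide
  where
  c = proj₁ Asymptotics.main-≲
  decide : (G : Graph) (t : ℕ) (root : Fin t → Fin (Graph.|V| G)) (M : Matroid t)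
       (k : ℕ) → rank M ⊤ ≡ k → (Q : ℕ) → 1 ≤ Q →
       let open Conditions G root M k
           open Semantics M Q
       in ∃[ s ] ∃[ T ]
            (mainP ∶ input G root k ⇓ s # T)
            × T ≤ (31 + c) * suc (bound k (Graph.|V| G) t Q)
            × Answers s (C1 × C2 × C3)
  decide G t root M zero _ Q _ =
    halts M Q (run-rank-zero G root M Q) (≤-trans (m≤m+n 31 c) (m≤m*n (31 + c)
        (suc (bound 0 (Graph.|V| G) t Q))))
  decide (record { |V| = suc n-1 ; |E| = E ; ends = ends }) t root M (suc k-1) rank≡k Q Q≥1 =
    halts M Q (run-main n-1 E ends root M (suc k-1) Q rank≡k (λ ()))
      (≤-trans (proj₂ Asymptotics.main-≲ sizes) (*-mono-≤ (m≤n+m c 31)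
          (n≤1+n (Asymptotics.total sizes))))
    where
    sizes : Sizes
    sizes = record { n = suc n-1 ; t = t ; k = suc k-1 ; Q = Q ; n≥1 = s≤s z≤n ; k≥1 = s≤s z≤n ; Q≥1 = Q≥1
                   ; t≥1 = ≤-trans (s≤s z≤n) (subst (_≤ t) rank≡k (MatroidProperties.rank-≤-size M ⊤)) }
  -- A positive rank requires a root, and a root requires a vertex, so an empty vertex set cannot
  -- occur here.
  decide (record { |V| = zero }) (suc t-1) root M (suc k-1) rank≡k Q Q≥1 = case root Fin.zero of λ ()
  decide (record { |V| = zero }) zero root M (suc k-1) rank≡k Q Q≥1 =
    ⊥-elim (n≮0 (subst (_≤ 0) rank≡k (MatroidProperties.rank-≤-size M ⊤)))
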